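{- Let $a\ge2$ be an integer. The orbits of rowmotion on the fence $\breve F(a,a,a,a)$ can be partitioned into four sets $\mathcal S,\mathcal M,\mathcal L,\mathcal G$ having the following properties. (a) We have $$\#\mathcal S=(a-1)^3,\quad \#\mathcal M=a,\quad \#\mathcal L=1,\quad \#\mathcal G=a-1,$$ and $$\#\mathcal O=\begin{cases}a&\text{if }\mathcal O\in\mathcal S,\\ a+1&\text{if }\mathcal O\in\mathcal M,\\ a^2+a+1&\text{if }\mathcal O\in\mathcal L,\\ 3a^2+a&\text{if }\mathcal O\in\mathcal G.\end{cases}$$ (b) The statistics $\chi$ and $\hat\chi$ are homometric under rowmotion, with values $$\chi(\mathcal O)=\begin{cases}4a-4&\text{if }\mathcal O\in\mathcal S,\\ 4a-2&\text{if }\mathcal O\in\mathcal M,\\ 4a^2-a&\text{if }\mathcal O\in\mathcal L,\\ 12a^2-11a+2&\text{if }\mathcal O\in\mathcal G,\end{cases}\qquad \hat\chi(\mathcal O)=\begin{cases}2a^2-a&\text{if }\mathcal O\in\mathcal S,\\ 2a^2+3a-1&\text{if }\mathcal O\in\mathcal M,\\ 2a^3+3a-1&\text{if }\mathcal O\in\mathcal L,\\ 6a^3-a&\text{if }\mathcal O\in\mathcal G.\end{cases}$$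
   Context: The fence $\breve F(a,a,a,a)$ is the poset on $x_1,\dots,x_{4a-1}$ with covering relations $x_1\lhd\cdots\lhd x_a\rhd x_{a+1}\rhd\cdots\rhd x_{2a}\lhd x_{2a+1}\lhd\cdots\lhd x_{3a}\rhd x_{3a+1}\rhd\cdots\rhd x_{4a-1}$. For a finite poset $P$, rowmotion on antichains is the bijection $\rho$ on the set of antichains sending $A$ to the set of minimal elements of $P\setminus I$, where $I$ is the (lower order) ideal generated by $A$. Rowmotion on ideals is the bijection $\hat\rho$ on the set of ideals sending $I$ to the ideal generated by the minimal elements of $P\setminus I$. Orbits are those of the cyclic groups generated by these maps; $A\mapsto$ (ideal generated by $A$) gives a size-preserving bijection between orbits of $\rho$ and of $\hat\rho$, and corresponding orbits are denoted by the same letter. For an orbit $\mathcal O$, $\chi(\mathcal O)=\sum_A\#A$ over the antichains in the orbit, and $\hat\chi(\mathcal O)=\sum_I\#I$ over the ideals in the orbit. A statistic $\mathrm{st}$ is homometric if $\#\mathcal O_1=\#\mathcal O_2$ implies $\mathrm{st}(\mathcal O_1)=\mathrm{st}(\mathcal O_2)$ for all orbits $\mathcal O_1,\mathcal O_2$, where $\mathrm{st}(\mathcal O)$ is the sum of $\mathrm{st}$ over $\mathcal O$. -}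

module Defs where

open import Data.Empty using (⊥-elim)
open import Data.Fin using (Fin; toℕ; _≟_)
open import Data.Fin.Induction using (po-noetherian)
open import Data.Fin.Properties using (any?; all?)
open import Data.Fin.Subset using (Subset; _∈_; _⊆_; ∁; ∣_∣)
open import Data.Fin.Subset.Properties using (_∈?_; ⊆-antisym)
open import Data.Irrelevant using ([_])
open import Data.List using (List; length; map; concat)
import Data.List.Membership.Propositional as List
import Data.List.Membership.Propositional.Properties as List
import Data.List.Membership.Setoid as Membership
open import Data.List.Relation.Binary.BagAndSetEquality using (set; [_]-Equality)
open import Data.List.Relation.Unary.Unique.Propositional using (Unique)
import Data.List.Relation.Unary.Unique.Propositional.Properties as Unique
import Data.List.Relation.Unary.Unique.Setoid as UniqueSetoid
open import Data.Nat as ℕ using (ℕ; suc; _+_; _*_; _∸_; _≤_; _<_; _⊓_)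
import Data.Nat.Induction as ℕ
open import Data.Nat.ListAction using (sum)
import Data.Nat.Properties as ℕ
open import Data.Product using (∃; _×_; _,_; proj₁; proj₂)
open import Data.Refinement using (Refinement-syntax; _,_; value)
open import Data.Sum using (_⊎_; inj₁; inj₂)
open import Data.Vec using (tabulate)
open import Data.Vec.Properties using (lookup∘tabulate; []=⇒lookup; lookup⇒[]=)
open import Function using (_∘_; _⇔_; mk⇔; Equivalence)
open import Induction.WellFounded using (Acc; acc)
open import Level using (0ℓ)
open import Relation.Binary using (Rel; Setoid; IsDecPartialOrder)
import Relation.Binary as B
open import Relation.Binary.Construct.Closure.Equivalence as EqClosure using (EqClosure)
open import Relation.Binary.Construct.Closure.ReflexiveTransitive using (Star; ε; _◅_; _◅◅_)
import Relation.Binary.Construct.On as On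
open import Relation.Binary.PropositionalEquality
open import Relation.Nullary using (¬_; Dec; yes; no; does; recompute)
open import Relation.Nullary.Decidable using (map′; dec-true; ¬?; _×-dec_; _→-dec_; _⊎-dec_)
import Relation.Unary as U

-- `f` is meant to be a bijection: the classes of the equivalence generated
-- by its graph are then the orbits of the cyclic group ⟨ f ⟩.

_∼⟨_⟩_ : {X : Set} → X → (X → X) → X → Set
x ∼⟨ f ⟩ y = EqClosure (λ u v → f u ≡ v) x y

-- A finite orbit is given by a repetition-free enumeration; the choice of
-- the base point and of the enumeration is disregarded by `OrbitSetoid`.

record Orbit {X : Set} (f : X → X) : Set where
  field
    base     : X
    elements : List X
    unique   : Unique elements
    orbit    : ∀ x → x List.∈ elements ⇔ base ∼⟨ f ⟩ x

open Orbit public using (elements)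

module _ {X : Set} {f : X → X} where

  #_ : Orbit f → ℕ
  # O = length (elements O)

  total : (X → ℕ) → Orbit f → ℕ
  total st O = sum (map st (elements O))

OrbitSetoid : {X : Set} → (X → X) → Setoid 0ℓ 0ℓ
OrbitSetoid {X} f = On.setoid {B = Orbit f} ([ set ]-Equality X) elements

_∈ₒ_ : {X : Set} {f : X → X} → Orbit f → List (Orbit f) → Set
_∈ₒ_ {f = f} = Membership._∈_ (OrbitSetoid f)

-- A set of orbits is a list without repetitions, so that its cardinality is
-- the length of the list. Uniqueness in the concatenation says both that each
-- block is repetition-free and that distinct blocks are disjoint.

PartitionsOrbits : {X : Set} (f : X → X) → List (List (Orbit f)) → Set
PartitionsOrbits f blocks =
  UniqueSetoid.Unique (OrbitSetoid f) (concat blocks) ×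
  (∀ (O : Orbit f) → O ∈ₒ concat blocks)

Homometric : {X : Set} → (X → X) → (X → ℕ) → Set
Homometric f st = ∀ (O₁ O₂ : Orbit f) → # O₁ ≡ # O₂ → total st O₁ ≡ total st O₂

module _ {X Y : Set} {f : X → X} {g : Y → Y}
         (φ : X → Y) (ψ : Y → X)
         (ψ∘φ : ∀ x → ψ (φ x) ≡ x) (φ∘ψ : ∀ y → φ (ψ y) ≡ y)
         (commutes : ∀ x → φ (f x) ≡ g (φ x)) where

  private
    φ-∼ : ∀ {x x′} → x ∼⟨ f ⟩ x′ → φ x ∼⟨ g ⟩ φ x′
    φ-∼ = EqClosure.gmap φ λ { {x} refl → sym (commutes x) }

    ψ-∼ : ∀ {y y′} → y ∼⟨ g ⟩ y′ → ψ y ∼⟨ f ⟩ ψ y′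
    ψ-∼ = EqClosure.gmap ψ λ { {y} refl → trans (sym (ψ∘φ (f (ψ y))))
      (cong ψ (trans (commutes (ψ y)) (cong g (φ∘ψ y)))) }

  mapOrbit : Orbit f → Orbit g
  mapOrbit O = record
    { base     = φ base
    ; elements = map φ (elements O)
    ; unique   = Unique.map⁺ (λ {x} {y} eq → trans (sym (ψ∘φ x)) (trans (cong ψ eq) (ψ∘φ y))) unique
    ; orbit    = λ y → mk⇔ (to y) (from y)
    }
    where
    open Orbit O using (base; unique; orbit)
    to : ∀ y → y List.∈ map φ (elements O) → φ base ∼⟨ g ⟩ y
    to y y∈ with List.∈-map⁻ φ y∈
    ... | x , x∈ , refl = φ-∼ (Equivalence.to (orbit x) x∈)
    from : ∀ y → φ base ∼⟨ g ⟩ y → y List.∈ map φ (elements O)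
    from y r = subst (List._∈ map φ (elements O)) (φ∘ψ y)
      (List.∈-map⁺ φ (Equivalence.from (orbit (ψ y))
        (subst (_∼⟨ f ⟩ ψ y) (ψ∘φ base) (ψ-∼ r))))

⟦_⟧ : ∀ {n} {P : Fin n → Set} → U.Decidable P → Subset n
⟦ P? ⟧ = tabulate (does ∘ P?)

module _ {n} {P : Fin n → Set} (P? : U.Decidable P) where

  ∈⟦⟧⁺ : ∀ {x} → P x → x ∈ ⟦ P? ⟧
  ∈⟦⟧⁺ {x} p = lookup⇒[]= x ⟦ P? ⟧ (trans (lookup∘tabulate (does ∘ P?) x) (dec-true (P? x) p))

  ∈⟦⟧⁻ : ∀ {x} → x ∈ ⟦ P? ⟧ → P x
  ∈⟦⟧⁻ {x} x∈ with P? x | trans (sym (lookup∘tabulate (does ∘ P?) x)) ([]=⇒lookup x∈)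
  ... | yes p | _ = p
  ... | no _  | ()

module Rowmotion {n : ℕ} {_≼_ : Rel (Fin n) 0ℓ} (isDPO : IsDecPartialOrder _≡_ _≼_) where

  private
    module ≼ = IsDecPartialOrder isDPO
    _≼?_ = ≼._≤?_

  Minimal Maximal : Subset n → Fin n → Set
  Minimal S x = x ∈ S × (∀ y → y ∈ S → y ≼ x → y ≡ x)
  Maximal S x = x ∈ S × (∀ y → y ∈ S → x ≼ y → x ≡ y)

  minimal? : ∀ S → U.Decidable (Minimal S)
  minimal? S x = (x ∈? S) ×-dec all? λ y → (y ∈? S) →-dec (y ≼? x) →-dec (y ≟ x)

  maximal? : ∀ S → U.Decidable (Maximal S)
  maximal? S x = (x ∈? S) ×-dec all? λ y → (y ∈? S) →-dec (x ≼? y) →-dec (x ≟ y)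

  minimals maximals : Subset n → Subset n
  minimals S = ⟦ minimal? S ⟧
  maximals S = ⟦ maximal? S ⟧

  below? : ∀ S → U.Decidable (λ x → ∃ λ y → y ∈ S × x ≼ y)
  below? S x = any? λ y → (y ∈? S) ×-dec (x ≼? y)

  ↓_ : Subset n → Subset n
  ↓ S = ⟦ below? S ⟧

  IsAntichain IsIdeal : Subset n → Set
  IsAntichain S = ∀ x y → x ∈ S → y ∈ S → x ≼ y → x ≡ y
  IsIdeal     S = ∀ x y → x ∈ S → y ≼ x → y ∈ S

  -- The proofs are irrelevant, so that _≡_ on these types is equality of
  -- the underlying subsets.

  Antichain Ideal : Set
  Antichain = [ S ∈ Subset n ∣ IsAntichain S ]
  Ideal     = [ S ∈ Subset n ∣ IsIdeal S ]

  minimals-isAntichain : ∀ S → IsAntichain (minimals S)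
  minimals-isAntichain S x y x∈ y∈ x≼y =
    proj₂ (∈⟦⟧⁻ (minimal? S) y∈) x (proj₁ (∈⟦⟧⁻ (minimal? S) x∈)) x≼y

  maximals-isAntichain : ∀ S → IsAntichain (maximals S)
  maximals-isAntichain S x y x∈ y∈ x≼y =
    proj₂ (∈⟦⟧⁻ (maximal? S) x∈) y (proj₁ (∈⟦⟧⁻ (maximal? S) y∈)) x≼y

  ↓-isIdeal : ∀ S → IsIdeal (↓ S)
  ↓-isIdeal S x y x∈ y≼x with ∈⟦⟧⁻ (below? S) x∈
  ... | z , z∈ , x≼z = ∈⟦⟧⁺ (below? S) (z , z∈ , ≼.trans y≼x x≼z)

  ρ : Antichain → Antichain
  ρ A = minimals (∁ (↓ value A)) , [ minimals-isAntichain _ ]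

  ρ̂ : Ideal → Ideal
  ρ̂ I = ↓ minimals (∁ (value I)) , [ ↓-isIdeal _ ]

  size : ∀ {P : Subset n → Set} → [ S ∈ Subset n ∣ P S ] → ℕ
  size S = ∣ value S ∣

  generate : Antichain → Ideal
  generate A = ↓ value A , [ ↓-isIdeal _ ]

  generate⁻¹ : Ideal → Antichain
  generate⁻¹ I = maximals (value I) , [ maximals-isAntichain _ ]

  private
    refine-≡ : ∀ {P : Subset n → Set} {A B : [ S ∈ Subset n ∣ P S ]} →
               value A ≡ value B → A ≡ B
    refine-≡ {A = _ , _} {B = _ , _} refl = refl

    maximal-above : ∀ S x → x ∈ S → ∃ λ y → Maximal S y × x ≼ y
    maximal-above S x x∈ = go x x∈ (po-noetherian ≼.isPartialOrder x)
      where
      go : ∀ x → x ∈ S → Acc (λ u v → v ≼ u × ¬ (v ≡ u)) x → ∃ λ y → Maximal S y × x ≼ y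
      go x x∈ (acc rec) with any? (λ y → (y ∈? S) ×-dec ((x ≼? y) ×-dec ¬? (x ≟ y)))
      ... | yes (y , y∈ , x≼y , x≢y) with go y y∈ (rec (x≼y , x≢y))
      ...   | z , z-max , y≼z = z , z-max , ≼.trans x≼y y≼z
      go x x∈ (acc rec) | no ¬above = x , (x∈ , max) , ≼.refl
        where
        max : ∀ y → y ∈ S → x ≼ y → x ≡ y
        max y y∈ x≼y with x ≟ y
        ... | yes x≡y = x≡y
        ... | no  x≢y = ⊥-elim (¬above (y , y∈ , x≼y , x≢y))

  generate⁻¹∘generate : ∀ A → generate⁻¹ (generate A) ≡ A
  generate⁻¹∘generate (A , [ A-antichain ]) = refine-≡ (⊆-antisym ⊆₁ ⊆₂)
    where
    antichain : IsAntichain A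
    antichain x y x∈ y∈ x≼y = recompute (x ≟ y) (A-antichain x y x∈ y∈ x≼y)
    in↓ : ∀ {x} → x ∈ A → x ∈ ↓ A
    in↓ {x} x∈ = ∈⟦⟧⁺ (below? A) (x , x∈ , ≼.refl)
    ⊆₁ : maximals (↓ A) ⊆ A
    ⊆₁ {x} x∈ with ∈⟦⟧⁻ (maximal? (↓ A)) x∈
    ... | x∈↓ , max with ∈⟦⟧⁻ (below? A) x∈↓
    ...   | y , y∈ , x≼y = subst (_∈ A) (sym (max y (in↓ y∈) x≼y)) y∈
    ⊆₂ : A ⊆ maximals (↓ A)
    ⊆₂ {x} x∈ = ∈⟦⟧⁺ (maximal? (↓ A)) (in↓ x∈ , max)
      where
      max : ∀ y → y ∈ ↓ A → x ≼ y → x ≡ y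
      max y y∈ x≼y with ∈⟦⟧⁻ (below? A) y∈
      ... | z , z∈ , y≼z = ≼.antisym x≼y
        (subst (y ≼_) (sym (antichain x z x∈ z∈ (≼.trans x≼y y≼z))) y≼z)

  generate∘generate⁻¹ : ∀ I → generate (generate⁻¹ I) ≡ I
  generate∘generate⁻¹ (I , [ I-ideal ]) = refine-≡ (⊆-antisym ⊆₁ ⊆₂)
    where
    ⊆₁ : ↓ maximals I ⊆ I
    ⊆₁ {x} x∈ with ∈⟦⟧⁻ (below? (maximals I)) x∈
    ... | y , y∈ , x≼y =
      recompute (x ∈? I) (I-ideal y x (proj₁ (∈⟦⟧⁻ (maximal? I) y∈)) x≼y)
    ⊆₂ : I ⊆ ↓ maximals I
    ⊆₂ {x} x∈ with maximal-above I x x∈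
    ... | y , y-max , x≼y = ∈⟦⟧⁺ (below? (maximals I)) (y , ∈⟦⟧⁺ (maximal? I) y-max , x≼y)

  -- The orbit of ρ̂ corresponding to an orbit of ρ.

  idealOrbit : Orbit ρ → Orbit ρ̂
  idealOrbit = mapOrbit generate generate⁻¹ generate⁻¹∘generate generate∘generate⁻¹ (λ _ → refl)

  χ : Orbit ρ → ℕ
  χ = total size

  χ̂ : Orbit ρ → ℕ
  χ̂ O = total size (idealOrbit O)

module _ {n : ℕ} {_⋖_ : Rel (Fin n) 0ℓ} (_⋖?_ : B.Decidable _⋖_)
         (rank : Fin n → ℕ) (rank-⋖ : ∀ {x y} → x ⋖ y → rank y < rank x) where

  private
    rank-≤ : ∀ {x y} → Star _⋖_ x y → rank y ≤ rank x
    rank-≤ ε         = ℕ.≤-refl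
    rank-≤ (c ◅ cs) = ℕ.≤-trans (rank-≤ cs) (ℕ.<⇒≤ (rank-⋖ c))

    antisym : ∀ {x y} → Star _⋖_ x y → Star _⋖_ y x → x ≡ y
    antisym ε        _  = refl
    antisym (c ◅ cs) ds =
      ⊥-elim (ℕ.<⇒≱ (rank-⋖ c) (ℕ.≤-trans (rank-≤ ds) (rank-≤ cs)))

    star? : ∀ x y → Acc _<_ (rank x) → Dec (Star _⋖_ x y)
    star? x y (acc rec) = map′ to from
      ((x ≟ y) ⊎-dec any? step?)
      where
      step? : ∀ z → Dec (x ⋖ z × Star _⋖_ z y)
      step? z with x ⋖? z
      ... | no ¬c = no (¬c ∘ proj₁)
      ... | yes c = map′ (c ,_) proj₂ (star? z y (rec (rank-⋖ c)))
      to : x ≡ y ⊎ (∃ λ z → x ⋖ z × Star _⋖_ z y) → Star _⋖_ x y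
      to (inj₁ refl)         = ε
      to (inj₂ (_ , c , cs)) = c ◅ cs
      from : Star _⋖_ x y → x ≡ y ⊎ (∃ λ z → x ⋖ z × Star _⋖_ z y)
      from ε        = inj₁ refl
      from (c ◅ cs) = inj₂ (_ , c , cs)

  star-isDecPartialOrder : IsDecPartialOrder _≡_ (Star _⋖_)
  star-isDecPartialOrder = record
    { isPartialOrder = record
      { isPreorder = record
        { isEquivalence = isEquivalence
        ; reflexive     = λ { refl → ε }
        ; trans         = _◅◅_
        }
      ; antisym = antisym
      }
    ; _≟_  = _≟_
    ; _≤?_ = λ x y → star? x y (ℕ.<-wellFounded (rank x))
    }

module Fence (a : ℕ) where

  Vertex : Set
  Vertex = Fin (4 * a ∸ 1)

  -- The vertex v is x_{index v}.

  index : Vertex → ℕ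
  index v = suc (toℕ v)

  data _⋖_ (u v : Vertex) : Set where
    rise₁ : index v ≡ suc (index u) →                  index v ≤ a     → u ⋖ v
    fall₁ : index u ≡ suc (index v) → a     ≤ index v → index u ≤ 2 * a → u ⋖ v
    rise₂ : index v ≡ suc (index u) → 2 * a ≤ index u → index v ≤ 3 * a → u ⋖ v
    fall₂ : index u ≡ suc (index v) → 3 * a ≤ index v                   → u ⋖ v

  _⋖?_ : B.Decidable _⋖_
  u ⋖? v = map′ to from
    (((index v ℕ.≟ suc (index u)) ×-dec (index v ℕ.≤? a)) ⊎-dec
    (((index u ℕ.≟ suc (index v)) ×-dec (a ℕ.≤? index v) ×-dec (index u ℕ.≤? 2 * a)) ⊎-dec
    (((index v ℕ.≟ suc (index u)) ×-dec (2 * a ℕ.≤? index u) ×-dec (index v ℕ.≤? 3 * a)) ⊎-dec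
     ((index u ℕ.≟ suc (index v)) ×-dec (3 * a ℕ.≤? index v)))))
    where
    to : _ → u ⋖ v
    to (inj₁ (p , q))                   = rise₁ p q
    to (inj₂ (inj₁ (p , q , r)))        = fall₁ p q r
    to (inj₂ (inj₂ (inj₁ (p , q , r)))) = rise₂ p q r
    to (inj₂ (inj₂ (inj₂ (p , q))))     = fall₂ p q
    from : u ⋖ v → _
    from (rise₁ p q)   = inj₁ (p , q)
    from (fall₁ p q r) = inj₂ (inj₁ (p , q , r))
    from (rise₂ p q r) = inj₂ (inj₂ (inj₁ (p , q , r)))
    from (fall₂ p q)   = inj₂ (inj₂ (inj₂ (p , q)))

  _≼_ : Rel Vertex 0ℓ
  _≼_ = Star _⋖_

  private
    -- distance to the nearest of the peaks x_a and x_{3a}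
    depth : ℕ → ℕ
    depth i = ℕ.∣ i - a ∣ ⊓ ℕ.∣ i - 3 * a ∣

    closer-below : ∀ {i p} → suc i ≤ p → ℕ.∣ suc i - p ∣ < ℕ.∣ i - p ∣
    closer-below {i} {p} i<p
      rewrite ℕ.m≤n⇒∣m-n∣≡n∸m i<p | ℕ.m≤n⇒∣m-n∣≡n∸m (ℕ.<⇒≤ i<p) =
      ℕ.∸-monoʳ-< (ℕ.n<1+n i) i<p

    closer-above : ∀ {i p} → p ≤ i → ℕ.∣ i - p ∣ < ℕ.∣ suc i - p ∣
    closer-above {i} {p} p≤i
      rewrite ℕ.m≤n⇒∣n-m∣≡n∸m p≤i | ℕ.m≤n⇒∣n-m∣≡n∸m (ℕ.m≤n⇒m≤1+n p≤i) =
      ℕ.∸-monoˡ-< (ℕ.n<1+n i) p≤i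

    a≤3a : a ≤ 3 * a
    a≤3a = ℕ.m≤m+n a _

    a≤2a : a ≤ 2 * a
    a≤2a = ℕ.m≤m+n a _

    2a≤3a : 2 * a ≤ 3 * a
    2a≤3a = ℕ.*-monoˡ-≤ a {2} {3} (ℕ.n≤1+n 2)

    2a∸a : 2 * a ∸ a ≡ a
    2a∸a = trans (ℕ.m+n∸m≡n a (1 * a)) (ℕ.*-identityˡ a)

    3a∸2a : 3 * a ∸ 2 * a ≡ a
    3a∸2a = ℕ.m+n∸n≡m a (2 * a)

    left-half : ∀ {i} → a ≤ i → i ≤ 2 * a → ℕ.∣ i - a ∣ ≤ ℕ.∣ i - 3 * a ∣
    left-half {i} a≤i i≤2a
      rewrite ℕ.m≤n⇒∣n-m∣≡n∸m a≤i | ℕ.m≤n⇒∣m-n∣≡n∸m (ℕ.≤-trans i≤2a 2a≤3a) =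
      ℕ.≤-trans (ℕ.≤-trans (ℕ.∸-monoˡ-≤ a i≤2a) (ℕ.≤-reflexive (trans 2a∸a (sym 3a∸2a))))
                (ℕ.∸-monoʳ-≤ (3 * a) i≤2a)

    right-half : ∀ {i} → 2 * a ≤ i → i ≤ 3 * a → ℕ.∣ i - 3 * a ∣ ≤ ℕ.∣ i - a ∣
    right-half {i} 2a≤i i≤3a
      rewrite ℕ.m≤n⇒∣n-m∣≡n∸m (ℕ.≤-trans a≤2a 2a≤i) | ℕ.m≤n⇒∣m-n∣≡n∸m i≤3a =
      ℕ.≤-trans (ℕ.≤-trans (ℕ.∸-monoʳ-≤ (3 * a) 2a≤i) (ℕ.≤-reflexive (trans 3a∸2a (sym 2a∸a))))
                (ℕ.∸-monoˡ-≤ a 2a≤i)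

    depth-⋖ : ∀ {u v} → u ⋖ v → depth (index v) < depth (index u)
    depth-⋖ (rise₁ eq v≤a) rewrite eq =
      ℕ.⊓-mono-< (closer-below v≤a) (closer-below (ℕ.≤-trans v≤a a≤3a))
    depth-⋖ {u} {v} (fall₁ eq a≤v u≤2a) rewrite eq =
      ℕ.≤-<-trans (ℕ.m⊓n≤m ℕ.∣ index v - a ∣ _)
        (ℕ.<-≤-trans (closer-above a≤v)
          (ℕ.⊓-glb ℕ.≤-refl (left-half (ℕ.m≤n⇒m≤1+n a≤v) u≤2a)))
    depth-⋖ {u} {v} (rise₂ eq 2a≤u v≤3a) rewrite eq =
      ℕ.≤-<-trans (ℕ.m⊓n≤n ℕ.∣ suc (index u) - a ∣ _)
        (ℕ.<-≤-trans (closer-below v≤3a)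
          (ℕ.⊓-glb (right-half 2a≤u (ℕ.<⇒≤ v≤3a)) ℕ.≤-refl))
    depth-⋖ (fall₂ eq 3a≤v) rewrite eq =
      ℕ.⊓-mono-< (closer-above (ℕ.≤-trans a≤3a 3a≤v)) (closer-above 3a≤v)

  ≼-isDecPartialOrder : IsDecPartialOrder _≡_ _≼_
  ≼-isDecPartialOrder = star-isDecPartialOrder _⋖?_ (depth ∘ index) depth-⋖

  open Rowmotion ≼-isDecPartialOrder public

{-# OPTIONS --safe #-}

-- Below each of the two peaks hang an outer and an inner chain of a − 1 elements, and the
-- inner chains meet in the valley. Rowmotion adds one element to the part of a chain in
-- the ideal and empties a complete chain, so the height of the ideal on a chain is a
-- counter modulo a. There are two interactions. If the heights o and i below a peak agree,
-- the ideal reaches the peak: the two counters then move as one counter modulo a + 1. If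
-- the two inner heights agree (and neither belongs to such a pair), they reach 0 together,
-- and at that moment the valley is lost for one step: they, too, move as one counter modulo
-- a + 1. The orbits are then
--   𝒮: no two neighbouring heights agree, and nothing ever interacts;
--   ℳ: two pairs with different phases;
--   ℒ: equal inner heights with equal outer heights, alternating with two pairs in phase;
--   𝒢: equal inner heights with outer heights that differ by some e ≠ 0, until one outer
--      counter meets the inner ones and forms a pair; the pair runs against the two free
--      counters on the other side until the inner heights agree again, and the same
--      happens with the sides exchanged.
-- Every ideal is seen to occur in one of these cycles. That they have no repetition and are
-- disjoint follows by counting: their lengths add up to the number of ideals. The number
-- of maximal elements is not a sum over the chains because of the valley, but the total of
-- the antichains A over an orbit is also that of the antichains ρ(A), and the number of
-- minimal elements of the complement of an ideal is such a sum.

module Submission where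

open import Defs
open import Data.Bool using (Bool; true; false)
open import Data.Empty using (⊥; ⊥-elim)
open import Data.Fin as Fin using (Fin; toℕ; fromℕ<; punchIn; opposite; splitAt; _↑ˡ_; _↑ʳ_)
import Data.Fin.Induction as Fin
import Data.Fin.Properties as Fin
open import Data.Fin.Subset using (Subset; ∁; ∣_∣; _∈_)
import Data.Fin.Subset.Properties as Subset
open import Data.Irrelevant using ([_])
open import Data.List using (List; []; _∷_; _++_; length; map; concat; concatMap; applyUpTo; allFin; cartesianProductWith)
open import Data.List.Membership.Propositional as List using (find)
import Data.List.Membership.Propositional.Properties as List
import Data.List.Membership.Propositional.Properties.WithK as List
import Data.List.Properties as List
open import Data.List.Relation.Binary.BagAndSetEquality using (∼bag⇒↭)
open import Data.List.Relation.Binary.Permutation.Propositional as Perm using (_↭_; ↭-sym; ↭-trans; ↭-reflexive; ↭⇒↭ₛ)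
import Data.List.Relation.Binary.Permutation.Propositional.Properties as Perm
import Data.List.Relation.Binary.Permutation.Setoid.Properties as PermSetoid
open import Data.List.Relation.Unary.All as All using (All; []; _∷_)
import Data.List.Relation.Unary.All.Properties as All
open import Data.List.Relation.Unary.AllPairs using ([]; _∷_)
open import Data.List.Relation.Unary.Any as Any using (Any; here; there)
import Data.List.Relation.Unary.Any.Properties as Any
open import Data.List.Relation.Unary.Unique.Propositional using (Unique)
import Data.List.Relation.Unary.Unique.Propositional.Properties as Unique
import Data.List.Relation.Unary.Unique.Setoid as UniqueSetoid
import Data.List.Relation.Unary.Unique.Setoid.Properties as UniqueSetoid
open import Data.Nat using (ℕ; zero; suc; _+_; _*_; _∸_; _^_; _⊓_; _≤_; _<_; z≤n; s≤s; z<s; s<s; s≤s⁻¹; s<s⁻¹; NonZero; _≟_; _≤?_; _<?_)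
open import Data.Nat.DivMod using (_%_; _/_; m%n<n; m≡m%n+[m/n]*n; [m+n]%n≡m%n; [m+kn]%n≡m%n; m%n%n≡m%n; m<n⇒m%n≡m; n%n≡0; %-distribˡ-+; m<n*o⇒m/o<n)
open import Data.Nat.ListAction using (sum)
import Data.Nat.ListAction.Properties as Sum
import Data.Nat.Properties as ℕ
open import Data.Nat.Tactic.RingSolver using (solve-∀)
open import Data.Product using (∃; ∃-syntax; _×_; _,_; proj₁; proj₂)
open import Data.Refinement using (value; _,_)
open import Data.Sum using (_⊎_; inj₁; inj₂; [_,_]′)
open import Data.Unit using (⊤; tt)
open import Data.Vec using (tabulate)
import Data.Vec.Properties as Vec
open import Function using (_∘_; id; _⇔_; mk⇔; Equivalence; case_of_)
open import Function.Construct.Composition using (_⇔-∘_)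
open import Function.Construct.Symmetry using (⇔-sym)
open import Level using (0ℓ)
open import Relation.Binary using (Rel; Setoid; IsDecPartialOrder; tri<; tri≈; tri>)
open import Relation.Binary.Construct.Closure.Equivalence as EqClosure using (EqClosure)
open import Relation.Binary.Construct.Closure.ReflexiveTransitive using (ε; _◅_)
open import Relation.Binary.Construct.Closure.Symmetric using (fwd; bwd)
open import Relation.Binary.PropositionalEquality
open import Relation.Nullary using (¬_; Dec; yes; no; does)
open import Relation.Nullary.Decidable using (_×-dec_; ¬?; dec-true; dec-false; does-⇔)
import Relation.Unary as U

-- Repetition-free lists, permutations and paths

module _ {A : Set} where

  Unique-resp-↭ : {xs ys : List A} → xs ↭ ys → Unique xs → Unique ys
  Unique-resp-↭ p = PermSetoid.Unique-resp-↭ (setoid A) (↭⇒↭ₛ p)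

  -- Pigeonhole: each entry of `xs` uses up one occurrence in `ys`, and by the length bound nothing
  -- remains. The permutation hands the uniqueness of `xs` on to `ys`; this is how the disjointness
  -- of the cycles will follow from a count.
  unique⊆⇒↭ : {xs : List A} (ys : List A) → Unique xs → (∀ {x} → x List.∈ xs → x List.∈ ys) →
              length ys ≤ length xs → xs ↭ ys
  unique⊆⇒↭ {[]} [] _ _ _ = ↭-reflexive refl
  unique⊆⇒↭ {x ∷ xs} ys (x∉ ∷ xs!) xs⊆ ≤len with List.∈-∃++ (xs⊆ (here refl))
  ... | us , vs , refl = ↭-trans (Perm.prep x (unique⊆⇒↭ (us ++ vs) xs! ⊆′ ≤len′)) (↭-sym (Perm.shift x us vs))
    where
    ⊆′ : ∀ {y} → y List.∈ xs → y List.∈ us ++ vs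
    ⊆′ y∈ with Perm.∈-resp-↭ (Perm.shift x us vs) (xs⊆ (there y∈))
    ... | here refl = ⊥-elim (All.lookup x∉ y∈ refl)
    ... | there y∈′ = y∈′
    ≤len′ : length (us ++ vs) ≤ length xs
    ≤len′ = s≤s⁻¹ (subst (_≤ suc (length xs)) (Perm.↭-length (Perm.shift x us vs)) ≤len)

  unique-++⁻ : (xs {ys} : List A) → Unique (xs ++ ys) →
               Unique xs × Unique ys × (∀ {x} → x List.∈ xs → x List.∈ ys → ⊥)
  unique-++⁻ [] ys! = [] , ys! , λ ()
  unique-++⁻ (x ∷ xs) (x∉ ∷ u) with unique-++⁻ xs u
  ... | xs! , ys! , disjoint = All.++⁻ˡ xs x∉ ∷ xs! , ys! ,
    λ { (here refl) y∈ → All.lookup (All.++⁻ʳ xs x∉) y∈ refl ; (there x∈) y∈ → disjoint x∈ y∈ }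

  module _ {I : Set} (f : I → List A) where

    unique-block : ∀ {is i} → Unique (concatMap f is) → i List.∈ is → Unique (f i)
    unique-block u (here refl) = proj₁ (unique-++⁻ (f _) u)
    unique-block {j ∷ _} u (there i∈) = unique-block (proj₁ (proj₂ (unique-++⁻ (f j) u))) i∈

    blocks-disjoint : ∀ {is i j x} → Unique (concatMap f is) → i List.∈ is → j List.∈ is →
                      x List.∈ f i → x List.∈ f j → i ≡ j
    blocks-disjoint u (here refl) (here refl) _ _ = refl
    blocks-disjoint {k ∷ _} u (here refl) (there j∈) x∈i x∈j =
      ⊥-elim (proj₂ (proj₂ (unique-++⁻ (f k) u)) x∈i (List.∈-concat⁺′ x∈j (List.∈-map⁺ f j∈)))
    blocks-disjoint {k ∷ _} u (there i∈) (here refl) x∈i x∈j =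
      ⊥-elim (proj₂ (proj₂ (unique-++⁻ (f k) u)) x∈j (List.∈-concat⁺′ x∈i (List.∈-map⁺ f i∈)))
    blocks-disjoint {k ∷ _} u (there i∈) (there j∈) x∈i x∈j =
      blocks-disjoint (proj₁ (proj₂ (unique-++⁻ (f k) u))) i∈ j∈ x∈i x∈j

  sum-map-↭ : (st : A → ℕ) {xs ys : List A} → xs ↭ ys → sum (map st xs) ≡ sum (map st ys)
  sum-map-↭ st p = Sum.sum-↭ (Perm.map⁺ st p)

  infixr 5 _∷_ _++ᴾ_

  -- The list contains the start of the path but not its end, so that the
  -- entries of a cycle are those of a path from x to x.

  data Path (R : A → A → Set) : A → List A → A → Set where
    []  : ∀ {x} → Path R x [] x
    _∷_ : ∀ {x y z xs} → R x y → Path R y xs z → Path R x (x ∷ xs) z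

  _++ᴾ_ : ∀ {R x y z xs ys} → Path R x xs y → Path R y ys z → Path R x (xs ++ ys) z
  []       ++ᴾ qs = qs
  (r ∷ ps) ++ᴾ qs = r ∷ (ps ++ᴾ qs)

  applyUpToᴾ : ∀ {R z} (g : ℕ → A) n → (∀ t → t < n → R (g t) (g (suc t))) → R (g n) z →
               Path R (g 0) (applyUpTo g (suc n)) z
  applyUpToᴾ g zero    r last = last ∷ []
  applyUpToᴾ g (suc n) r last = r 0 z<s ∷ applyUpToᴾ (g ∘ suc) n (λ t t<n → r (suc t) (s<s t<n)) last

mapᴾ : {A B : Set} {R : A → A → Set} {S : B → B → Set} (φ : A → B) →
       (∀ {x y} → R x y → S (φ x) (φ y)) →
       ∀ {x xs y} → Path R x xs y → Path S (φ x) (map φ xs) (φ y)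
mapᴾ φ h []       = []
mapᴾ φ h (r ∷ ps) = h r ∷ mapᴾ φ h ps

-- Orbits from a covering by disjoint cycles

Graph : {X : Set} → (X → X) → X → X → Set
Graph f u v = f u ≡ v

module _ {X : Set} {f : X → X} where

  path-∼ : ∀ {x xs y z} → Path (Graph f) x xs y → z List.∈ xs → x ∼⟨ f ⟩ z
  path-∼ (r ∷ ps) (here refl) = ε
  path-∼ (r ∷ ps) (there z∈)  = fwd r ◅ path-∼ ps z∈

  path-next : ∀ {x xs y z} → Path (Graph f) x xs y → z List.∈ xs → f z List.∈ xs ⊎ f z ≡ y
  path-next (r ∷ [])     (here refl)     = inj₂ r
  path-next (r ∷ _ ∷ ps) (here refl)     = inj₁ (there (here r))
  path-next (r ∷ ps)     (there z∈) with path-next ps z∈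
  ... | inj₁ fz∈ = inj₁ (there fz∈)
  ... | inj₂ eq  = inj₂ eq

  start∈ : ∀ {x y xs z} → Path (Graph f) x xs z → y List.∈ xs → x List.∈ xs
  start∈ (_ ∷ _) _ = here refl

  cycle-closed : ∀ {x xs y} → Path (Graph f) x xs x → y List.∈ xs → f y List.∈ xs
  cycle-closed p y∈ with path-next p y∈
  ... | inj₁ fy∈  = fy∈
  ... | inj₂ refl = start∈ p y∈

  -- The entries of a path and their images differ only in the start and the end, and these coincide
  -- in a cycle. With this the size of an antichain may be replaced by that of its image under
  -- rowmotion.
  cycle-total-next : ∀ {x xs} (st : X → ℕ) → Path (Graph f) x xs x →
                     sum (map st xs) ≡ sum (map (st ∘ f) xs)
  cycle-total-next {x} st p = ℕ.+-cancelˡ-≡ (st x) _ _ (trans (ℕ.+-comm (st x) _) (telescope p))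
    where
    telescope : ∀ {x xs y} → Path (Graph f) x xs y →
                sum (map st xs) + st y ≡ st x + sum (map (st ∘ f) xs)
    telescope []                      = sym (ℕ.+-identityʳ _)
    telescope {x} (_∷_ {xs = xs} refl ps) = trans (ℕ.+-assoc (st x) _ _) (cong (st x +_) (telescope ps))

  -- Injectivity of f is not assumed: it follows from the exhaustion of X by
  -- finitely many pairwise disjoint cycles.

  module Cycles {I : Set} (start : I → X) (cyc : I → List X) (is : List I)
                (start∈cyc : ∀ i → start i List.∈ cyc i)
                (path : ∀ i → Path (Graph f) (start i) (cyc i) (start i))
                (index : X → I) (index∈ : ∀ x → index x List.∈ is) (cover : ∀ x → x List.∈ cyc (index x))
                (all : ∀ i → i List.∈ is) (distinct : Unique (concatMap cyc is)) where

    cyc-index : ∀ {i x} → x List.∈ cyc i → i ≡ index x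
    cyc-index {i} {x} x∈ = blocks-disjoint cyc distinct (all i) (index∈ x) x∈ (cover x)

    index-f : ∀ x → index (f x) ≡ index x
    index-f x = sym (cyc-index (cycle-closed (path (index x)) (cover x)))

    -- `index-f` is an equation and is used in both directions: a `bwd` step preserves the index
    -- just as a `fwd` step does.
    index-∼ : ∀ {x y} → x ∼⟨ f ⟩ y → index x ≡ index y
    index-∼ ε = refl
    index-∼ {x} (fwd refl ◅ r) = trans (sym (index-f x)) (index-∼ r)
    index-∼ (bwd refl ◅ r) = trans (index-f _) (index-∼ r)

    cycle : I → Orbit f
    cycle i = record
      { base     = start i
      ; elements = cyc i
      ; unique   = unique-block cyc distinct (all i)
      ; orbit    = λ x → mk⇔ (path-∼ (path i))
          -- A point of the orbit of `start i` has the index of `start i`, which is `i`, and `cover`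
          -- places it in the cycle of its own index.
          (λ r → subst (λ j → x List.∈ cyc j) (trans (sym (index-∼ r)) (sym (cyc-index (start∈cyc i)))) (cover x))
      }

    cycle-index : ∀ O → Setoid._≈_ (OrbitSetoid f) O (cycle (index (Orbit.base O)))
    cycle-index O {x} = mk⇔ to from
      where
      open Orbit O using (base; orbit)
      to : x List.∈ elements O → x List.∈ cyc (index base)
      to x∈ = subst (λ j → x List.∈ cyc j) (sym (index-∼ (Equivalence.to (orbit x) x∈))) (cover x)
      from : x List.∈ cyc (index base) → x List.∈ elements O
      from x∈ = Equivalence.from (orbit x)
        (EqClosure.transitive _ (EqClosure.symmetric _ (path-∼ (path _) (cover base))) (path-∼ (path _) x∈))

    cycle-injective : ∀ {i j} → Setoid._≈_ (OrbitSetoid f) (cycle i) (cycle j) → i ≡ j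
    cycle-injective {i} eq = trans (cyc-index (start∈cyc i)) (sym (cyc-index (Equivalence.to eq (start∈cyc i))))

-- Without repetitions, equal sets are equal multisets. Lengths and totals therefore depend only on
-- the class of an orbit in `OrbitSetoid`.
≈ₒ⇒↭ : {X : Set} {f : X → X} (O O′ : Orbit f) → Setoid._≈_ (OrbitSetoid f) O O′ → elements O ↭ elements O′
≈ₒ⇒↭ O O′ eq = ∼bag⇒↭ (List.unique∧set⇒bag (Orbit.unique O) (Orbit.unique O′) eq)

-- Arithmetic modulo a and modulo a + 1

-- A step of a counter with the values 0 , ... , n. As a relation it allows an analysis by cases,
-- without computing remainders.
data Turn (n : ℕ) : ℕ → ℕ → Set where
  tick : ∀ {k} → k < n → Turn n k (suc k)
  wrap : Turn n n 0

[m%n+d]%n≡[m+d]%n : ∀ m d n .{{_ : NonZero n}} → (m % n + d) % n ≡ (m + d) % n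
[m%n+d]%n≡[m+d]%n m d n = begin
  (m % n + d) % n           ≡⟨ %-distribˡ-+ (m % n) d n ⟩
  (m % n % n + d % n) % n   ≡⟨ cong (λ k → (k + d % n) % n) (m%n%n≡m%n m n) ⟩
  (m % n + d % n) % n       ≡⟨ %-distribˡ-+ m d n ⟨
  (m + d) % n               ∎
  where open ≡-Reasoning

m≤n⇒m%[1+n]≡m : ∀ {m n} → m ≤ n → m % suc n ≡ m
m≤n⇒m%[1+n]≡m m≤n = m<n⇒m%n≡m (s≤s m≤n)

m%[1+n]≤n : ∀ m n → m % suc n ≤ n
m%[1+n]≤n m n = s≤s⁻¹ (m%n<n m (suc n))

turn : ∀ n t → Turn n (t % suc n) (suc t % suc n)
turn n t = subst (Turn n (t % suc n)) (trans (cong (_% suc n) (ℕ.+-comm 1 (t % suc n)))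
    (trans ([m%n+d]%n≡[m+d]%n t 1 (suc n)) (cong (_% suc n) (ℕ.+-comm t 1))))
  (next (ℕ.m≤n⇒m<n∨m≡n (m%[1+n]≤n t n)))
  where
  next : ∀ {k} → k < n ⊎ k ≡ n → Turn n k (suc k % suc n)
  next {k} (inj₁ k<n) = subst (Turn n k) (sym (m≤n⇒m%[1+n]≡m k<n)) (tick k<n)
  next (inj₂ refl)    = subst (Turn n n) (sym (n%n≡0 (suc n))) wrap

-- The difference j - i modulo n + 1 lies between 1 and n; it is coded as one less, by an element of
-- `Fin n`. These codes later name the orbits.
offset : ∀ {n i j} → i ≤ n → j ≤ n → i ≢ j → ∃ λ (x : Fin n) → j ≡ (i + suc (toℕ x)) % suc n
offset {n} {i} {j} i≤n j≤n i≢j with ℕ.<-cmp i j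
... | tri≈ _ i≡j _ = ⊥-elim (i≢j i≡j)
... | tri< i<j _ _ = fromℕ< {j ∸ suc i} (ℕ.≤-trans (ℕ.∸-monoʳ-< (s≤s z≤n) i<j) j≤n) , sym (begin
    (i + suc (toℕ (fromℕ< {j ∸ suc i} {n} _))) % suc n ≡⟨ cong (λ x → (i + suc x) % suc n) (Fin.toℕ-fromℕ< _) ⟩
    (i + suc (j ∸ suc i)) % suc n  ≡⟨ cong (_% suc n) (trans (ℕ.+-suc i _) (ℕ.m+[n∸m]≡n i<j)) ⟩
    j % suc n                      ≡⟨ m≤n⇒m%[1+n]≡m j≤n ⟩
    j                              ∎)
  where open ≡-Reasoning
-- Here the difference is j - i + n + 1, whose predecessor is j + (n - i).
... | tri> _ _ j<i = fromℕ< {j + (n ∸ i)} x<n , sym (begin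
    (i + suc (toℕ (fromℕ< {j + (n ∸ i)} x<n))) % suc n ≡⟨ cong (λ x → (i + suc x) % suc n) (Fin.toℕ-fromℕ< x<n) ⟩
    (i + suc (j + (n ∸ i))) % suc n ≡⟨ cong (_% suc n) (rearrange i j (n ∸ i)) ⟩
    (j + suc (i + (n ∸ i))) % suc n ≡⟨ cong (λ x → (j + suc x) % suc n) (ℕ.m+[n∸m]≡n i≤n) ⟩
    (j + suc n) % suc n             ≡⟨ [m+n]%n≡m%n j (suc n) ⟩
    j % suc n                       ≡⟨ m≤n⇒m%[1+n]≡m j≤n ⟩
    j                               ∎)
  where
  open ≡-Reasoning
  x<n : j + (n ∸ i) < n
  x<n = ℕ.<-≤-trans (ℕ.+-monoˡ-< (n ∸ i) j<i) (ℕ.≤-reflexive (ℕ.m+[n∸m]≡n i≤n))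
  rearrange : ∀ x y z → x + suc (y + z) ≡ y + suc (x + z)
  rearrange = solve-∀

-- The variant of `offset` that admits the difference 0 and an unreduced `m`.
offset₀ : ∀ {n} m {j} → j ≤ n → ∃ λ s → s ≤ n × (m + s) % suc n ≡ j
offset₀ {n} m {j} j≤n with m % suc n ≟ j
... | yes refl = 0 , z≤n , cong (_% suc n) (ℕ.+-identityʳ m)
... | no ≢j with offset (m%[1+n]≤n m n) j≤n ≢j
...   | x , eq = suc (toℕ x) , Fin.toℕ<n x , sym (trans eq ([m%n+d]%n≡[m+d]%n m (suc (toℕ x)) (suc n)))

-- Either m + d + 1 stays below the modulus and exceeds m, or one wrap takes it to `r`, which is
-- below m because d + 1 is less than the modulus.
[m+d]%n≢m : ∀ {m d n} → m ≤ n → d < n → (m + suc d) % suc n ≢ m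
[m+d]%n≢m {m} {d} {n} m≤n d<n eq with ℕ.<-≤-connex (m + suc d) (suc n)
... | inj₁ <n = ℕ.m+1+n≢m m (trans (sym (m<n⇒m%n≡m <n)) eq)
... | inj₂ n≤ = ℕ.<-irrefl r≡m r<m
  where
  r = m + suc d ∸ suc n
  r+n : r + suc n ≡ m + suc d
  r+n = ℕ.m∸n+n≡m n≤
  r<m : r < m
  r<m = ℕ.+-cancelʳ-< (suc n) r m (subst (_< m + suc n) (sym r+n) (ℕ.+-monoʳ-< m (s<s d<n)))
  r≡m : r ≡ m
  r≡m = begin
    r                 ≡⟨ m≤n⇒m%[1+n]≡m (ℕ.≤-trans (ℕ.<⇒≤ r<m) m≤n) ⟨
    r % suc n         ≡⟨ [m+n]%n≡m%n r (suc n) ⟨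
    (r + suc n) % suc n ≡⟨ cong (_% suc n) r+n ⟩
    (m + suc d) % suc n ≡⟨ eq ⟩
    m ∎
    where open ≡-Reasoning

-- Since suc n ≡ 1 modulo n, the time m + s * suc n is m modulo suc n and m + s modulo n.

[m+s*[1+n]+d]%n : ∀ m s d n .{{_ : NonZero n}} → (m + s * suc n + d) % n ≡ (m + s + d) % n
[m+s*[1+n]+d]%n m s d n = trans (cong (_% n) (rearrange m s d n)) ([m+kn]%n≡m%n (m + s + d) s n)
  where
  rearrange : ∀ m s d n → m + s * suc n + d ≡ m + s + d + s * n
  rearrange = solve-∀

-- Let s be the quotient of t by n + 2. Then t ≡ i + 1 + s modulo n + 1, so t + e ≡ i forces s + e +
-- 1 ≡ 0, which is impossible for s + e < n. With n = b: an outer counter of offset e cannot meet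
-- two equal inner ones before round b - e.
collision : ∀ {n t e i} → (t + e) % suc n ≡ i → t % suc (suc n) ≡ suc i → n ≤ t / suc (suc n) + e
collision {n} {t} {e} {i} eq eq′ with ℕ.<-≤-connex (t / suc (suc n) + e) n
... | inj₂ n≤ = n≤
... | inj₁ <n = ⊥-elim ([m+d]%n≢m (subst (_≤ n) eq (m%[1+n]≤n (t + e) n)) <n (begin
    (i + suc (t / suc (suc n) + e)) % suc n ≡⟨ cong (_% suc n) (rearrange i (t / suc (suc n)) e) ⟩
    (suc i + t / suc (suc n) + e) % suc n   ≡⟨ [m+s*[1+n]+d]%n (suc i) (t / suc (suc n)) e (suc n) ⟨
    (suc i + t / suc (suc n) * suc (suc n) + e) % suc n
      ≡⟨ cong (λ m → (m + t / suc (suc n) * suc (suc n) + e) % suc n) eq′ ⟨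
    (t % suc (suc n) + t / suc (suc n) * suc (suc n) + e) % suc n
      ≡⟨ cong (λ t → (t + e) % suc n) (m≡m%n+[m/n]*n t (suc (suc n))) ⟨
    (t + e) % suc n ≡⟨ eq ⟩
    i ∎))
  where
  open ≡-Reasoning
  rearrange : ∀ i s e → i + suc (s + e) ≡ suc i + s + e
  rearrange = solve-∀

-- Finite sums of periodic functions

∑ : ℕ → (ℕ → ℕ) → ℕ
∑ n g = sum (applyUpTo g n)

∑-cong-< : ∀ n {g h} → (∀ t → t < n → g t ≡ h t) → ∑ n g ≡ ∑ n h
∑-cong-< zero    eq = refl
∑-cong-< (suc n) eq = cong₂ _+_ (eq 0 z<s) (∑-cong-< n (λ t t<n → eq (suc t) (s<s t<n)))

∑-cong : ∀ n {g h} → (∀ t → g t ≡ h t) → ∑ n g ≡ ∑ n h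
∑-cong n eq = ∑-cong-< n (λ t _ → eq t)

∑-const : ∀ n k → ∑ n (λ _ → k) ≡ n * k
∑-const zero    k = refl
∑-const (suc n) k = cong (k +_) (∑-const n k)

∑-+ : ∀ m n g → ∑ (m + n) g ≡ ∑ m g + ∑ n (λ t → g (m + t))
∑-+ zero    n g = refl
∑-+ (suc m) n g = trans (cong (g 0 +_) (∑-+ m n (g ∘ suc))) (sym (ℕ.+-assoc (g 0) _ _))

∑-last : ∀ n g → ∑ (suc n) g ≡ ∑ n g + g n
∑-last zero    g = ℕ.+-comm (g 0) 0
∑-last (suc n) g = trans (cong (g 0 +_) (∑-last n (g ∘ suc))) (sym (ℕ.+-assoc (g 0) _ _))

∑-distrib : ∀ n g h → ∑ n (λ t → g t + h t) ≡ ∑ n g + ∑ n h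
∑-distrib zero    g h = refl
∑-distrib (suc n) g h = trans (cong (g 0 + h 0 +_) (∑-distrib n (g ∘ suc) (h ∘ suc))) (exchange (g 0) (h 0) _ _)
  where
  exchange : ∀ a b c d → a + b + (c + d) ≡ a + c + (b + d)
  exchange = solve-∀

∑-double : ∀ n g → ∑ n (λ t → 2 * g t) ≡ 2 * ∑ n g
∑-double zero    g = refl
∑-double (suc n) g = trans (cong (2 * g 0 +_) (∑-double n (g ∘ suc))) (sym (ℕ.*-distribˡ-+ 2 (g 0) _))

-- Moving the window by one place trades `g d` for `g (d + n)`, which is the same by periodicity.
∑-shift : ∀ n g → (∀ t → g (n + t) ≡ g t) → ∀ d → ∑ n (λ t → g (d + t)) ≡ ∑ n g
∑-shift n g periodic zero    = refl
∑-shift n g periodic (suc d) = trans (ℕ.+-cancelˡ-≡ (g d) _ _ (begin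
    g d + ∑ n (λ t → g (suc d + t))      ≡⟨ cong₂ _+_ (cong g (ℕ.+-identityʳ d)) (∑-cong n (λ t → cong g (ℕ.+-suc d t))) ⟨
    ∑ (suc n) (λ t → g (d + t))          ≡⟨ ∑-last n (λ t → g (d + t)) ⟩
    ∑ n (λ t → g (d + t)) + g (d + n)    ≡⟨ cong (∑ n (λ t → g (d + t)) +_) (trans (cong g (ℕ.+-comm d n)) (periodic d)) ⟩
    ∑ n (λ t → g (d + t)) + g d          ≡⟨ ℕ.+-comm _ (g d) ⟩
    g d + ∑ n (λ t → g (d + t))          ∎)) (∑-shift n g periodic d)
  where open ≡-Reasoning

∑-periodic : ∀ n g → (∀ t → g (n + t) ≡ g t) → ∀ k → ∑ (k * n) g ≡ k * ∑ n g
∑-periodic n g periodic zero    = refl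
∑-periodic n g periodic (suc k) = trans (∑-+ n (k * n) g)
  (cong (∑ n g +_) (trans (∑-cong (k * n) periodic) (∑-periodic n g periodic k)))

-- In k full turns every residue occurs k times, whatever the phase d. The totals of the counters
-- reduce to this.
∑-turns : ∀ n f k d → ∑ (k * suc n) (λ t → f ((t + d) % suc n)) ≡ k * ∑ (suc n) f
∑-turns n f k d = begin
  ∑ (k * suc n) (λ t → f ((t + d) % suc n))
    ≡⟨ ∑-periodic (suc n) _ (λ t → cong f (periodic t)) k ⟩
  k * ∑ (suc n) (λ t → f ((t + d) % suc n))
    ≡⟨ cong (k *_) (∑-cong (suc n) (λ t → cong (λ m → f (m % suc n)) (ℕ.+-comm t d))) ⟩
  k * ∑ (suc n) (λ t → f ((d + t) % suc n))
    ≡⟨ cong (k *_) (∑-shift (suc n) (λ t → f (t % suc n)) (λ t → cong f (period t)) d) ⟩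
  k * ∑ (suc n) (λ t → f (t % suc n))
    ≡⟨ cong (k *_) (∑-cong-< (suc n) (λ t t≤n → cong f (m<n⇒m%n≡m t≤n))) ⟩
  k * ∑ (suc n) f ∎
  where
  open ≡-Reasoning
  period : ∀ t → (suc n + t) % suc n ≡ t % suc n
  period t = trans (cong (_% suc n) (ℕ.+-comm (suc n) t)) ([m+n]%n≡m%n t (suc n))
  periodic : ∀ t → (suc n + t + d) % suc n ≡ (t + d) % suc n
  periodic t = trans (cong (_% suc n) (ℕ.+-assoc (suc n) t d)) (period (t + d))

split-elim : ∀ m {n} (P : Fin (m + n) → Set) → (∀ i → P (i ↑ˡ n)) → (∀ j → P (m ↑ʳ j)) → ∀ k → P k
split-elim m {n} P l r k with splitAt m k in eq
... | inj₁ i = subst P (Fin.splitAt⁻¹-↑ˡ eq) (l i)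
... | inj₂ j = subst P (Fin.splitAt⁻¹-↑ʳ eq) (r j)

opposite-toℕ : ∀ {n} (k : Fin n) → toℕ (opposite k) + suc (toℕ k) ≡ n
opposite-toℕ k = trans (cong (_+ suc (toℕ k)) (Fin.opposite-prop k)) (ℕ.m∸n+n≡m (Fin.toℕ<n k))

data Side : Set where
  left right : Side

-- Coordinates on the fence

module Coordinates (c : ℕ) where

  -- Writing a as c + 2 builds in a ≥ 2, and `b` is the number of elements of each of the four
  -- chains.
  b a : ℕ
  b = suc c
  a = suc b

  open Fence a

  -- outer s k and inner s k are the elements of height k of the two chains below
  -- the peak s; heights on an inner chain are counted from just above the valley.

  data Pos : Set where
    outer  : Side → Fin b → Pos
    peak   : Side → Pos
    inner  : Side → Fin b → Pos
    valley : Pos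

  -- `4 * a ∸ 1` computes to `b + (a + (a + (a + 0)))`, so the vertices split into an initial block
  -- of b and three blocks of a. The latter begin at the left peak, the valley and the right peak.
  block₁ block₂ block₃ : Fin a → Vertex
  block₁ i = b ↑ʳ (i ↑ˡ (a + (a + 0)))
  block₂ i = b ↑ʳ (a ↑ʳ (i ↑ˡ (a + 0)))
  block₃ i = b ↑ʳ (a ↑ʳ (a ↑ʳ (i ↑ˡ 0)))

  pt : Pos → Vertex
  pt (outer left k)  = k ↑ˡ (a + (a + (a + 0)))
  pt (peak left)     = block₁ Fin.zero
  pt (inner left k)  = block₁ (Fin.suc (opposite k))
  pt valley          = block₂ Fin.zero
  pt (inner right k) = block₂ (Fin.suc k)
  pt (peak right)    = block₃ Fin.zero
  pt (outer right k) = block₃ (Fin.suc (opposite k))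

  pos₁ pos₂ pos₃ : Fin a → Pos
  pos₁ Fin.zero    = peak left
  pos₁ (Fin.suc k) = inner left (opposite k)
  pos₂ Fin.zero    = valley
  pos₂ (Fin.suc k) = inner right k
  pos₃ Fin.zero    = peak right
  pos₃ (Fin.suc k) = outer right (opposite k)

  pos : Vertex → Pos
  pos v = [ outer left , [ pos₁ , [ pos₂ , [ pos₃ , (λ ()) ]′ ∘ splitAt a ]′ ∘ splitAt a ]′ ∘ splitAt a ]′ (splitAt b v)

  pos-outer-left : ∀ k → pos (k ↑ˡ (a + (a + (a + 0)))) ≡ outer left k
  pos-outer-left k rewrite Fin.splitAt-↑ˡ b k (a + (a + (a + 0))) = refl

  pos-block₁ : ∀ i → pos (block₁ i) ≡ pos₁ i
  pos-block₁ i rewrite Fin.splitAt-↑ʳ b (a + (a + (a + 0))) (i ↑ˡ (a + (a + 0)))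
    | Fin.splitAt-↑ˡ a i (a + (a + 0)) = refl

  pos-block₂ : ∀ i → pos (block₂ i) ≡ pos₂ i
  pos-block₂ i rewrite Fin.splitAt-↑ʳ b (a + (a + (a + 0))) (a ↑ʳ (i ↑ˡ (a + 0)))
    | Fin.splitAt-↑ʳ a (a + (a + 0)) (i ↑ˡ (a + 0))
    | Fin.splitAt-↑ˡ a i (a + 0) = refl

  pos-block₃ : ∀ i → pos (block₃ i) ≡ pos₃ i
  pos-block₃ i rewrite Fin.splitAt-↑ʳ b (a + (a + (a + 0))) (a ↑ʳ (a ↑ʳ (i ↑ˡ 0)))
    | Fin.splitAt-↑ʳ a (a + (a + 0)) (a ↑ʳ (i ↑ˡ 0))
    | Fin.splitAt-↑ʳ a (a + 0) (i ↑ˡ 0)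
    | Fin.splitAt-↑ˡ a i 0 = refl

  pos∘pt : ∀ p → pos (pt p) ≡ p
  pos∘pt (outer left k)  = pos-outer-left k
  pos∘pt (peak left)     = pos-block₁ Fin.zero
  pos∘pt (inner left k)  = trans (pos-block₁ (Fin.suc (opposite k))) (cong (inner left) (Fin.opposite-involutive k))
  pos∘pt valley          = pos-block₂ Fin.zero
  pos∘pt (inner right k) = pos-block₂ (Fin.suc k)
  pos∘pt (peak right)    = pos-block₃ Fin.zero
  pos∘pt (outer right k) = trans (pos-block₃ (Fin.suc (opposite k))) (cong (outer right) (Fin.opposite-involutive k))

  pt-surjective : ∀ v → ∃ λ p → pt p ≡ v
  pt-surjective = split-elim b _ (λ k → outer left k , refl)
    (split-elim a _ (λ i → in₁ i)
    (split-elim a _ (λ i → in₂ i)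
    (split-elim a _ (λ i → in₃ i) (λ ()))))
    where
    in₁ : ∀ i → ∃ λ p → pt p ≡ block₁ i
    in₁ Fin.zero    = peak left , refl
    in₁ (Fin.suc k) = inner left (opposite k) , cong (block₁ ∘ Fin.suc) (Fin.opposite-involutive k)
    in₂ : ∀ i → ∃ λ p → pt p ≡ block₂ i
    in₂ Fin.zero    = valley , refl
    in₂ (Fin.suc k) = inner right k , refl
    in₃ : ∀ i → ∃ λ p → pt p ≡ block₃ i
    in₃ Fin.zero    = peak right , refl
    in₃ (Fin.suc k) = outer right (opposite k) , cong (block₃ ∘ Fin.suc) (Fin.opposite-involutive k)

  pt∘pos : ∀ v → pt (pos v) ≡ v
  pt∘pos v with pt-surjective v
  ... | p , refl = cong pt (pos∘pt p)

  -- On the two chains whose height falls as the index grows, the equation for the index is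
  -- additive, which avoids subtraction.
  At : Pos → ℕ → Set
  At (outer left k)  n = n ≡ suc (toℕ k)
  At (peak left)     n = n ≡ a
  At (inner left k)  n = n + suc (toℕ k) ≡ 2 * a
  At valley          n = n ≡ 2 * a
  At (inner right k) n = n ≡ 2 * a + suc (toℕ k)
  At (peak right)    n = n ≡ 3 * a
  At (outer right k) n = n + suc (toℕ k) ≡ 4 * a

  toℕ-block₁ : ∀ i → suc (toℕ (block₁ i)) ≡ a + toℕ i
  toℕ-block₁ i = cong suc (trans (Fin.toℕ-↑ʳ b _) (cong (b +_) (Fin.toℕ-↑ˡ i _)))

  toℕ-block₂ : ∀ i → suc (toℕ (block₂ i)) ≡ 2 * a + toℕ i
  toℕ-block₂ i = trans
    (cong suc (trans (Fin.toℕ-↑ʳ b _) (cong (b +_) (trans (Fin.toℕ-↑ʳ a _) (cong (a +_) (Fin.toℕ-↑ˡ i _))))))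
    (rearrange a (toℕ i))
    where
    rearrange : ∀ x y → x + (x + y) ≡ 2 * x + y
    rearrange = solve-∀

  toℕ-block₃ : ∀ i → suc (toℕ (block₃ i)) ≡ 3 * a + toℕ i
  toℕ-block₃ i = trans
    (cong suc (trans (Fin.toℕ-↑ʳ b _) (cong (b +_) (trans (Fin.toℕ-↑ʳ a _)
      (cong (a +_) (trans (Fin.toℕ-↑ʳ a _) (cong (a +_) (Fin.toℕ-↑ˡ i _))))))))
    (rearrange a (toℕ i))
    where
    rearrange : ∀ x y → x + (x + (x + y)) ≡ 3 * x + y
    rearrange = solve-∀

  at : ∀ p → At p (index (pt p))
  at (outer left k)  = cong suc (Fin.toℕ-↑ˡ k (a + (a + (a + 0))))
  at (peak left)     = trans (toℕ-block₁ Fin.zero) (ℕ.+-identityʳ a)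
  at (inner left k)  = trans (cong (_+ suc (toℕ k)) (toℕ-block₁ (Fin.suc (opposite k))))
    (trans (ℕ.+-assoc a (suc (toℕ (opposite k))) (suc (toℕ k))) (cong (a +_) (trans (cong suc (opposite-toℕ k)) (sym (ℕ.+-identityʳ a)))))
  at valley          = trans (toℕ-block₂ Fin.zero) (ℕ.+-identityʳ (2 * a))
  at (inner right k) = toℕ-block₂ (Fin.suc k)
  at (peak right)    = trans (toℕ-block₃ Fin.zero) (ℕ.+-identityʳ (3 * a))
  at (outer right k) = trans (cong (_+ suc (toℕ k)) (toℕ-block₃ (Fin.suc (opposite k))))
    (trans (ℕ.+-assoc (3 * a) (suc (toℕ (opposite k))) (suc (toℕ k))) (trans (cong (3 * a +_) (cong suc (opposite-toℕ k))) (ℕ.+-comm (3 * a) a)))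

  At-functional : ∀ p {m n} → At p m → At p n → m ≡ n
  At-functional (outer left k)  p q = trans p (sym q)
  At-functional (peak left)     p q = trans p (sym q)
  At-functional (inner left k)  p q = ℕ.+-cancelʳ-≡ (suc (toℕ k)) _ _ (trans p (sym q))
  At-functional valley          p q = trans p (sym q)
  At-functional (inner right k) p q = trans p (sym q)
  At-functional (peak right)    p q = trans p (sym q)
  At-functional (outer right k) p q = ℕ.+-cancelʳ-≡ (suc (toℕ k)) _ _ (trans p (sym q))

  At⇒≡ : ∀ {p q n} → index (pt p) ≡ n → At q n → p ≡ q
  At⇒≡ {p} {q} refl at-q = trans (sym (pos∘pt p)) (trans (cong pos pt-≡) (pos∘pt q))
    where
    pt-≡ : pt p ≡ pt q
    pt-≡ = Fin.toℕ-injective (ℕ.suc-injective (At-functional q at-q (at q)))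

  block : Pos → ℕ
  block (outer left k)  = 0
  block (peak left)     = 1
  block (inner left k)  = 1
  block valley          = 2
  block (inner right k) = 2
  block (peak right)    = 3
  block (outer right k) = 3

  block-bounds : ∀ p → block p * a ≤ index (pt p) × index (pt p) < suc (block p) * a
  block-bounds (outer left k) = z≤n , subst (index (pt (outer left k)) <_) (sym (ℕ.*-identityˡ a))
    (subst (_< a) (sym (at (outer left k))) (s<s (Fin.toℕ<n k)))
  block-bounds (peak left) rewrite at (peak left) = ℕ.≤-reflexive (ℕ.*-identityˡ a) , ℕ.m<m+n a z<s
  block-bounds (inner left k) = falling (at (inner left k))
    where
    falling : ∀ {n} → n + suc (toℕ k) ≡ 2 * a → 1 * a ≤ n × n < 2 * a
    falling {n} eq = ℕ.+-cancelʳ-≤ (suc (toℕ k)) _ _ (ℕ.≤-trans (ℕ.+-monoʳ-≤ (1 * a) (ℕ.≤-trans (Fin.toℕ<n k) (ℕ.n≤1+n b)))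
        (ℕ.≤-reflexive (trans (ℕ.+-comm (1 * a) a) (sym eq))))
      , subst (n <_) eq (ℕ.m<m+n n z<s)
  block-bounds valley rewrite at valley = ℕ.≤-refl , ℕ.m<n+m (2 * a) {a} z<s
  block-bounds (inner right k) rewrite at (inner right k) = ℕ.m≤m+n (2 * a) _ ,
    subst (2 * a + suc (toℕ k) <_) (ℕ.+-comm (2 * a) a) (ℕ.+-monoʳ-< (2 * a) (s<s (Fin.toℕ<n k)))
  block-bounds (peak right) rewrite at (peak right) = ℕ.≤-refl , ℕ.m<n+m (3 * a) {a} z<s
  block-bounds (outer right k) = falling (at (outer right k))
    where
    falling : ∀ {n} → n + suc (toℕ k) ≡ 4 * a → 3 * a ≤ n × n < 4 * a
    falling {n} eq = ℕ.+-cancelʳ-≤ (suc (toℕ k)) _ _ (ℕ.≤-trans (ℕ.+-monoʳ-≤ (3 * a) (ℕ.≤-trans (Fin.toℕ<n k) (ℕ.n≤1+n b)))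
        (ℕ.≤-reflexive (trans (ℕ.+-comm (3 * a) a) (sym eq))))
      , subst (n <_) eq (ℕ.m<m+n n z<s)

  -- The block number is the quotient of the index by a. The bounds in the constructors of `_⋖_`
  -- thus tell in which block the vertex of smaller index lies.
  in-block : ∀ p β → β * a ≤ index (pt p) → index (pt p) < suc β * a → block p ≡ β
  in-block p β l u = ℕ.≤-antisym
    (s≤s⁻¹ (ℕ.*-cancelʳ-< a (block p) (suc β) (ℕ.≤-<-trans (proj₁ (block-bounds p)) u)))
    (s≤s⁻¹ (ℕ.*-cancelʳ-< a β (suc (block p)) (ℕ.≤-<-trans l (proj₂ (block-bounds p)))))

  infix 4 _<:_

  -- Covers in terms of height instead of index: rising and falling parts of the fence obey the same
  -- rules, and so do the two sides.
  data _<:_ : Pos → Pos → Set where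
    outer-outer  : ∀ {s k l} → toℕ l ≡ suc (toℕ k) → outer s k <: outer s l
    outer-peak   : ∀ {s k} → suc (toℕ k) ≡ b → outer s k <: peak s
    inner-inner  : ∀ {s k l} → toℕ l ≡ suc (toℕ k) → inner s k <: inner s l
    inner-peak   : ∀ {s k} → suc (toℕ k) ≡ b → inner s k <: peak s
    valley-inner : ∀ {s k} → toℕ k ≡ 0 → valley <: inner s k

  next : (k : Fin b) → (∃ λ (l : Fin b) → toℕ l ≡ suc (toℕ k)) ⊎ suc (toℕ k) ≡ b
  next k with ℕ.m≤n⇒m<n∨m≡n (Fin.toℕ<n k)
  ... | inj₁ <b = inj₁ (fromℕ< <b , Fin.toℕ-fromℕ< <b)
  ... | inj₂ ≡b = inj₂ ≡b

  prev : (k : Fin b) → (∃ λ (l : Fin b) → toℕ k ≡ suc (toℕ l)) ⊎ toℕ k ≡ 0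
  prev Fin.zero    = inj₂ refl
  prev (Fin.suc k) = inj₁ (Fin.inject₁ k , cong suc (sym (Fin.toℕ-inject₁ k)))

  top : ∃ λ (k : Fin b) → suc (toℕ k) ≡ b
  top = Fin.fromℕ c , cong suc (Fin.toℕ-fromℕ c)

  covers₀ : ∀ p q → index (pt q) ≡ suc (index (pt p)) → block p ≡ 0 → p <: q
  covers₀ (outer left k) q eq refl with next k
  ... | inj₁ (l , l≡) rewrite At⇒≡ {q} {outer left l} eq (cong suc (trans (at (outer left k)) (sym l≡))) = outer-outer l≡
  ... | inj₂ ≡b rewrite At⇒≡ {q} {peak left} eq (cong suc (trans (at (outer left k)) ≡b)) = outer-peak ≡b
  covers₀ (peak left) _ _ ()
  covers₀ (inner left _) _ _ ()

  covers₁ : ∀ p q → index (pt p) ≡ suc (index (pt q)) → block q ≡ 1 → p <: q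
  covers₁ p (peak left) eq refl rewrite At⇒≡ {p} {inner left (proj₁ top)} eq
    (trans (cong suc (cong₂ _+_ (at (peak left)) (proj₂ top)))
      (trans (sym (ℕ.+-suc a b)) (cong (a +_) (sym (ℕ.+-identityʳ a))))) = inner-peak (proj₂ top)
  covers₁ p (inner left k) eq refl with prev k
  ... | inj₁ (l , k≡) rewrite At⇒≡ {p} {inner left l} eq
    (trans (sym (ℕ.+-suc (index (pt (inner left k))) (suc (toℕ l)))) (trans (cong (index (pt (inner left k)) +_) (cong suc (sym k≡))) (at (inner left k)))) = inner-inner k≡
  ... | inj₂ k≡0 rewrite At⇒≡ {p} {valley} eq
    (trans (ℕ.+-comm 1 (index (pt (inner left k)))) (trans (cong (index (pt (inner left k)) +_) (cong suc (sym k≡0))) (at (inner left k)))) = valley-inner k≡0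
  covers₁ _ (outer left _) _ ()

  covers₂ : ∀ p q → index (pt q) ≡ suc (index (pt p)) → block p ≡ 2 → p <: q
  covers₂ valley q eq refl rewrite At⇒≡ {q} {inner right Fin.zero} eq
    (trans (cong suc (at valley)) (ℕ.+-comm 1 (2 * a))) = valley-inner refl
  covers₂ (inner right k) q eq refl with next k
  ... | inj₁ (l , l≡) rewrite At⇒≡ {q} {inner right l} eq
    (trans (cong suc (at (inner right k))) (trans (sym (ℕ.+-suc (2 * a) (suc (toℕ k)))) (cong (2 * a +_) (cong suc (sym l≡))))) = inner-inner l≡
  ... | inj₂ ≡b rewrite At⇒≡ {q} {peak right} eq
    (trans (cong suc (at (inner right k))) (trans (sym (ℕ.+-suc (2 * a) (suc (toℕ k))))
      (trans (cong (λ x → 2 * a + suc x) ≡b) (ℕ.+-comm (2 * a) a)))) = inner-peak ≡b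
  covers₂ (outer left _) _ _ ()
  covers₂ (peak left) _ _ ()

  covers₃ : ∀ p q → index (pt p) ≡ suc (index (pt q)) → block q ≡ 3 → p <: q
  covers₃ p (peak right) eq refl rewrite At⇒≡ {p} {outer right (proj₁ top)} eq
    (trans (cong suc (cong₂ _+_ (at (peak right)) (proj₂ top))) (trans (sym (ℕ.+-suc (3 * a) b)) (ℕ.+-comm (3 * a) a))) =
    outer-peak (proj₂ top)
  covers₃ p (outer right k) eq refl with prev k
  ... | inj₁ (l , k≡) rewrite At⇒≡ {p} {outer right l} eq
    (trans (sym (ℕ.+-suc (index (pt (outer right k))) (suc (toℕ l)))) (trans (cong (index (pt (outer right k)) +_) (cong suc (sym k≡))) (at (outer right k)))) = outer-outer k≡
  -- The element of height 0 on this chain is the last vertex of the fence; a vertex after it would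
  -- have index 4a.
  ... | inj₂ k≡0 = ⊥-elim (ℕ.<-irrefl
    (trans eq (trans (ℕ.+-comm 1 (index (pt (outer right k)))) (trans (cong (index (pt (outer right k)) +_) (cong suc (sym k≡0))) (at (outer right k)))))
    (s<s (Fin.toℕ<n (pt p))))
  covers₃ _ (inner left _) _ ()

  ⋖⇒<: : ∀ p q → pt p ⋖ pt q → p <: q
  ⋖⇒<: p q (rise₁ eq ≤a) = covers₀ p q eq (in-block p 0 z≤n (subst₂ _≤_ eq (sym (ℕ.*-identityˡ a)) ≤a))
  ⋖⇒<: p q (fall₁ eq a≤ ≤2a) = covers₁ p q eq
    (in-block q 1 (subst (_≤ index (pt q)) (sym (ℕ.*-identityˡ a)) a≤) (subst (_≤ 2 * a) eq ≤2a))
  ⋖⇒<: p q (rise₂ eq 2a≤ ≤3a) = covers₂ p q eq (in-block p 2 2a≤ (subst (_≤ 3 * a) eq ≤3a))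
  ⋖⇒<: p q (fall₂ eq 3a≤) = covers₃ p q eq (in-block q 3 3a≤ (s<s (Fin.toℕ<n (pt q))))

  <:⇒⋖ : ∀ {p q} → p <: q → pt p ⋖ pt q
  <:⇒⋖ (outer-outer {left} {k} {l} l≡) = rise₁ (trans (at (outer left l)) (cong suc (trans l≡ (sym (at (outer left k))))))
    (subst (_≤ a) (sym (at (outer left l))) (s≤s (ℕ.<⇒≤ (Fin.toℕ<n l))))
  <:⇒⋖ (outer-outer {right} {k} {l} l≡) = fall₂ eq (proj₁ (block-bounds (outer right l)))
    where
    eq : index (pt (outer right k)) ≡ suc (index (pt (outer right l)))
    eq = ℕ.+-cancelʳ-≡ (suc (toℕ k)) _ _ (trans (at (outer right k)) (trans (sym (at (outer right l)))
      (trans (cong (λ x → index (pt (outer right l)) + suc x) l≡) (ℕ.+-suc (index (pt (outer right l))) (suc (toℕ k))))))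
  <:⇒⋖ (outer-peak {left} {k} ≡b) = rise₁ (trans (at (peak left)) (cong suc (trans (sym ≡b) (sym (at (outer left k))))))
    (ℕ.≤-reflexive (at (peak left)))
  <:⇒⋖ (outer-peak {right} {k} ≡b) = fall₂ eq (ℕ.≤-reflexive (sym (at (peak right))))
    where
    eq : index (pt (outer right k)) ≡ suc (index (pt (peak right)))
    eq = ℕ.+-cancelʳ-≡ (suc (toℕ k)) _ _ (trans (at (outer right k)) (trans (ℕ.+-comm a (3 * a))
      (trans (ℕ.+-suc (3 * a) b) (cong suc (cong₂ _+_ (sym (at (peak right))) (sym ≡b))))))
  <:⇒⋖ (inner-inner {left} {k} {l} l≡) = fall₁ eq (subst (_≤ index (pt (inner left l))) (ℕ.*-identityˡ a) (proj₁ (block-bounds (inner left l))))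
      (ℕ.<⇒≤ (proj₂ (block-bounds (inner left k))))
    where
    eq : index (pt (inner left k)) ≡ suc (index (pt (inner left l)))
    eq = ℕ.+-cancelʳ-≡ (suc (toℕ k)) _ _ (trans (at (inner left k)) (trans (sym (at (inner left l)))
      (trans (cong (λ x → index (pt (inner left l)) + suc x) l≡) (ℕ.+-suc (index (pt (inner left l))) (suc (toℕ k))))))
  <:⇒⋖ (inner-inner {right} {k} {l} l≡) = rise₂
    (trans (at (inner right l)) (trans (cong (λ x → 2 * a + suc x) l≡) (trans (ℕ.+-suc (2 * a) (suc (toℕ k))) (cong suc (sym (at (inner right k)))))))
    (proj₁ (block-bounds (inner right k))) (ℕ.<⇒≤ (proj₂ (block-bounds (inner right l))))
  <:⇒⋖ (inner-peak {left} {k} ≡b) = fall₁ eq (ℕ.≤-reflexive (sym (at (peak left)))) (ℕ.<⇒≤ (proj₂ (block-bounds (inner left k))))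
    where
    eq : index (pt (inner left k)) ≡ suc (index (pt (peak left)))
    eq = ℕ.+-cancelʳ-≡ (suc (toℕ k)) _ _ (trans (at (inner left k)) (trans (cong (a +_) (ℕ.+-identityʳ a))
      (trans (ℕ.+-suc a b) (cong suc (cong₂ _+_ (sym (at (peak left))) (sym ≡b))))))
  <:⇒⋖ (inner-peak {right} {k} ≡b) = rise₂
    (trans (at (peak right)) (trans (ℕ.+-comm a (2 * a)) (trans (ℕ.+-suc (2 * a) b) (cong suc (trans (cong (2 * a +_) (sym ≡b)) (sym (at (inner right k))))))))
    (proj₁ (block-bounds (inner right k))) (ℕ.≤-reflexive (at (peak right)))
  <:⇒⋖ (valley-inner {left} {k} k≡0) = fall₁ eq (subst (_≤ index (pt (inner left k))) (ℕ.*-identityˡ a) (proj₁ (block-bounds (inner left k))))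
      (ℕ.≤-reflexive (at valley))
    where
    eq : index (pt valley) ≡ suc (index (pt (inner left k)))
    eq = trans (at valley) (trans (sym (at (inner left k))) (trans (cong (λ x → index (pt (inner left k)) + suc x) k≡0) (ℕ.+-comm (index (pt (inner left k))) 1)))
  <:⇒⋖ (valley-inner {right} {k} k≡0) = rise₂ eq (ℕ.≤-reflexive (sym (at valley))) (ℕ.<⇒≤ (proj₂ (block-bounds (inner right k))))
    where
    eq : index (pt (inner right k)) ≡ suc (index (pt valley))
    eq = trans (at (inner right k)) (trans (cong (λ x → 2 * a + suc x) k≡0) (trans (ℕ.+-comm (2 * a) 1) (cong suc (sym (at valley)))))

-- Ideals as states and the action of rowmotion

data Arm : Set where
  free : (o i : ℕ) → Arm
  pair : (l : ℕ) → Arm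

-- An ideal meets the two chains below a peak in o and i elements; the case o = i
-- is the state pair o, where pair a says that the peak is in the ideal, too.
-- The state is full or empty according to whether the valley is in the ideal.

data State : Set where
  full  : Arm → Arm → State
  empty : (o o′ : ℕ) → State

-- The peak will belong to the ideal exactly when `b < peakHeight s`, which among the phases up to a
-- singles out `pair a`. There the chain heights are a as well, one more than a chain has elements;
-- membership is tested by `toℕ k < h`, so this still means the complete chain.
outerHeight innerHeight peakHeight : Arm → ℕ
outerHeight (free o i) = o
outerHeight (pair l)   = l
innerHeight (free o i) = i
innerHeight (pair l)   = l
peakHeight  (free o i) = 0
peakHeight  (pair l)   = l

peak≤outer : ∀ s → peakHeight s ≤ outerHeight s
peak≤outer (free o i) = z≤n
peak≤outer (pair l)   = ℕ.≤-refl

peak≤inner : ∀ s → peakHeight s ≤ innerHeight s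
peak≤inner (free o i) = z≤n
peak≤inner (pair l)   = ℕ.≤-refl

arm : Side → Arm → Arm → Arm
arm left  s t = s
arm right s t = t

O I P : State → Side → ℕ
O (full s t)     d     = outerHeight (arm d s t)
O (empty o o′)   left  = o
O (empty o o′)   right = o′
I (full s t)     d     = innerHeight (arm d s t)
I (empty o o′)   d     = 0
P (full s t)     d     = peakHeight (arm d s t)
P (empty o o′)   d     = 0

V : State → Set
V (full s t)   = ⊤
V (empty o o′) = ⊥

V? : ∀ q → Dec (V q)
V? (full s t)   = yes tt
V? (empty o o′) = no id

P≤O : ∀ q d → P q d ≤ O q d
P≤O (full s t)   d = peak≤outer (arm d s t)
P≤O (empty _ _)  d = z≤n

P≤I : ∀ q d → P q d ≤ I q d
P≤I (full s t)   d = peak≤inner (arm d s t)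
P≤I (empty _ _)  d = z≤n

0<I⇒V : ∀ q {d k} → k < I q d → V q
0<I⇒V (full s t) _ = tt

⟦⟧-cong : ∀ {n} {P Q : Fin n → Set} (P? : U.Decidable P) (Q? : U.Decidable Q) →
          (∀ x → P x ⇔ Q x) → ⟦ P? ⟧ ≡ ⟦ Q? ⟧
⟦⟧-cong P? Q? P⇔Q = Vec.tabulate-cong (λ x → does-⇔ (P⇔Q x) (P? x) (Q? x))

module Dynamics (c : ℕ) where

  open Coordinates c public
  open Fence a public

  ⋖-irreflexive : ∀ {u} → ¬ (u ⋖ u)
  ⋖-irreflexive (rise₁ eq _)   = ℕ.m≢1+m+n _ (trans eq (cong suc (sym (ℕ.+-identityʳ _))))
  ⋖-irreflexive (fall₁ eq _ _) = ℕ.m≢1+m+n _ (trans eq (cong suc (sym (ℕ.+-identityʳ _))))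
  ⋖-irreflexive (rise₂ eq _ _) = ℕ.m≢1+m+n _ (trans eq (cong suc (sym (ℕ.+-identityʳ _))))
  ⋖-irreflexive (fall₂ eq _)   = ℕ.m≢1+m+n _ (trans eq (cong suc (sym (ℕ.+-identityʳ _))))

  -- `Star` is built from its lower end, whereas minimality asks for the last cover before the upper
  -- end.
  unsnoc : ∀ {u v} → u ≼ v → u ≡ v ⊎ ∃ λ w → u ≼ w × w ⋖ v
  unsnoc ε = inj₁ refl
  unsnoc (r ◅ rs) with unsnoc rs
  ... | inj₁ refl              = inj₂ (_ , ε , r)
  ... | inj₂ (w , u≼w , w⋖v) = inj₂ (w , r ◅ u≼w , w⋖v)

  <:-pos : ∀ {p v} → v ⋖ pt p → pos v <: p
  <:-pos {p} {v} r = ⋖⇒<: (pos v) p (subst (_⋖ pt p) (sym (pt∘pos v)) r)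

  pos-<: : ∀ {p v} → pt p ⋖ v → p <: pos v
  pos-<: {p} {v} r = ⋖⇒<: p (pos v) (subst (pt p ⋖_) (sym (pt∘pos v)) r)

  module _ {M : Pos → Set} (M? : U.Decidable M) (closed : ∀ {p q} → p <: q → M q → M p) where

    downset : Subset (4 * a ∸ 1)
    downset = ⟦ M? ∘ pos ⟧

    ∈-downset⁺ : ∀ {v} → M (pos v) → v ∈ downset
    ∈-downset⁺ = ∈⟦⟧⁺ (M? ∘ pos)

    ∈-downset⁻ : ∀ {v} → v ∈ downset → M (pos v)
    ∈-downset⁻ = ∈⟦⟧⁻ (M? ∘ pos)

    M-≼ : ∀ {u v} → u ≼ v → M (pos v) → M (pos u)
    M-≼ ε m = m
    M-≼ {u} (_◅_ {j = w} r rs) m = closed (<:-pos (subst (u ⋖_) (sym (pt∘pos w)) r)) (M-≼ rs m)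

    downset-isIdeal : IsIdeal downset
    downset-isIdeal x y x∈ y≼x = ∈-downset⁺ (M-≼ y≼x (∈-downset⁻ x∈))

    -- It is enough to look at the lower covers: whatever is strictly below `pt p` is below or equal
    -- to one of them, and the down-set contains everything below its elements.
    minimal-local : ∀ p → Minimal (∁ downset) (pt p) ⇔ (¬ M p × (∀ {q} → q <: p → M q))
    minimal-local p = mk⇔ to from
      where
      to : Minimal (∁ downset) (pt p) → ¬ M p × (∀ {q} → q <: p → M q)
      to (p∉ , min) = (λ m → Subset.x∈∁p⇒x∉p p∉ (∈-downset⁺ (subst M (sym (pos∘pt p)) m))) , below
        where
        below : ∀ {q} → q <: p → M q
        below {q} r with M? q
        ... | yes m = m
        ... | no ¬m = ⊥-elim (⋖-irreflexive (subst (_⋖ pt p) (min (pt q)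
            (Subset.x∉p⇒x∈∁p (λ q∈ → ¬m (subst M (pos∘pt q) (∈-downset⁻ q∈)))) (<:⇒⋖ r ◅ ε)) (<:⇒⋖ r)))
      from : ¬ M p × (∀ {q} → q <: p → M q) → Minimal (∁ downset) (pt p)
      from (¬m , below) = Subset.x∉p⇒x∈∁p (λ p∈ → ¬m (subst M (pos∘pt p) (∈-downset⁻ p∈))) , min
        where
        min : ∀ v → v ∈ ∁ downset → v ≼ pt p → v ≡ pt p
        min v v∉ v≼ with unsnoc v≼
        ... | inj₁ eq               = eq
        ... | inj₂ (w , v≼w , w⋖) = ⊥-elim (Subset.x∈∁p⇒x∉p v∉ (∈-downset⁺ (M-≼ v≼w (below (<:-pos w⋖)))))

    maximal-local : ∀ p → Maximal downset (pt p) ⇔ (M p × (∀ {q} → p <: q → ¬ M q))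
    maximal-local p = mk⇔ to from
      where
      to : Maximal downset (pt p) → M p × (∀ {q} → p <: q → ¬ M q)
      to (p∈ , max) = subst M (pos∘pt p) (∈-downset⁻ p∈) , λ {q} r m →
        ⋖-irreflexive (subst (_⋖ pt q) (max (pt q) (∈-downset⁺ (subst M (sym (pos∘pt q)) m)) (<:⇒⋖ r ◅ ε)) (<:⇒⋖ r))
      from : M p × (∀ {q} → p <: q → ¬ M q) → Maximal downset (pt p)
      from (m , above) = ∈-downset⁺ (subst M (sym (pos∘pt p)) m) , max
        where
        max : ∀ v → v ∈ downset → pt p ≼ v → pt p ≡ v
        max v v∈ ε        = refl
        max v v∈ (r ◅ rs) = ⊥-elim (above (pos-<: r) (M-≼ rs (∈-downset⁻ v∈)))

  Mem : State → Pos → Set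
  Mem q (outer d k) = toℕ k < O q d
  Mem q (peak d)    = b < P q d
  Mem q (inner d k) = toℕ k < I q d
  Mem q valley      = V q

  mem? : ∀ q → U.Decidable (Mem q)
  mem? q (outer d k) = toℕ k <? O q d
  mem? q (peak d)    = b <? P q d
  mem? q (inner d k) = toℕ k <? I q d
  mem? q valley      = V? q

  mem-closed : ∀ q {p r} → p <: r → Mem q r → Mem q p
  mem-closed q (outer-outer l≡) m = ℕ.<-trans (ℕ.≤-reflexive (sym l≡)) m
  mem-closed q (outer-peak {d} ≡b) m = ℕ.≤-trans (ℕ.≤-reflexive ≡b) (ℕ.≤-trans (ℕ.<⇒≤ m) (P≤O q d))
  mem-closed q (inner-inner l≡) m = ℕ.<-trans (ℕ.≤-reflexive (sym l≡)) m
  mem-closed q (inner-peak {d} ≡b) m = ℕ.≤-trans (ℕ.≤-reflexive ≡b) (ℕ.≤-trans (ℕ.<⇒≤ m) (P≤I q d))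
  mem-closed q (valley-inner _) m = 0<I⇒V q m

  ideal : State → Ideal
  ideal q = downset (mem? q) (mem-closed q) , [ downset-isIdeal (mem? q) (mem-closed q) ]

  φ : State → Antichain
  φ q = generate⁻¹ (ideal q)

  LocMin LocMax : State → Pos → Set
  LocMin q (outer d k) = toℕ k ≡ O q d
  LocMin q (peak d)    = ¬ (b < P q d) × b ≤ O q d × b ≤ I q d
  LocMin q (inner d k) = toℕ k ≡ I q d × V q
  LocMin q valley      = ¬ V q
  LocMax q (outer d k) = O q d ≡ suc (toℕ k)
  LocMax q (peak d)    = b < P q d
  LocMax q (inner d k) = I q d ≡ suc (toℕ k)
  LocMax q valley      = V q × I q left ≡ 0 × I q right ≡ 0

  locMin? : ∀ q → U.Decidable (LocMin q)
  locMin? q (outer d k) = toℕ k ≟ O q d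
  locMin? q (peak d)    = ¬? (b <? P q d) ×-dec (b ≤? O q d) ×-dec (b ≤? I q d)
  locMin? q (inner d k) = (toℕ k ≟ I q d) ×-dec V? q
  locMin? q valley      = ¬? (V? q)

  minimal⇔locMin : ∀ q p → (¬ Mem q p × (∀ {r} → r <: p → Mem q r)) ⇔ LocMin q p
  minimal⇔locMin q (outer d k) = mk⇔ to from
    where
    to : ¬ Mem q (outer d k) × (∀ {r} → r <: outer d k → Mem q r) → toℕ k ≡ O q d
    to (∉ , below) with prev k
    ... | inj₁ (l , k≡) = ℕ.≤-antisym (subst (_≤ O q d) (sym k≡) (below (outer-outer {d} k≡))) (ℕ.≮⇒≥ ∉)
    ... | inj₂ k≡0      = ℕ.≤-antisym (subst (_≤ O q d) (sym k≡0) z≤n) (ℕ.≮⇒≥ ∉)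
    from : toℕ k ≡ O q d → ¬ Mem q (outer d k) × (∀ {r} → r <: outer d k → Mem q r)
    from eq = ℕ.<-irrefl eq , λ { (outer-outer k≡) → ℕ.≤-reflexive (trans (sym k≡) eq) }
  minimal⇔locMin q (peak d) = mk⇔
    (λ (∉ , below) → ∉ , subst (_≤ O q d) (proj₂ top) (below (outer-peak {d} (proj₂ top)))
                       , subst (_≤ I q d) (proj₂ top) (below (inner-peak {d} (proj₂ top))))
    (λ (∉ , b≤O , b≤I) → ∉ , λ { (outer-peak ≡b) → subst (_≤ O q d) (sym ≡b) b≤O
                                ; (inner-peak ≡b) → subst (_≤ I q d) (sym ≡b) b≤I })
  minimal⇔locMin q (inner d k) = mk⇔ to from
    where
    to : ¬ Mem q (inner d k) × (∀ {r} → r <: inner d k → Mem q r) → toℕ k ≡ I q d × V q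
    to (∉ , below) with prev k
    ... | inj₁ (l , k≡) = ℕ.≤-antisym (subst (_≤ I q d) (sym k≡) l∈) (ℕ.≮⇒≥ ∉) , 0<I⇒V q {d} l∈
      where l∈ = below (inner-inner {d} {l} {k} k≡)
    ... | inj₂ k≡0      = ℕ.≤-antisym (subst (_≤ I q d) (sym k≡0) z≤n) (ℕ.≮⇒≥ ∉) , below (valley-inner {d} k≡0)
    from : toℕ k ≡ I q d × V q → ¬ Mem q (inner d k) × (∀ {r} → r <: inner d k → Mem q r)
    from (eq , v) = ℕ.<-irrefl eq , λ { (inner-inner k≡) → ℕ.≤-reflexive (trans (sym k≡) eq) ; (valley-inner _) → v }
  minimal⇔locMin q valley = mk⇔ proj₁ (λ ∉ → ∉ , λ ())

  -- A height may exceed b only together with the peak. At the top of a chain this makes the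
  -- equation in `LocMax`, height b, equivalent to the chain being complete and the peak missing.
  Tight : State → Set
  Tight q = ∀ d → (b < O q d → b < P q d) × (b < I q d → b < P q d)

  maximal⇔locMax : ∀ q → Tight q → ∀ p → (Mem q p × (∀ {r} → p <: r → ¬ Mem q r)) ⇔ LocMax q p
  maximal⇔locMax q tight (outer d k) = mk⇔ to from
    where
    to : Mem q (outer d k) × (∀ {r} → outer d k <: r → ¬ Mem q r) → O q d ≡ suc (toℕ k)
    to (∈ , above) with next k
    ... | inj₁ (l , l≡) = ℕ.≤-antisym (ℕ.≮⇒≥ (above (outer-outer l≡) ∘ subst (_< O q d) (sym l≡))) ∈
    ... | inj₂ ≡b       = ℕ.≤-antisym (ℕ.≮⇒≥ (above (outer-peak ≡b) ∘ proj₁ (tight d) ∘ subst (_< O q d) ≡b)) ∈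
    from : O q d ≡ suc (toℕ k) → Mem q (outer d k) × (∀ {r} → outer d k <: r → ¬ Mem q r)
    from eq = ℕ.≤-reflexive (sym eq) , λ
      { (outer-outer l≡) → ℕ.<-irrefl (trans l≡ (sym eq))
      ; (outer-peak ≡b) b<P → ℕ.<-irrefl (trans (sym ≡b) (sym eq)) (ℕ.<-≤-trans b<P (P≤O q d)) }
  maximal⇔locMax q tight (peak d) = mk⇔ proj₁ (λ ∈ → ∈ , λ ())
  maximal⇔locMax q tight (inner d k) = mk⇔ to from
    where
    to : Mem q (inner d k) × (∀ {r} → inner d k <: r → ¬ Mem q r) → I q d ≡ suc (toℕ k)
    to (∈ , above) with next k
    ... | inj₁ (l , l≡) = ℕ.≤-antisym (ℕ.≮⇒≥ (above (inner-inner l≡) ∘ subst (_< I q d) (sym l≡))) ∈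
    ... | inj₂ ≡b       = ℕ.≤-antisym (ℕ.≮⇒≥ (above (inner-peak ≡b) ∘ proj₂ (tight d) ∘ subst (_< I q d) ≡b)) ∈
    from : I q d ≡ suc (toℕ k) → Mem q (inner d k) × (∀ {r} → inner d k <: r → ¬ Mem q r)
    from eq = ℕ.≤-reflexive (sym eq) , λ
      { (inner-inner l≡) → ℕ.<-irrefl (trans l≡ (sym eq))
      ; (inner-peak ≡b) b<P → ℕ.<-irrefl (trans (sym ≡b) (sym eq)) (ℕ.<-≤-trans b<P (P≤I q d)) }
  maximal⇔locMax q tight valley = mk⇔
    (λ (∈ , above) → ∈ , ℕ.n<1⇒n≡0 (ℕ.≰⇒> (above (valley-inner {left} {Fin.zero} refl)))
                       , ℕ.n<1⇒n≡0 (ℕ.≰⇒> (above (valley-inner {right} {Fin.zero} refl))))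
    (λ (∈ , l≡0 , r≡0) → ∈ , λ { (valley-inner {left} _) m → ℕ.n≮0 (subst (_ <_) l≡0 m)
                                ; (valley-inner {right} _) m → ℕ.n≮0 (subst (_ <_) r≡0 m) })

  infix 4 _↦_ _⟶_

  -- The heights of a free arm must differ in the source only. The target is unrestricted, since in
  -- `stop` it serves as a carrier of which the outer height alone survives.
  data _↦_ : Arm → Arm → Set where
    free : ∀ {o o′ i i′} → Turn b o o′ → Turn b i i′ → o ≢ i → free o i ↦ free o′ i′
    pair : ∀ {l l′} → Turn a l l′ → pair l ↦ pair l′

  -- The valley enters the new ideal if it was missing, being then minimal in the complement, or if
  -- one of the new inner heights is positive. `stop` is the case in which neither happens.
  data _⟶_ : State → State → Set where
    run   : ∀ {s s′ t t′} → s ↦ s′ → t ↦ t′ → ¬ (innerHeight s′ ≡ 0 × innerHeight t′ ≡ 0) →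
            full s t ⟶ full s′ t′
    stop  : ∀ {s s′ t t′} → s ↦ s′ → t ↦ t′ → innerHeight s′ ≡ 0 → innerHeight t′ ≡ 0 →
            full s t ⟶ empty (outerHeight s′) (outerHeight t′)
    start : ∀ {o o′ s t} → Turn b o (outerHeight s) → Turn b o′ (outerHeight t) →
            innerHeight s ≡ 0 → innerHeight t ≡ 0 → empty o o′ ⟶ full s t

  turn-≤ : ∀ {n k k′} → Turn n k k′ → k ≤ n × k′ ≤ n
  turn-≤ (tick k<n) = ℕ.<⇒≤ k<n , k<n
  turn-≤ wrap       = ℕ.≤-refl , z≤n

  turn-⇔ : ∀ {n o o′ k} → Turn n o o′ → k < n → (k ≡ o) ⇔ (o′ ≡ suc k)
  turn-⇔ (tick _) k<n = mk⇔ (cong suc ∘ sym) (sym ∘ ℕ.suc-injective)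
  turn-⇔ wrap     k<n = mk⇔ (λ eq → ⊥-elim (ℕ.<-irrefl eq k<n)) (λ ())

  ↦-outer : ∀ {s s′ k} → s ↦ s′ → k < b → (k ≡ outerHeight s) ⇔ (outerHeight s′ ≡ suc k)
  ↦-outer (free t _ _) k<b = turn-⇔ t k<b
  ↦-outer (pair t)     k<b = turn-⇔ t (ℕ.m≤n⇒m≤1+n k<b)

  ↦-inner : ∀ {s s′ k} → s ↦ s′ → k < b → (k ≡ innerHeight s) ⇔ (innerHeight s′ ≡ suc k)
  ↦-inner (free _ t _) k<b = turn-⇔ t k<b
  ↦-inner (pair t)     k<b = turn-⇔ t (ℕ.m≤n⇒m≤1+n k<b)

  -- The peak is the next generator when it is missing and both chains below it are complete. In a
  -- free arm two complete chains would have equal heights; a pair is in this situation exactly in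
  -- phase b, and its next phase is a.
  ↦-peak : ∀ {s s′} → s ↦ s′ → (¬ (b < peakHeight s) × b ≤ outerHeight s × b ≤ innerHeight s) ⇔ (b < peakHeight s′)
  ↦-peak (free t u o≢i) = mk⇔
    (λ (_ , b≤o , b≤i) → ⊥-elim (o≢i (trans (ℕ.≤-antisym (proj₁ (turn-≤ t)) b≤o) (ℕ.≤-antisym b≤i (proj₁ (turn-≤ u))))))
    (λ ())
  ↦-peak (pair (tick l<a)) = mk⇔ (λ (_ , b≤l , _) → s≤s b≤l) (λ b≤l → (λ b<l → ℕ.<-irrefl refl (ℕ.<-≤-trans b<l (s≤s⁻¹ l<a))) , s≤s⁻¹ b≤l , s≤s⁻¹ b≤l)
  ↦-peak (pair wrap) = mk⇔ (λ (¬b<a , _) → ⊥-elim (¬b<a ℕ.≤-refl)) (λ ())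

  ↦-tight : ∀ {s s′} → s ↦ s′ → (b < outerHeight s′ → b < peakHeight s′) × (b < innerHeight s′ → b < peakHeight s′)
  ↦-tight (free t u _) = (λ b< → ⊥-elim (ℕ.<⇒≱ b< (proj₂ (turn-≤ t)))) , (λ b< → ⊥-elim (ℕ.<⇒≱ b< (proj₂ (turn-≤ u))))
  ↦-tight (pair _) = id , id

  ⟶-tight : ∀ {q q′} → q ⟶ q′ → Tight q′
  ⟶-tight (run r _ _) left  = ↦-tight r
  ⟶-tight (run _ r _) right = ↦-tight r
  ⟶-tight (stop {s′ = s} r _ i≡0 _) left = (λ b< → ⊥-elim (ℕ.n≮0 (subst (b <_) i≡0 (ℕ.<-≤-trans (proj₁ (↦-tight r) b<) (peak≤inner s))))) , λ ()
  ⟶-tight (stop {t′ = t} _ r _ i≡0) right = (λ b< → ⊥-elim (ℕ.n≮0 (subst (b <_) i≡0 (ℕ.<-≤-trans (proj₁ (↦-tight r) b<) (peak≤inner t))))) , λ ()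
  ⟶-tight (start t _ i≡0 _) left  = (λ b< → ⊥-elim (ℕ.<⇒≱ b< (proj₂ (turn-≤ t)))) , (λ b< → ⊥-elim (ℕ.n≮0 (subst (b <_) i≡0 b<)))
  ⟶-tight (start _ t _ i≡0) right = (λ b< → ⊥-elim (ℕ.<⇒≱ b< (proj₂ (turn-≤ t)))) , (λ b< → ⊥-elim (ℕ.n≮0 (subst (b <_) i≡0 b<)))

  both : {A B : Set} → ¬ A → ¬ B → A ⇔ B
  both ¬a ¬b = mk⇔ (⊥-elim ∘ ¬a) (⊥-elim ∘ ¬b)

  peak-absurd : ∀ s → innerHeight s ≡ 0 → ¬ (b < peakHeight s)
  peak-absurd s i≡0 b< = ℕ.n≮0 (subst (b <_) i≡0 (ℕ.<-≤-trans b< (peak≤inner s)))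

  -- `ρ` takes the maximal elements of an ideal to the minimal elements of its complement. A step is
  -- therefore checked position by position, by comparing the latter with the maximal elements of
  -- the target.
  ⟶-local : ∀ {q q′} → q ⟶ q′ → ∀ p → LocMin q p ⇔ LocMax q′ p
  ⟶-local (run r _ _) (outer left k)  = ↦-outer r (Fin.toℕ<n k)
  ⟶-local (run _ r _) (outer right k) = ↦-outer r (Fin.toℕ<n k)
  ⟶-local (run r _ _) (peak left)     = ↦-peak r
  ⟶-local (run _ r _) (peak right)    = ↦-peak r
  ⟶-local (run r _ _) (inner left k)  = mk⇔ (Equivalence.to e ∘ proj₁) (λ m → Equivalence.from e m , tt)
    where e = ↦-inner r (Fin.toℕ<n k)
  ⟶-local (run _ r _) (inner right k) = mk⇔ (Equivalence.to e ∘ proj₁) (λ m → Equivalence.from e m , tt)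
    where e = ↦-inner r (Fin.toℕ<n k)
  ⟶-local (run _ _ ≢0) valley         = both (λ ¬v → ¬v tt) (≢0 ∘ proj₂)
  ⟶-local (stop r _ _ _) (outer left k)  = ↦-outer r (Fin.toℕ<n k)
  ⟶-local (stop _ r _ _) (outer right k) = ↦-outer r (Fin.toℕ<n k)
  ⟶-local (stop {s′ = s} r _ i≡0 _) (peak left)  = both (peak-absurd s i≡0 ∘ Equivalence.to (↦-peak r)) (λ ())
  ⟶-local (stop {t′ = t} _ r _ i≡0) (peak right) = both (peak-absurd t i≡0 ∘ Equivalence.to (↦-peak r)) (λ ())
  ⟶-local (stop r _ i≡0 _) (inner left k)  = both (λ (eq , _) → case trans (sym i≡0) (Equivalence.to (↦-inner r (Fin.toℕ<n k)) eq) of λ ()) (λ ())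
  ⟶-local (stop _ r _ i≡0) (inner right k) = both (λ (eq , _) → case trans (sym i≡0) (Equivalence.to (↦-inner r (Fin.toℕ<n k)) eq) of λ ()) (λ ())
  ⟶-local (stop _ _ _ _) valley            = both (λ ¬v → ¬v tt) proj₁
  ⟶-local (start t _ _ _) (outer left k)  = turn-⇔ t (Fin.toℕ<n k)
  ⟶-local (start _ t _ _) (outer right k) = turn-⇔ t (Fin.toℕ<n k)
  ⟶-local (start {s = s} _ _ i≡0 _) (peak left)  = both (λ { (_ , _ , ()) }) (peak-absurd s i≡0)
  ⟶-local (start {t = t} _ _ _ i≡0) (peak right) = both (λ { (_ , _ , ()) }) (peak-absurd t i≡0)
  ⟶-local (start _ _ i≡0 _) (inner left k)  = both proj₂ (λ eq → case trans (sym i≡0) eq of λ ())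
  ⟶-local (start _ _ _ i≡0) (inner right k) = both proj₂ (λ eq → case trans (sym i≡0) eq of λ ())
  ⟶-local (start _ _ l≡0 r≡0) valley        = mk⇔ (λ _ → tt , l≡0 , r≡0) (λ _ → id)

  antichain-≡ : {A B : Antichain} → value A ≡ value B → A ≡ B
  antichain-≡ {_ , _} {_ , _} refl = refl

  minimals-complement : ∀ q → minimals (∁ (value (ideal q))) ≡ ⟦ locMin? q ∘ pos ⟧
  minimals-complement q = ⟦⟧-cong (minimal? _) (locMin? q ∘ pos) λ v → subst (λ u → Minimal _ u ⇔ LocMin q (pos v)) (pt∘pos v)
    (minimal⇔locMin q (pos v) ⇔-∘ minimal-local (mem? q) (mem-closed q) (pos v))

  ρ∘φ : ∀ q → value (ρ (φ q)) ≡ ⟦ locMin? q ∘ pos ⟧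
  ρ∘φ q = trans (cong (minimals ∘ ∁ ∘ value) (generate∘generate⁻¹ (ideal q))) (minimals-complement q)

  ρ-step : ∀ {q q′} → q ⟶ q′ → ρ (φ q) ≡ φ q′
  ρ-step {q} {q′} r = antichain-≡ (trans (ρ∘φ q) (⟦⟧-cong (locMin? q ∘ pos) (maximal? _) λ v →
    subst (λ u → LocMin q (pos v) ⇔ Maximal (value (ideal q′)) u) (pt∘pos v)
      (⇔-sym (maximal-local (mem? q′) (mem-closed q′) (pos v)) ⇔-∘
        (⇔-sym (maximal⇔locMax q′ (⟶-tight r) (pos v)) ⇔-∘ ⟶-local r (pos v)))))

-- Every antichain is encoded by exactly one valid state

∣tabulate-+∣ : ∀ m {n} (f : Fin (m + n) → Bool) →
               ∣ tabulate f ∣ ≡ ∣ tabulate (f ∘ (_↑ˡ n)) ∣ + ∣ tabulate (f ∘ (m ↑ʳ_)) ∣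
∣tabulate-+∣ zero    f = refl
∣tabulate-+∣ (suc m) f with f Fin.zero
... | true  = cong suc (∣tabulate-+∣ m (f ∘ Fin.suc))
... | false = ∣tabulate-+∣ m (f ∘ Fin.suc)

bit : Bool → ℕ
bit true  = 1
bit false = 0

∣tabulate∣-suc : ∀ {n} (f : Fin (suc n) → Bool) → ∣ tabulate f ∣ ≡ bit (f Fin.zero) + ∣ tabulate (f ∘ Fin.suc) ∣
∣tabulate∣-suc f with f Fin.zero
... | true  = refl
... | false = refl

∣tabulate∣-last : ∀ {n} (f : Fin (suc n) → Bool) →
                  ∣ tabulate f ∣ ≡ bit (f (Fin.fromℕ n)) + ∣ tabulate (f ∘ Fin.inject₁) ∣
∣tabulate∣-last {zero}  f = ∣tabulate∣-suc f
∣tabulate∣-last {suc n} f = begin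
  ∣ tabulate f ∣                                    ≡⟨ ∣tabulate∣-suc f ⟩
  x + ∣ tabulate (f ∘ Fin.suc) ∣                   ≡⟨ cong (x +_) (∣tabulate∣-last (f ∘ Fin.suc)) ⟩
  x + (y + ∣ tabulate (f ∘ Fin.inject₁ ∘ Fin.suc) ∣) ≡⟨ exchange x y _ ⟩
  y + (x + ∣ tabulate (f ∘ Fin.inject₁ ∘ Fin.suc) ∣) ≡⟨ cong (y +_) (∣tabulate∣-suc (f ∘ Fin.inject₁)) ⟨
  y + ∣ tabulate (f ∘ Fin.inject₁) ∣               ∎
  where
  open ≡-Reasoning
  x = bit (f Fin.zero)
  y = bit (f (Fin.suc (Fin.fromℕ n)))
  exchange : ∀ x y z → x + (y + z) ≡ y + (x + z)
  exchange = solve-∀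

∣tabulate-opposite∣ : ∀ {n} (f : Fin n → Bool) → ∣ tabulate (f ∘ opposite) ∣ ≡ ∣ tabulate f ∣
∣tabulate-opposite∣ {zero}  f = refl
∣tabulate-opposite∣ {suc n} f = begin
  ∣ tabulate (f ∘ opposite) ∣                                      ≡⟨ ∣tabulate∣-suc (f ∘ opposite) ⟩
  bit (f (Fin.fromℕ n)) + ∣ tabulate (f ∘ Fin.inject₁ ∘ opposite) ∣ ≡⟨ cong (bit (f (Fin.fromℕ n)) +_) (∣tabulate-opposite∣ (f ∘ Fin.inject₁)) ⟩
  bit (f (Fin.fromℕ n)) + ∣ tabulate (f ∘ Fin.inject₁) ∣           ≡⟨ ∣tabulate∣-last f ⟨
  ∣ tabulate f ∣                                                   ∎
  where open ≡-Reasoning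

∣tabulate-false∣ : ∀ n → ∣ tabulate {n = n} (λ _ → false) ∣ ≡ 0
∣tabulate-false∣ zero    = refl
∣tabulate-false∣ (suc n) = ∣tabulate-false∣ n

∣tabulate-<∣ : ∀ n h → ∣ tabulate {n = n} (λ k → does (toℕ k <? h)) ∣ ≡ h ⊓ n
∣tabulate-<∣ zero    h       = sym (ℕ.⊓-zeroʳ h)
∣tabulate-<∣ (suc n) zero    = ∣tabulate-false∣ n
∣tabulate-<∣ (suc n) (suc h) = cong suc (∣tabulate-<∣ n h)

∣tabulate-≟∣ : ∀ n h → ∣ tabulate {n = n} (λ k → does (toℕ k ≟ h)) ∣ ≡ bit (does (h <? n))
∣tabulate-≟∣ zero    h       = refl
∣tabulate-≟∣ (suc n) zero    = cong suc (∣tabulate-false∣ n)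
∣tabulate-≟∣ (suc n) (suc h) = ∣tabulate-≟∣ n h

∣tabulate∣-cong : ∀ {n} {f g : Fin n → Bool} → (∀ i → f i ≡ g i) → ∣ tabulate f ∣ ≡ ∣ tabulate g ∣
∣tabulate∣-cong eq = cong ∣_∣ (Vec.tabulate-cong eq)

∣tabulate∣-suc-cong : ∀ {n} (f : Fin (suc n) → Bool) (x : Bool) (g : Fin n → Bool) →
  f Fin.zero ≡ x → (∀ k → f (Fin.suc k) ≡ g k) → ∣ tabulate f ∣ ≡ bit x + ∣ tabulate g ∣
∣tabulate∣-suc-cong f x g refl eq = trans (∣tabulate∣-suc f) (cong (bit x +_) (∣tabulate∣-cong eq))

-- The blocks come in the order of the fence, two of them containing a chain in reverse. The count
-- is regrouped into the valley and the two arms, where reversal does not matter.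
∣tabulate-blocks∣ : ∀ {m n} (f : Fin (m + (suc n + (suc n + (suc n + 0)))) → Bool)
  (outerˡ : Fin m → Bool) (innerˡ innerʳ outerʳ : Fin n → Bool) (peakˡ valley peakʳ : Bool) →
  (∀ k → f (k ↑ˡ (suc n + (suc n + (suc n + 0)))) ≡ outerˡ k) →
  f (m ↑ʳ (Fin.zero {n} ↑ˡ (suc n + (suc n + 0)))) ≡ peakˡ →
  (∀ k → f (m ↑ʳ (Fin.suc k ↑ˡ (suc n + (suc n + 0)))) ≡ innerˡ (opposite k)) →
  f (m ↑ʳ (suc n ↑ʳ (Fin.zero {n} ↑ˡ (suc n + 0)))) ≡ valley →
  (∀ k → f (m ↑ʳ (suc n ↑ʳ (Fin.suc k ↑ˡ (suc n + 0)))) ≡ innerʳ k) →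
  f (m ↑ʳ (suc n ↑ʳ (suc n ↑ʳ (Fin.zero {n} ↑ˡ 0)))) ≡ peakʳ →
  (∀ k → f (m ↑ʳ (suc n ↑ʳ (suc n ↑ʳ (Fin.suc k ↑ˡ 0)))) ≡ outerʳ (opposite k)) →
  ∣ tabulate f ∣ ≡ bit valley + (∣ tabulate outerˡ ∣ + bit peakˡ + ∣ tabulate innerˡ ∣)
                              + (∣ tabulate outerʳ ∣ + bit peakʳ + ∣ tabulate innerʳ ∣)
∣tabulate-blocks∣ {m} {n} f outerˡ innerˡ innerʳ outerʳ peakˡ valley peakʳ o≡ p≡ i≡ v≡ j≡ q≡ r≡ = trans
  (trans (∣tabulate-+∣ m f) (cong₂ _+_ (∣tabulate∣-cong o≡)
    (trans (∣tabulate-+∣ (suc n) (f ∘ (m ↑ʳ_))) (cong₂ _+_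
      (trans (∣tabulate∣-suc-cong (λ k → f (m ↑ʳ (k ↑ˡ (suc n + (suc n + 0))))) peakˡ (innerˡ ∘ opposite) p≡ i≡) (cong (bit peakˡ +_) (∣tabulate-opposite∣ innerˡ)))
      (trans (∣tabulate-+∣ (suc n) (λ k → f (m ↑ʳ (suc n ↑ʳ k)))) (cong₂ _+_
        (∣tabulate∣-suc-cong (λ k → f (m ↑ʳ (suc n ↑ʳ (k ↑ˡ (suc n + 0))))) valley innerʳ v≡ j≡)
        (trans (∣tabulate-+∣ (suc n) (λ k → f (m ↑ʳ (suc n ↑ʳ (suc n ↑ʳ k))))) (cong (_+ 0)
          (trans (∣tabulate∣-suc-cong (λ k → f (m ↑ʳ (suc n ↑ʳ (suc n ↑ʳ (k ↑ˡ 0))))) peakʳ (outerʳ ∘ opposite) q≡ r≡) (cong (bit peakʳ +_) (∣tabulate-opposite∣ outerʳ)))))))))))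
  (rearrange (∣ tabulate outerˡ ∣) (bit peakˡ) (∣ tabulate innerˡ ∣) (bit valley) (∣ tabulate innerʳ ∣) (bit peakʳ) (∣ tabulate outerʳ ∣))
  where
  rearrange : ∀ o p i v j q r → o + (p + i + (v + j + (q + r + 0))) ≡ v + (o + p + i) + (r + q + j)
  rearrange = solve-∀

heights-≡ : ∀ {n h h′} → h ≤ n → h′ ≤ n → (∀ (k : Fin n) → (toℕ k < h) ⇔ (toℕ k < h′)) → h ≡ h′
heights-≡ h≤n h′≤n iff = ℕ.≤-antisym (half h≤n (Equivalence.to ∘ iff)) (half h′≤n (Equivalence.from ∘ iff))
  where
  half : ∀ {n h h′} → h ≤ n → (∀ (k : Fin n) → toℕ k < h → toℕ k < h′) → h ≤ h′
  half {h = h} {h′} h≤n f with ℕ.<-≤-connex h′ h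
  ... | inj₂ h≤h′ = h≤h′
  ... | inj₁ h′<h = ⊥-elim (ℕ.<-irrefl refl (subst (_< h′) k≡ (f (fromℕ< h′<n) (subst (_< h) (sym k≡) h′<h))))
    where
    h′<n = ℕ.<-≤-trans h′<h h≤n
    k≡   = Fin.toℕ-fromℕ< h′<n

-- A down-closed set without the least element is empty; otherwise that element is split off and
-- adds one to the height of the rest.
height : ∀ n {M : Fin n → Set} → U.Decidable M → (∀ {k l} → toℕ l ≡ suc (toℕ k) → M l → M k) →
         ∃ λ h → h ≤ n × (∀ k → M k ⇔ (toℕ k < h))
height zero M? closed = 0 , z≤n , λ ()
height (suc n) {M} M? closed with M? Fin.zero
... | no ¬m₀ = 0 , z≤n , λ k → mk⇔ (⊥-elim ∘ none k) (λ ())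
  where
  none : ∀ k → ¬ M k
  none = Fin.<-weakInduction (¬_ ∘ M) ¬m₀ (λ i ¬m → ¬m ∘ closed (cong suc (sym (Fin.toℕ-inject₁ i))))
... | yes m₀ with height n (M? ∘ Fin.suc) (λ eq → closed (cong suc eq))
...   | h , h≤n , iff = suc h , s≤s h≤n , λ
  { Fin.zero    → mk⇔ (λ _ → z<s) (λ _ → m₀)
  ; (Fin.suc k) → mk⇔ (s<s ∘ Equivalence.to (iff k)) (Equivalence.from (iff k) ∘ s<s⁻¹) }

module Encoding (c : ℕ) where

  open Dynamics c public

  -- The condition `o ≢ i` makes the encoding unique: equal heights are always written as a pair,
  -- whose phases b and a are told apart by the peak.
  data ValidArm : Arm → Set where
    free : ∀ {o i} → o ≤ b → i ≤ b → o ≢ i → ValidArm (free o i)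
    pair : ∀ {l} → l ≤ a → ValidArm (pair l)

  data Valid : State → Set where
    full  : ∀ {s t} → ValidArm s → ValidArm t → Valid (full s t)
    empty : ∀ {o o′} → o ≤ b → o′ ≤ b → Valid (empty o o′)

  record _Describes_ (s : Arm) (M : Pos → Set) (d : Side) : Set where
    field
      outer-iff : ∀ k → M (outer d k) ⇔ (toℕ k < outerHeight s)
      peak-iff  : M (peak d) ⇔ (b < peakHeight s)
      inner-iff : ∀ k → M (inner d k) ⇔ (toℕ k < innerHeight s)

  module _ (M : Pos → Set) (M? : U.Decidable M) (closed : ∀ {p q} → p <: q → M q → M p) where

    decode-arm : ∀ d → ∃ λ s → ValidArm s × (s Describes M) d
    decode-arm d with height b (M? ∘ outer d) (closed ∘ outer-outer) | height b (M? ∘ inner d) (closed ∘ inner-inner)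
    ... | o , o≤b , o-iff | i , i≤b , i-iff with M? (peak d)
    -- The peak forces both chains to be complete, so `o` and `i` are both b and are replaced by the
    -- phase a.
    ...   | yes m = pair a , pair ℕ.≤-refl , record
      { outer-iff = λ k → mk⇔ (λ _ → ℕ.m≤n⇒m≤1+n (Fin.toℕ<n k))
          (λ _ → Equivalence.from (o-iff k) (ℕ.<-≤-trans (Fin.toℕ<n k) (subst (_≤ o) (proj₂ top) (Equivalence.to (o-iff (proj₁ top)) (closed (outer-peak (proj₂ top)) m)))))
      ; peak-iff  = mk⇔ (λ _ → ℕ.≤-refl) (λ _ → m)
      ; inner-iff = λ k → mk⇔ (λ _ → ℕ.m≤n⇒m≤1+n (Fin.toℕ<n k))
          (λ _ → Equivalence.from (i-iff k) (ℕ.<-≤-trans (Fin.toℕ<n k) (subst (_≤ i) (proj₂ top) (Equivalence.to (i-iff (proj₁ top)) (closed (inner-peak (proj₂ top)) m)))))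
      }
    ...   | no ¬m with o ≟ i
    ...     | yes refl = pair o , pair (ℕ.m≤n⇒m≤1+n o≤b) , record
      { outer-iff = o-iff
      ; peak-iff  = both ¬m (ℕ.≤⇒≯ o≤b)
      ; inner-iff = i-iff
      }
    ...     | no o≢i = free o i , free o≤b i≤b o≢i , record
      { outer-iff = o-iff
      ; peak-iff  = both ¬m λ ()
      ; inner-iff = i-iff
      }

    decode : ∃ λ q → Valid q × (∀ p → M p ⇔ Mem q p)
    decode with M? valley
    ... | yes m with decode-arm left | decode-arm right
    ...   | s , s-valid , s-describes | t , t-valid , t-describes = full s t , full s-valid t-valid , λ
      { (outer left k)  → outer-iff s-describes k
      ; (outer right k) → outer-iff t-describes k
      ; (peak left)     → peak-iff s-describes
      ; (peak right)    → peak-iff t-describes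
      ; (inner left k)  → inner-iff s-describes k
      ; (inner right k) → inner-iff t-describes k
      ; valley          → mk⇔ (λ _ → tt) (λ _ → m) }
      where open _Describes_
    decode | no ¬m with height b (M? ∘ outer left) (closed ∘ outer-outer) | height b (M? ∘ outer right) (closed ∘ outer-outer)
    ... | o , o≤b , o-iff | o′ , o′≤b , o′-iff = empty o o′ , empty o≤b o′≤b , λ
      { (outer left k)  → o-iff k
      ; (outer right k) → o′-iff k
      ; (peak d)        → both (¬inner {d} (proj₁ top) ∘ closed (inner-peak (proj₂ top))) λ ()
      ; (inner d k)     → both (¬inner k) λ ()
      ; valley          → both ¬m id }
      where
      ¬inner : ∀ {d} k → ¬ M (inner d k)
      ¬inner {d} = Fin.<-weakInduction (λ k → ¬ M (inner d k)) (¬m ∘ closed (valley-inner refl))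
        (λ i ¬m → ¬m ∘ closed (inner-inner (cong suc (sym (Fin.toℕ-inject₁ i)))))

  φ-from-ideal : ∀ A q → (∀ p → pt p ∈ ↓ value A ⇔ Mem q p) → φ q ≡ A
  φ-from-ideal A q iff = trans (cong generate⁻¹ (ideal-≡ {ideal q} {generate A} eq)) (generate⁻¹∘generate A)
    where
    ideal-≡ : {I J : Ideal} → value I ≡ value J → I ≡ J
    ideal-≡ {_ , _} {_ , _} refl = refl
    eq : value (ideal q) ≡ ↓ value A
    eq = Subset.⊆-antisym
      (λ {v} v∈ → subst (_∈ ↓ value A) (pt∘pos v) (Equivalence.from (iff (pos v)) (∈-downset⁻ (mem? q) (mem-closed q) v∈)))
      (λ {v} v∈ → ∈-downset⁺ (mem? q) (mem-closed q) (Equivalence.to (iff (pos v)) (subst (_∈ ↓ value A) (sym (pt∘pos v)) v∈)))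

  decode-ideal : ∀ S → IsIdeal S → ∃ λ q → Valid q × (∀ p → pt p ∈ S ⇔ Mem q p)
  decode-ideal S isIdeal = decode (λ p → pt p ∈ S) (λ p → pt p Subset.∈? S)
    (λ {p} {r} p<:r r∈ → isIdeal (pt r) (pt p) r∈ (<:⇒⋖ p<:r ◅ ε))

  φ-surjective : ∀ A → ∃ λ q → Valid q × φ q ≡ A
  φ-surjective A = let q , valid , iff = decode-ideal (↓ value A) (↓-isIdeal (value A)) in
    q , valid , φ-from-ideal A q iff

  φ-mem : ∀ {q q′} → φ q ≡ φ q′ → ∀ p → Mem q p ⇔ Mem q′ p
  φ-mem {q} {q′} eq p = mk⇔ (half q q′ ideal-≡) (half q′ q (sym ideal-≡))
    where
    ideal-≡ : value (ideal q) ≡ value (ideal q′)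
    ideal-≡ = cong value (trans (sym (generate∘generate⁻¹ (ideal q))) (trans (cong generate eq) (generate∘generate⁻¹ (ideal q′))))
    half : ∀ q q′ → value (ideal q) ≡ value (ideal q′) → Mem q p → Mem q′ p
    half q q′ eq m = subst (Mem q′) (pos∘pt p) (∈-downset⁻ (mem? q′) (mem-closed q′)
      (subst (pt p ∈_) eq (∈-downset⁺ (mem? q) (mem-closed q) (subst (Mem q) (sym (pos∘pt p)) m))))

  arm-≡ : ∀ {s t} → ValidArm s → ValidArm t → (∀ (k : Fin b) → (toℕ k < outerHeight s) ⇔ (toℕ k < outerHeight t)) →
          (b < peakHeight s) ⇔ (b < peakHeight t) → (∀ (k : Fin b) → (toℕ k < innerHeight s) ⇔ (toℕ k < innerHeight t)) → s ≡ t
  arm-≡ (free o≤ i≤ _) (free o≤′ i≤′ _) oo pp ii = cong₂ free (heights-≡ o≤ o≤′ oo) (heights-≡ i≤ i≤′ ii)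
  -- The free arm has no peak, so the phase of the pair is at most b and can be read off from either
  -- chain; the free heights would have to agree.
  arm-≡ (free o≤ i≤ o≢i) (pair _) oo pp ii = ⊥-elim (o≢i (trans (heights-≡ o≤ l≤b oo) (sym (heights-≡ i≤ l≤b ii))))
    where l≤b = ℕ.≮⇒≥ (ℕ.n≮0 ∘ Equivalence.from pp)
  arm-≡ (pair _) (free o≤ i≤ o≢i) oo pp ii = ⊥-elim (o≢i (trans (sym (heights-≡ l≤b o≤ oo)) (heights-≡ l≤b i≤ ii)))
    where l≤b = ℕ.≮⇒≥ (ℕ.n≮0 ∘ Equivalence.to pp)
  arm-≡ (pair {l} l≤) (pair {l′} l≤′) oo pp ii with b <? l
  -- Membership on the chains does not separate the phases b and a; the peak does.
  ... | yes b<l = cong pair (trans (ℕ.≤-antisym l≤ b<l) (ℕ.≤-antisym (Equivalence.to pp b<l) l≤′))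
  ... | no b≮l  = cong pair (heights-≡ (ℕ.≮⇒≥ b≮l) (ℕ.≮⇒≥ (b≮l ∘ Equivalence.from pp)) oo)

  φ-injective : ∀ {q q′} → Valid q → Valid q′ → φ q ≡ φ q′ → q ≡ q′
  φ-injective {q} {q′} v v′ eq = go v v′ (φ-mem {q} {q′} eq)
    where
    go : ∀ {q q′} → Valid q → Valid q′ → (∀ p → Mem q p ⇔ Mem q′ p) → q ≡ q′
    go (full s t) (full s′ t′) m = cong₂ full
      (arm-≡ s s′ (m ∘ outer left) (m (peak left)) (m ∘ inner left))
      (arm-≡ t t′ (m ∘ outer right) (m (peak right)) (m ∘ inner right))
    go (full _ _) (empty _ _) m = ⊥-elim (Equivalence.to (m valley) tt)
    go (empty _ _) (full _ _) m = ⊥-elim (Equivalence.from (m valley) tt)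
    go (empty o o′) (empty p p′) m = cong₂ empty (heights-≡ o p (m ∘ outer left)) (heights-≡ o′ p′ (m ∘ outer right))

  countˢ : (Pos → Bool) → Side → ℕ
  countˢ χ d = ∣ tabulate (χ ∘ outer d) ∣ + bit (χ (peak d)) + ∣ tabulate (χ ∘ inner d) ∣

  ∣pos∣ : ∀ (χ : Pos → Bool) → ∣ tabulate (χ ∘ pos) ∣ ≡ bit (χ valley) + countˢ χ left + countˢ χ right
  ∣pos∣ χ = ∣tabulate-blocks∣ (χ ∘ pos) (χ ∘ outer left) (χ ∘ inner left) (χ ∘ inner right) (χ ∘ outer right)
    (χ (peak left)) (χ valley) (χ (peak right))
    (cong χ ∘ pos-outer-left)
    (cong χ (pos-block₁ Fin.zero)) (cong χ ∘ pos-block₁ ∘ Fin.suc)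
    (cong χ (pos-block₂ Fin.zero)) (cong χ ∘ pos-block₂ ∘ Fin.suc)
    (cong χ (pos-block₃ Fin.zero)) (cong χ ∘ pos-block₃ ∘ Fin.suc)

-- The cycles of states

mirror : State → State
mirror (full s t)   = full t s
mirror (empty o o′) = empty o′ o

offset-≢ : ∀ {n d} t → d < n → (t + suc d) % suc n ≢ t % suc n
offset-≢ {n} {d} t d<n eq = [m+d]%n≢m (m%[1+n]≤n t n) d<n (trans ([m%n+d]%n≡[m+d]%n t (suc d) (suc n)) eq)

module Model (c : ℕ) where

  open Encoding c public

  mirror-⟶ : ∀ {q q′} → q ⟶ q′ → mirror q ⟶ mirror q′
  mirror-⟶ (run r r′ ≢0)         = run r′ r (λ (x , y) → ≢0 (y , x))
  mirror-⟶ (stop r r′ i≡0 i′≡0)  = stop r′ r i′≡0 i≡0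
  mirror-⟶ (start t t′ i≡0 i′≡0) = start t′ t i′≡0 i≡0

  turn+ : ∀ n d t → Turn n ((t + d) % suc n) ((suc t + d) % suc n)
  turn+ n d t = turn n (t + d)

  -- Modulo a, the outer left and the inner right height exceed the inner left one by x + 1 and y +
  -- 1, and the outer right height exceeds the inner right one by z + 1. For x , y , z < b no two
  -- neighbours ever agree.
  spin : ℕ → ℕ → ℕ → ℕ → State
  spin x y z t = full (free ((t + suc x) % a) (t % a)) (free ((t + (suc y + suc z)) % a) ((t + suc y) % a))

  pairs : ℕ → ℕ → State
  pairs d t = full (pair (t % suc a)) (pair ((t + d) % suc a))

  -- The pair has period a + 1 and the free counters have period a. These are coprime, so the inner
  -- heights return to 0 together after a (a + 1) steps.
  pairˡ : ℕ → ℕ → State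
  pairˡ d t = full (pair (t % suc a)) (free ((t + d) % a) (t % a))

  -- Two equal inner heights run through the phases 0 , … , a modulo suc a,
  -- where in phase 0 the valley is missing and phase suc i is height i.

  midAt : ℕ → ℕ → ℕ → State
  midAt zero    o o′ = empty o o′
  midAt (suc i) o o′ = full (free o i) (free o′ i)

  mid : ℕ → ℕ → State
  mid d t = midAt (t % suc a) (t % a) ((t + d) % a)

  -- Here e + u = b - 1. The pair on the left dissolves when it and the right inner counter reach 0
  -- together. The equal inner heights then make u rounds of a + 1 steps, after which the right
  -- outer height is b in the phase without valley; that state is the additional `suc`. Next a pair
  -- forms on the right, with e and u exchanged.
  halfG : ℕ → ℕ → List State
  halfG e u = applyUpTo (pairˡ (suc e)) (a * suc a) ++ applyUpTo (mid (suc e)) (suc (u * suc a))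

  data Name : Set where
    S : (x y z : Fin b) → Name
    M : (d : Fin a) → Name
    L : Name
    G : (e : Fin b) → Name

  cyc : Name → List State
  cyc (S x y z) = applyUpTo (spin (toℕ x) (toℕ y) (toℕ z)) a
  cyc (M d)     = applyUpTo (pairs (suc (toℕ d))) (suc a)
  cyc L         = applyUpTo (mid 0) (suc (b * suc a)) ++ applyUpTo (pairs 0) (suc a)
  cyc (G e)     = halfG (toℕ e) (toℕ (opposite e)) ++ map mirror (halfG (toℕ (opposite e)) (toℕ e))

  first : Name → State
  first (S x y z) = spin (toℕ x) (toℕ y) (toℕ z) 0
  first (M d)     = pairs (suc (toℕ d)) 0
  first L         = mid 0 0
  first (G e)     = pairˡ (suc (toℕ e)) 0

  first∈ : ∀ j → first j List.∈ cyc j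
  first∈ (S x y z) = here refl
  first∈ (M d)     = here refl
  first∈ L         = here refl
  first∈ (G e)     = here refl

  full-period : ∀ n d → (suc n + d) % suc n ≡ d % suc n
  full-period n d = trans (cong (_% suc n) (ℕ.+-comm (suc n) d)) ([m+n]%n≡m%n d (suc n))

  spin-step : ∀ (x y z : Fin b) t → spin (toℕ x) (toℕ y) (toℕ z) t ⟶ spin (toℕ x) (toℕ y) (toℕ z) (suc t)
  spin-step x y z t = run
    (free (turn+ b _ t) (turn b t) (offset-≢ t (Fin.toℕ<n x)))
    (free (turn+ b _ t) (turn+ b _ t) (λ eq → offset-≢ (t + suc (toℕ y)) (Fin.toℕ<n z) (trans (cong (_% a) (ℕ.+-assoc t _ _)) eq)))
    (λ (i≡0 , j≡0) → offset-≢ (suc t) (Fin.toℕ<n y) (trans j≡0 (sym i≡0)))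

  spin-path : ∀ (x y z : Fin b) → Path _⟶_ (first (S x y z)) (cyc (S x y z)) (first (S x y z))
  spin-path x y z = applyUpToᴾ (spin (toℕ x) (toℕ y) (toℕ z)) b (λ t _ → spin-step x y z t)
    (subst (spin (toℕ x) (toℕ y) (toℕ z) b ⟶_) wraps (spin-step x y z b))
    where
    wraps : spin (toℕ x) (toℕ y) (toℕ z) a ≡ spin (toℕ x) (toℕ y) (toℕ z) 0
    wraps = cong₂ full (cong₂ free (full-period b _) (n%n≡0 a)) (cong₂ free (full-period b _) (full-period b _))

  pairs-step : ∀ (d : Fin a) t → pairs (suc (toℕ d)) t ⟶ pairs (suc (toℕ d)) (suc t)
  pairs-step d t = run (pair (turn a t)) (pair (turn+ a _ t))
    (λ (i≡0 , j≡0) → offset-≢ (suc t) (Fin.toℕ<n d) (trans j≡0 (sym i≡0)))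

  pairs-path : ∀ d → Path _⟶_ (first (M d)) (cyc (M d)) (first (M d))
  pairs-path d = applyUpToᴾ (pairs (suc (toℕ d))) a (λ t _ → pairs-step d t)
    (subst (pairs (suc (toℕ d)) a ⟶_) (cong₂ full (cong pair (n%n≡0 (suc a))) (cong pair (full-period a _))) (pairs-step d a))

  -- The turn of the phase modulo a + 1 decides on the kind of step: `start` from 0, `run` between
  -- heights, `stop` at the wrap.
  midAt-step : ∀ {m m′ o o′ p p′} → Turn a m m′ → Turn b o o′ → Turn b p p′ →
               (∀ {i} → m ≡ suc i → o ≢ i × p ≢ i) → midAt m o p ⟶ midAt m′ o′ p′
  midAt-step {zero}  (tick _)    t u ≢i = start t u refl refl
  midAt-step {suc i} (tick i<b)  t u ≢i =
    run (free t (tick (s<s⁻¹ i<b)) (proj₁ (≢i refl))) (free u (tick (s<s⁻¹ i<b)) (proj₂ (≢i refl))) λ { (() , _) }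
  midAt-step {suc i} wrap t u ≢i =
    stop {s′ = free _ 0} {t′ = free _ 0} (free t wrap (proj₁ (≢i refl))) (free u wrap (proj₂ (≢i refl))) refl refl

  -- `t / suc a` counts the completed rounds. By `collision` the left outer counter, of offset 0,
  -- can meet the inner ones in round b at the earliest, and the right one, of offset d, in round b
  -- - d = u.
  mid-step : ∀ {d u t} → d + u ≡ b → t < u * suc a → mid d t ⟶ mid d (suc t)
  mid-step {d} {u} {t} d+u t< = midAt-step (turn a t) (turn b t) (turn+ b d t) λ {i} m≡ →
    (λ o≡ → ℕ.<⇒≱ t/a<b (subst (b ≤_) (ℕ.+-identityʳ _) (collision {b} {t} {0} (trans (cong (_% a) (ℕ.+-identityʳ t)) o≡) m≡))) ,
    (λ o≡ → ℕ.<⇒≱ t/a+d<b (collision {b} {t} {d} o≡ m≡))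
    where
    t/a<u : t / suc a < u
    t/a<u = m<n*o⇒m/o<n t<
    t/a+d<b : t / suc a + d < b
    t/a+d<b = subst (t / suc a + d <_) (trans (ℕ.+-comm u d) d+u) (ℕ.+-monoˡ-< d t/a<u)
    t/a<b : t / suc a < b
    t/a<b = ℕ.≤-<-trans (ℕ.m≤m+n _ d) t/a+d<b

  mid-at : ∀ d {m} s → m ≤ a → mid d (m + s * suc a) ≡ midAt m ((m + s) % a) ((m + s + d) % a)
  mid-at d {m} s m≤a = cong-midAt
    (trans ([m+kn]%n≡m%n m s (suc a)) (m≤n⇒m%[1+n]≡m m≤a))
    (subst₂ (λ x y → x % a ≡ y % a) (ℕ.+-identityʳ (m + s * suc a)) (ℕ.+-identityʳ (m + s)) ([m+s*[1+n]+d]%n m s 0 a))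
    ([m+s*[1+n]+d]%n m s d a)
    where
    cong-midAt : ∀ {m m′ o o′ p p′} → m ≡ m′ → o ≡ o′ → p ≡ p′ → midAt m o p ≡ midAt m′ o′ p′
    cong-midAt refl refl refl = refl

  mid-end : ∀ {d u} → d + u ≡ b → mid d (u * suc a) ≡ empty (u % a) b
  mid-end {d} {u} d+u = trans (mid-at d u z≤n) (cong (empty (u % a))
    (trans (cong (_% a) (trans (ℕ.+-comm u d) d+u)) (m≤n⇒m%[1+n]≡m ℕ.≤-refl)))

  pairs-diagonal : ∀ t → t < a → pairs 0 t ⟶ pairs 0 (suc t)
  pairs-diagonal t t<a = run (pair (turn a t)) (pair (turn+ a 0 t))
    (λ (i≡0 , _) → case trans (sym (m≤n⇒m%[1+n]≡m t<a)) i≡0 of λ ())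

  L-path : Path _⟶_ (first L) (cyc L) (first L)
  L-path = applyUpToᴾ (mid 0) (b * suc a) (λ t → mid-step {0} {b} refl)
      -- After b rounds both outer heights are b. They wrap to 0 as the valley returns, and both
      -- arms become pairs in phase 0.
      (subst (_⟶ pairs 0 0) (sym (mid-end {0} {b} refl)) (start (subst (λ o → Turn b o 0) (sym (m≤n⇒m%[1+n]≡m ℕ.≤-refl)) wrap) wrap refl refl))
    -- The two pairs reach phase 0 together and the valley is lost; the resulting `empty 0 0` is the
    -- first state of the cycle.
    ++ᴾ applyUpToᴾ (pairs 0) a pairs-diagonal (stop {s′ = pair 0} {t′ = pair 0} (pair last) (pair last′) refl refl)
    where
    last : Turn a (a % suc a) 0
    last = subst (Turn a (a % suc a)) (n%n≡0 (suc a)) (turn a a)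
    last′ : Turn a ((a + 0) % suc a) 0
    last′ = subst (λ x → Turn a (x % suc a) 0) (sym (ℕ.+-identityʳ a)) last

  -- A multiple s (a + 1) of a + 1 is congruent to s modulo a, hence no multiple of a for 0 < s < a.
  pairˡ-≢0 : ∀ t → t < a * suc a → ¬ (t % suc a ≡ 0 × t % a ≡ 0) ⊎ t ≡ 0
  pairˡ-≢0 zero    _  = inj₂ refl
  pairˡ-≢0 t@(suc _) t< = inj₁ λ (m≡0 , i≡0) → t≢0 (t / suc a) (m<n*o⇒m/o<n {t} {a} {suc a} t<)
    (trans (m≡m%n+[m/n]*n t (suc a)) (cong (_+ t / suc a * suc a) m≡0)) i≡0
    where
    t≢0 : ∀ s → s < a → t ≡ s * suc a → t % a ≢ 0
    t≢0 zero    _   ()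
    t≢0 (suc s) s<a eq i≡0 = case (begin
      suc s                        ≡⟨ m<n⇒m%n≡m s<a ⟨
      suc s % a                    ≡⟨ cong (_% a) (ℕ.+-identityʳ (suc s)) ⟨
      (0 + suc s + 0) % a          ≡⟨ [m+s*[1+n]+d]%n 0 (suc s) 0 a ⟨
      (0 + suc s * suc a + 0) % a  ≡⟨ cong (_% a) (ℕ.+-identityʳ (suc s * suc a)) ⟩
      (suc s * suc a) % a          ≡⟨ cong (_% a) eq ⟨
      t % a                        ≡⟨ i≡0 ⟩
      0                            ∎) of λ ()
      where open ≡-Reasoning

  pairˡ-step : ∀ {e} t → e < b → suc t < a * suc a → pairˡ (suc e) t ⟶ pairˡ (suc e) (suc t)
  pairˡ-step {e} t e<b t< = run (pair (turn a t)) (free (turn+ b _ t) (turn b t) (offset-≢ t e<b)) (≢0 (pairˡ-≢0 (suc t) t<))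
    where
    ≢0 : ∀ {A : Set} → A ⊎ suc t ≡ 0 → A
    ≢0 (inj₁ x) = x

  halfG-path : ∀ {e u} → suc (e + u) ≡ b → Path _⟶_ (pairˡ (suc e) 0) (halfG e u) (mirror (pairˡ (suc u) 0))
  halfG-path {e} {u} e+u =
    applyUpToᴾ (pairˡ (suc e)) (a + b * suc a) (λ t t< → pairˡ-step t e<b (s<s t<))
      -- T + 1 = a (a + 1) is a multiple of both periods: the pair and the right inner chain become
      -- empty together. The remaining outer heights 0 and e + 1 are those at the start of
      -- `mid (suc e)`.
      (stop {s′ = pair 0} {t′ = free (suc e % a) 0}
        (pair (subst (Turn a (T % suc a)) ([m+kn]%n≡m%n 0 a (suc a)) (turn a T)))
        (free (subst (Turn b ((T + suc e) % a)) wrap-outer (turn+ b (suc e) T)) (subst (Turn b (T % a)) wrap-inner (turn b T)) (offset-≢ T e<b))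
        refl refl)
    ++ᴾ applyUpToᴾ (mid (suc e)) (u * suc a) (λ t → mid-step {suc e} {u} e+u)
      (subst (_⟶ mirror (pairˡ (suc u) 0)) (sym (mid-end {suc e} {u} e+u)) (start (turn b u) wrap refl refl))
    where
    e<b : e < b
    e<b = subst (e <_) e+u (s≤s (ℕ.m≤m+n e u))
    T : ℕ
    T = a + b * suc a
    wrap-inner : suc T % a ≡ 0
    wrap-inner = trans (cong (_% a) (ℕ.*-comm a (suc a))) ([m+kn]%n≡m%n 0 (suc a) a)
    wrap-outer : (suc T + suc e) % a ≡ suc e % a
    wrap-outer = trans (cong (_% a) (trans (ℕ.+-comm (a * suc a) (suc e)) (cong (suc e +_) (ℕ.*-comm a (suc a))))) ([m+kn]%n≡m%n (suc e) (suc a) a)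

  opposite-sum : ∀ (e : Fin b) → suc (toℕ e + toℕ (opposite e)) ≡ b
  opposite-sum e = trans (ℕ.+-comm (suc (toℕ e)) _) (opposite-toℕ e)

  path : ∀ j → Path _⟶_ (first j) (cyc j) (first j)
  path (S x y z) = spin-path x y z
  path (M d)     = pairs-path d
  path L         = L-path
  path (G e)     = halfG-path (opposite-sum e) ++ᴾ mapᴾ mirror mirror-⟶ (halfG-path (trans (cong suc (ℕ.+-comm (toℕ (opposite e)) (toℕ e))) (opposite-sum e)))

-- Every state lies on a cycle, and the lengths of the cycles add up

unique-concatMap⁻ : {I A : Set} (f : I → List A) → (∀ i → ∃ λ x → x List.∈ f i) →
                    ∀ {is} → Unique (concatMap f is) → Unique is
unique-concatMap⁻ f inhabited {[]}     u = []
unique-concatMap⁻ f inhabited {i ∷ is} u with unique-++⁻ (f i) u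
... | _ , rest , disjoint = All.tabulate (λ { j∈ refl → disjoint (proj₂ (inhabited i)) (List.∈-concat⁺′ (proj₂ (inhabited i)) (List.∈-map⁺ f j∈)) })
  ∷ unique-concatMap⁻ f inhabited rest

length-concatMap : {I A : Set} (f : I → List A) {k : ℕ} → (∀ i → length (f i) ≡ k) → ∀ is → length (concatMap f is) ≡ length is * k
length-concatMap f eq []       = refl
length-concatMap f eq (i ∷ is) = trans (List.length-++ (f i)) (cong₂ _+_ (eq i) (length-concatMap f eq is))

length-cartesianProductWith : {A B C : Set} (f : A → B → C) (xs : List A) (ys : List B) →
                              length (cartesianProductWith f xs ys) ≡ length xs * length ys
length-cartesianProductWith f []       ys = refl
length-cartesianProductWith f (x ∷ xs) ys = trans (List.length-++ (map (f x) ys))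
  (cong₂ _+_ (List.length-map (f x) ys) (length-cartesianProductWith f xs ys))

length-allFin : ∀ n → length (allFin n) ≡ n
length-allFin n = List.length-tabulate {n = n} id

module Coverage (c : ℕ) where

  open Model c public

  Covered : State → Set
  Covered q = ∃ λ j → q List.∈ cyc j

  -- Chinese remainders: the time l + s (a + 1) is l modulo a + 1 and l + s modulo a, and s is
  -- chosen to make the latter i.
  in-pairˡ : ∀ {d l i} → l ≤ a → i ≤ b →
             full (pair l) (free ((i + d) % a) i) List.∈ applyUpTo (pairˡ d) (a * suc a)
  in-pairˡ {d} {l} {i} l≤a i≤b with offset₀ {b} l i≤b
  ... | s , s≤b , refl = subst (List._∈ applyUpTo (pairˡ d) (a * suc a)) eq (List.∈-applyUpTo⁺ (pairˡ d) t<)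
    where
    t< : l + s * suc a < a * suc a
    t< = ℕ.≤-trans (ℕ.+-monoˡ-≤ (s * suc a) (s≤s l≤a)) (ℕ.*-monoˡ-≤ (suc a) (s≤s s≤b))
    eq : pairˡ d (l + s * suc a) ≡ full (pair l) (free (((l + s) % a + d) % a) ((l + s) % a))
    eq = cong₂ full (cong pair (trans ([m+kn]%n≡m%n l s (suc a)) (m≤n⇒m%[1+n]≡m l≤a)))
      (cong₂ free (trans ([m+s*[1+n]+d]%n l s d a) (sym ([m%n+d]%n≡[m+d]%n (l + s) d a)))
        (subst₂ (λ x y → x % a ≡ y % a) (ℕ.+-identityʳ (l + s * suc a)) (ℕ.+-identityʳ (l + s)) ([m+s*[1+n]+d]%n l s 0 a)))

  -- `m` is the phase and `s` the round. The list stops at phase 0 of round u, hence the second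
  -- alternative.
  in-mid : ∀ {d u m s} → m ≤ a → s < u ⊎ s ≡ u × m ≡ 0 →
           midAt m ((m + s) % a) ((m + s + d) % a) List.∈ applyUpTo (mid d) (suc (u * suc a))
  in-mid {d} {u} {m} {s} m≤a bound = subst (List._∈ applyUpTo (mid d) (suc (u * suc a))) (mid-at d s m≤a)
    (List.∈-applyUpTo⁺ (mid d) (s≤s (t≤ bound)))
    where
    t≤ : s < u ⊎ s ≡ u × m ≡ 0 → m + s * suc a ≤ u * suc a
    t≤ (inj₁ s<u)           = ℕ.≤-trans (ℕ.+-monoˡ-≤ (s * suc a) (ℕ.m≤n⇒m≤1+n m≤a)) (ℕ.*-monoˡ-≤ (suc a) s<u)
    t≤ (inj₂ (refl , refl)) = ℕ.≤-refl

  cover-S : ∀ {o i o′ i′} → o ≤ b → i ≤ b → o ≢ i → o′ ≤ b → i′ ≤ b → o′ ≢ i′ → i ≢ i′ → Covered (full (free o i) (free o′ i′))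
  cover-S {i = i} o≤ i≤ o≢i o′≤ i′≤ o′≢i′ i≢i′ with offset i≤ o≤ (o≢i ∘ sym) | offset i≤ i′≤ i≢i′ | offset i′≤ o′≤ (o′≢i′ ∘ sym)
  ... | x , refl | y , refl | z , refl = S x y z ,
    subst (List._∈ cyc (S x y z))
      (cong₂ full (cong (free _) (m≤n⇒m%[1+n]≡m i≤))
        (cong (λ o → free o ((i + suc (toℕ y)) % a))
          (trans (cong (_% a) (sym (ℕ.+-assoc i _ _))) (sym ([m%n+d]%n≡[m+d]%n (i + suc (toℕ y)) (suc (toℕ z)) a)))))
      (List.∈-applyUpTo⁺ (spin (toℕ x) (toℕ y) (toℕ z)) (s≤s i≤))

  cover-pairs : ∀ {l l′} → l ≤ a → l′ ≤ a → Covered (full (pair l) (pair l′))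
  cover-pairs {l} {l′} l≤ l′≤ with l ≟ l′
  ... | yes refl = L , List.∈-++⁺ʳ (applyUpTo (mid 0) (suc (b * suc a))) (subst (List._∈ applyUpTo (pairs 0) (suc a))
    (cong₂ full (cong pair (m≤n⇒m%[1+n]≡m l≤)) (cong pair (trans (cong (_% suc a) (ℕ.+-identityʳ l)) (m≤n⇒m%[1+n]≡m l≤))))
    (List.∈-applyUpTo⁺ (pairs 0) (s≤s l≤)))
  ... | no l≢l′ with offset l≤ l′≤ l≢l′
  ...   | d , refl = M d , subst (List._∈ cyc (M d)) (cong (λ k → full (pair k) (pair ((l + suc (toℕ d)) % suc a))) (m≤n⇒m%[1+n]≡m l≤))
    (List.∈-applyUpTo⁺ (pairs (suc (toℕ d))) (s≤s l≤))

  cover-pairˡ : ∀ {l o i} → l ≤ a → o ≤ b → i ≤ b → o ≢ i → Covered (full (pair l) (free o i))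
  cover-pairˡ l≤ o≤ i≤ o≢i with offset i≤ o≤ (o≢i ∘ sym)
  ... | e , refl = G e , List.∈-++⁺ˡ (List.∈-++⁺ˡ (in-pairˡ l≤ i≤))

  cover-pairʳ : ∀ {l o i} → l ≤ a → o ≤ b → i ≤ b → o ≢ i → Covered (full (free o i) (pair l))
  cover-pairʳ {l} {_} {i} l≤ o≤ i≤ o≢i with offset i≤ o≤ (o≢i ∘ sym)
  -- A pair on the right occurs in the mirrored half, whose parameter is the opposite of the name;
  -- so `opposite` is applied twice.
  ... | u , refl = G (opposite u) , List.∈-++⁺ʳ (halfG (toℕ (opposite u)) (toℕ (opposite (opposite u)))) (List.∈-map⁺ mirror (List.∈-++⁺ˡ
    (subst (λ x → full (pair l) (free ((i + suc (toℕ u)) % a) i) List.∈ applyUpTo (pairˡ (suc (toℕ x))) (a * suc a))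
      (sym (Fin.opposite-involutive u)) (in-pairˡ l≤ i≤))))

  [1+i+b]%a : ∀ {i} → i ≤ b → (suc i + b) % a ≡ i
  [1+i+b]%a {i} i≤ = trans (cong (_% a) (sym (ℕ.+-suc i b))) (trans ([m+n]%n≡m%n i a) (m≤n⇒m%[1+n]≡m i≤))

  -- In round s of the equal inner heights an outer chain collides with them only
  -- in the last round, s = b, counted from the offset of that chain.

  no-collision : ∀ {m o s} → m ≤ a → (∀ {i} → m ≡ suc i → o ≢ i) → (m + s) % a ≡ o → s ≡ b → m ≡ 0
  no-collision {zero}  m≤ ≢i eq refl = refl
  no-collision {suc i} m≤ ≢i eq refl = ⊥-elim (≢i refl (trans (sym eq) ([1+i+b]%a (s≤s⁻¹ m≤))))

  -- The phase and the left outer height determine the round s. Equal outer heights lead to `L`;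
  -- otherwise their difference e + 1 selects `G e`, and s is compared with the number u of rounds
  -- of the first half.
  cover-mid : ∀ {m o o′} → m ≤ a → o ≤ b → o′ ≤ b → (∀ {i} → m ≡ suc i → o ≢ i) → (∀ {i} → m ≡ suc i → o′ ≢ i) →
              Covered (midAt m o o′)
  cover-mid {m} {o} {o′} m≤ o≤ o′≤ ≢i ≢i′ with offset₀ {b} m o≤
  ... | s , s≤b , s≡ with o ≟ o′
  ...   | yes refl = L , List.∈-++⁺ˡ (subst (List._∈ applyUpTo (mid 0) (suc (b * suc a)))
            (cong₂ (midAt m) s≡ (trans (cong (_% a) (ℕ.+-identityʳ (m + s))) s≡))
            (in-mid {0} {b} m≤ (bound (ℕ.m≤n⇒m<n∨m≡n s≤b))))
    where
    bound : s < b ⊎ s ≡ b → s < b ⊎ s ≡ b × m ≡ 0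
    bound (inj₁ s<b) = inj₁ s<b
    bound (inj₂ s≡b) = inj₂ (s≡b , no-collision m≤ ≢i s≡ s≡b)
  ...   | no o≢o′ with offset o≤ o′≤ o≢o′
  ...     | e , o′≡ = round (ℕ.<-cmp s u)
    where
    u = toℕ (opposite e)
    o′≡s : (m + s + suc (toℕ e)) % a ≡ o′
    o′≡s = trans (sym ([m%n+d]%n≡[m+d]%n (m + s) (suc (toℕ e)) a)) (trans (cong (λ x → (x + suc (toℕ e)) % a) s≡) (sym o′≡))
    in-left : s < u ⊎ s ≡ u × m ≡ 0 → Covered (midAt m o o′)
    in-left bound = G e , List.∈-++⁺ˡ (List.∈-++⁺ʳ (applyUpTo (pairˡ (suc (toℕ e))) (a * suc a)) (subst (List._∈ applyUpTo (mid (suc (toℕ e))) (suc (u * suc a)))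
      (cong₂ (midAt m) s≡ o′≡s) (in-mid {suc (toℕ e)} {u} m≤ bound)))
    mirror-midAt : ∀ m {o o′} → mirror (midAt m o o′) ≡ midAt m o′ o
    mirror-midAt zero    = refl
    mirror-midAt (suc i) = refl
    round : _ → Covered (midAt m o o′)
    round (tri< s<u _ _) = in-left (inj₁ s<u)
    -- Here s + e + 1 = b: the right outer counter is in its own last round, so only phase 0 is
    -- possible.
    round (tri≈ _ s≡u _) = in-left (inj₂ (s≡u , no-collision {s = s + suc (toℕ e)} m≤ ≢i′
      (trans (cong (_% a) (sym (ℕ.+-assoc m s (suc (toℕ e))))) o′≡s)
      (trans (cong (_+ suc (toℕ e)) s≡u) (opposite-toℕ e))))
    round (tri> _ _ u<s) = G e , List.∈-++⁺ʳ (halfG (toℕ e) u) (subst (List._∈ map mirror (halfG u (toℕ e))) (mirror-midAt m)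
        (List.∈-map⁺ mirror (List.∈-++⁺ʳ (applyUpTo (pairˡ (suc u)) (a * suc a)) (subst (List._∈ applyUpTo (mid (suc u)) (suc (toℕ e * suc a))) (cong₂ (midAt m) s′≡o′ s′≡o)
          (in-mid {suc u} {toℕ e} m≤ (bound (ℕ.m≤n⇒m<n∨m≡n s′≤e)))))))
      where
      -- In the mirrored half the right outer counter gives the round. Its offset e + 1 is -(u + 1)
      -- modulo a, so the round is s - (u + 1).
      s′ = s ∸ suc u
      s′+u : s′ + suc u ≡ s
      s′+u = ℕ.m∸n+n≡m u<s
      e+u : toℕ e + suc u ≡ b
      e+u = trans (ℕ.+-suc (toℕ e) u) (opposite-sum e)
      s′≤e : s′ ≤ toℕ e
      s′≤e = ℕ.+-cancelʳ-≤ (suc u) s′ (toℕ e) (subst₂ _≤_ (sym s′+u) (sym e+u) s≤b)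
      s′≡o : (m + s′ + suc u) % a ≡ o
      s′≡o = trans (cong (_% a) (trans (ℕ.+-assoc m s′ (suc u)) (cong (m +_) s′+u))) s≡
      s′≡o′ : (m + s′) % a ≡ o′
      s′≡o′ = begin
        (m + s′) % a                            ≡⟨ [m+n]%n≡m%n (m + s′) a ⟨
        (m + s′ + a) % a                        ≡⟨ cong (λ x → (m + s′ + suc x) % a) (opposite-toℕ e) ⟨
        (m + s′ + suc (u + suc (toℕ e))) % a    ≡⟨ cong (_% a) (ℕ.+-assoc (m + s′) (suc u) (suc (toℕ e))) ⟨
        (m + s′ + suc u + suc (toℕ e)) % a      ≡⟨ cong (λ x → (x + suc (toℕ e)) % a) (trans (ℕ.+-assoc m s′ (suc u)) (cong (m +_) s′+u)) ⟩
        (m + s + suc (toℕ e)) % a               ≡⟨ o′≡s ⟩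
        o′                                      ∎
        where open ≡-Reasoning
      bound : s′ < toℕ e ⊎ s′ ≡ toℕ e → s′ < toℕ e ⊎ s′ ≡ toℕ e × m ≡ 0
      bound (inj₁ s′<e) = inj₁ s′<e
      bound (inj₂ s′≡e) = inj₂ (s′≡e , no-collision m≤ ≢i s≡ (trans (sym s′+u) (trans (cong (_+ suc u) s′≡e) e+u)))

  cover : ∀ {q} → Valid q → Covered q
  cover (empty o≤ o′≤) = cover-mid {0} z≤n o≤ o′≤ (λ ()) (λ ())
  cover (full (pair l≤) (pair l′≤)) = cover-pairs l≤ l′≤
  cover (full (pair l≤) (free o≤ i≤ o≢i)) = cover-pairˡ l≤ o≤ i≤ o≢i
  cover (full (free o≤ i≤ o≢i) (pair l≤)) = cover-pairʳ l≤ o≤ i≤ o≢i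
  cover (full (free {i = i} o≤ i≤ o≢i) (free {i = i′} o′≤ i′≤ o′≢i′)) with i ≟ i′
  ... | no i≢i′  = cover-S o≤ i≤ o≢i o′≤ i′≤ o′≢i′ i≢i′
  ... | yes refl = cover-mid {suc i} (s≤s i≤) o≤ o′≤ (λ { refl → o≢i }) (λ { refl → o′≢i′ })

  -- `punchIn o` runs through the heights different from `o`.
  freeArm : Fin a → Fin b → Arm
  freeArm o x = free (toℕ o) (toℕ (punchIn o x))

  arms : List Arm
  arms = map (pair ∘ toℕ) (allFin (suc a)) ++ cartesianProductWith freeArm (allFin a) (allFin b)

  states : List State
  states = cartesianProductWith full arms arms ++ cartesianProductWith (λ o o′ → empty (toℕ o) (toℕ o′)) (allFin a) (allFin a)

  arms-valid : ∀ {s} → s List.∈ arms → ValidArm s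
  arms-valid s∈ with List.∈-++⁻ (map (pair ∘ toℕ) (allFin (suc a))) s∈
  ... | inj₁ ∈pairs with List.∈-map⁻ (pair ∘ toℕ) ∈pairs
  ...   | l , _ , refl = pair (s≤s⁻¹ (Fin.toℕ<n l))
  arms-valid s∈ | inj₂ ∈frees with List.∈-cartesianProductWith⁻ freeArm (allFin a) (allFin b) ∈frees
  ...   | o , x , _ , _ , refl = free (s≤s⁻¹ (Fin.toℕ<n o)) (s≤s⁻¹ (Fin.toℕ<n (punchIn o x))) (Fin.punchInᵢ≢i o x ∘ sym ∘ Fin.toℕ-injective)

  states-valid : ∀ {q} → q List.∈ states → Valid q
  states-valid q∈ with List.∈-++⁻ (cartesianProductWith full arms arms) q∈
  ... | inj₁ ∈full with List.∈-cartesianProductWith⁻ full arms arms ∈full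
  ...   | s , t , s∈ , t∈ , refl = full (arms-valid s∈) (arms-valid t∈)
  states-valid q∈ | inj₂ ∈empty with List.∈-cartesianProductWith⁻ (λ o o′ → empty (toℕ o) (toℕ o′)) (allFin a) (allFin a) ∈empty
  ...   | o , o′ , _ , _ , refl = empty (s≤s⁻¹ (Fin.toℕ<n o)) (s≤s⁻¹ (Fin.toℕ<n o′))

  arms-unique : Unique arms
  arms-unique = Unique.++⁺ (Unique.map⁺ pair-injective (Unique.allFin⁺ (suc a)))
    (Unique.cartesianProductWith⁺ freeArm free-injective (Unique.allFin⁺ a) (Unique.allFin⁺ b)) disjoint
    where
    pair-injective : ∀ {k l : Fin (suc a)} → pair (toℕ k) ≡ pair (toℕ l) → k ≡ l
    pair-injective eq = Fin.toℕ-injective (cong outerHeight eq)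
    free-injective : ∀ {o o′ x x′} → freeArm o x ≡ freeArm o′ x′ → o ≡ o′ × x ≡ x′
    free-injective {o} {o′} {x} {x′} eq with Fin.toℕ-injective (cong outerHeight eq)
    ... | refl = refl , Fin.punchIn-injective o x x′ (Fin.toℕ-injective (cong innerHeight eq))
    disjoint : ∀ {s} → ¬ (s List.∈ map (pair ∘ toℕ) (allFin (suc a)) × s List.∈ cartesianProductWith freeArm (allFin a) (allFin b))
    disjoint (∈pairs , ∈frees) with List.∈-map⁻ (pair ∘ toℕ) ∈pairs | List.∈-cartesianProductWith⁻ freeArm (allFin a) (allFin b) ∈frees
    ... | _ , _ , refl | _ , _ , _ , _ , ()

  states-unique : Unique states
  states-unique = Unique.++⁺ (Unique.cartesianProductWith⁺ full (λ { refl → refl , refl }) arms-unique arms-unique)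
    (Unique.cartesianProductWith⁺ _ empty-injective (Unique.allFin⁺ a) (Unique.allFin⁺ a)) disjoint
    where
    empty-injective : ∀ {o o′ p p′ : Fin a} → empty (toℕ o) (toℕ p) ≡ empty (toℕ o′) (toℕ p′) → o ≡ o′ × p ≡ p′
    empty-injective eq = Fin.toℕ-injective (cong (λ q → O q left) eq) , Fin.toℕ-injective (cong (λ q → O q right) eq)
    disjoint : ∀ {q} → ¬ (q List.∈ cartesianProductWith full arms arms ×
                          q List.∈ cartesianProductWith (λ o o′ → empty (toℕ o) (toℕ o′)) (allFin a) (allFin a))
    disjoint (∈full , ∈empty) with List.∈-cartesianProductWith⁻ full arms arms ∈full
                                 | List.∈-cartesianProductWith⁻ (λ o o′ → empty (toℕ o) (toℕ o′)) (allFin a) (allFin a) ∈empty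
    ... | _ , _ , _ , _ , refl | _ , _ , _ , _ , ()

  length-states : length states ≡ (suc a + a * b) * (suc a + a * b) + a * a
  length-states = trans (List.length-++ (cartesianProductWith full arms arms)) (cong₂ _+_
    (trans (length-cartesianProductWith full arms arms) (cong₂ _*_ length-arms length-arms))
    (trans (length-cartesianProductWith (λ o o′ → empty (toℕ o) (toℕ o′)) (allFin a) (allFin a)) (cong₂ _*_ (length-allFin a) (length-allFin a))))
    where
    length-arms : length arms ≡ suc a + a * b
    length-arms = trans (List.length-++ (map (pair ∘ toℕ) (allFin (suc a)))) (cong₂ _+_
      (trans (List.length-map (pair ∘ toℕ) (allFin (suc a))) (length-allFin (suc a)))
      (trans (length-cartesianProductWith freeArm (allFin a) (allFin b)) (cong₂ _*_ (length-allFin a) (length-allFin b))))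

  nameS : Fin b → Fin b × Fin b → Name
  nameS x (y , z) = S x y z

  pairsOfFin : List (Fin b × Fin b)
  pairsOfFin = cartesianProductWith _,_ (allFin b) (allFin b)

  namesS namesM namesL namesG names : List Name
  namesS = cartesianProductWith nameS (allFin b) pairsOfFin
  namesM = map M (allFin a)
  namesL = L ∷ []
  namesG = map G (allFin b)
  names  = concat (namesS ∷ namesM ∷ namesL ∷ namesG ∷ [])

  all-names : ∀ j → j List.∈ names
  all-names (S x y z) = List.∈-++⁺ˡ (List.∈-cartesianProductWith⁺ nameS {xs = allFin b} {ys = pairsOfFin} (List.∈-allFin x)
    (List.∈-cartesianProductWith⁺ _,_ (List.∈-allFin y) (List.∈-allFin z)))
  all-names (M d) = List.∈-++⁺ʳ namesS (List.∈-++⁺ˡ (List.∈-map⁺ M (List.∈-allFin d)))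
  all-names L     = List.∈-++⁺ʳ namesS (List.∈-++⁺ʳ namesM (here refl))
  all-names (G e) = List.∈-++⁺ʳ namesS (List.∈-++⁺ʳ namesM (there (List.∈-++⁺ˡ (List.∈-map⁺ G (List.∈-allFin e)))))

  data Kind : Set where
    𝕊 𝕄 𝕃 𝔾 : Kind

  kind : Name → Kind
  kind (S _ _ _) = 𝕊
  kind (M _)     = 𝕄
  kind L         = 𝕃
  kind (G _)     = 𝔾

  -- The sizes as they arise from the lists. For `𝔾`: a rounds in each of the two pair runs, e + u =
  -- c rounds of equal inner heights, and one closing empty state in each half.
  orbitSize : Kind → ℕ
  orbitSize 𝕊 = a
  orbitSize 𝕄 = suc a
  orbitSize 𝕃 = suc (b * suc a) + suc a
  orbitSize 𝔾 = (c + 2 * a) * suc a + 2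

  length-halfG : ∀ e u → length (halfG e u) ≡ a * suc a + suc (u * suc a)
  length-halfG e u = trans (List.length-++ (applyUpTo (pairˡ (suc e)) (a * suc a)))
    (cong₂ _+_ (List.length-applyUpTo (pairˡ (suc e)) (a * suc a)) (List.length-applyUpTo (mid (suc e)) (suc (u * suc a))))

  length-cyc : ∀ j → length (cyc j) ≡ orbitSize (kind j)
  length-cyc (S x y z) = List.length-applyUpTo (spin (toℕ x) (toℕ y) (toℕ z)) a
  length-cyc (M d)     = List.length-applyUpTo (pairs (suc (toℕ d))) (suc a)
  length-cyc L         = trans (List.length-++ (applyUpTo (mid 0) (suc (b * suc a))))
    (cong₂ _+_ (List.length-applyUpTo (mid 0) (suc (b * suc a))) (List.length-applyUpTo (pairs 0) (suc a)))
  length-cyc (G e)     = trans (List.length-++ (halfG (toℕ e) u)) (trans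
    (cong₂ _+_ (length-halfG (toℕ e) u) (trans (List.length-map mirror (halfG u (toℕ e))) (length-halfG u (toℕ e))))
    (trans (rearrange a (toℕ e) u) (cong (λ x → (x + 2 * a) * suc a + 2) (ℕ.suc-injective (opposite-sum e)))))
    where
    u = toℕ (opposite e)
    rearrange : ∀ a e u → a * suc a + suc (u * suc a) + (a * suc a + suc (e * suc a)) ≡ (e + u + 2 * a) * suc a + 2
    rearrange = solve-∀

  length-block : ∀ κ js → (∀ {j} → j List.∈ js → kind j ≡ κ) → length (concatMap cyc js) ≡ length js * orbitSize κ
  length-block κ []       _  = refl
  length-block κ (j ∷ js) eq = trans (List.length-++ (cyc j))
    (cong₂ _+_ (trans (length-cyc j) (cong orbitSize (eq (here refl)))) (length-block κ js (eq ∘ there)))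

  kindS : ∀ {j} → j List.∈ namesS → kind j ≡ 𝕊
  kindS j∈ with List.∈-cartesianProductWith⁻ nameS (allFin b) pairsOfFin j∈
  ... | _ , _ , _ , _ , refl = refl

  kindM : ∀ {j} → j List.∈ namesM → kind j ≡ 𝕄
  kindM j∈ with List.∈-map⁻ M j∈
  ... | _ , _ , refl = refl

  kindL : ∀ {j} → j List.∈ namesL → kind j ≡ 𝕃
  kindL (here refl) = refl

  kindG : ∀ {j} → j List.∈ namesG → kind j ≡ 𝔾
  kindG j∈ with List.∈-map⁻ G j∈
  ... | _ , _ , refl = refl

  length-namesS : length namesS ≡ b ^ 3
  length-namesS = trans (length-cartesianProductWith nameS (allFin b) pairsOfFin)
    (cong₂ _*_ (length-allFin b) (trans (length-cartesianProductWith (_,_ {A = Fin b} {B = λ _ → Fin b}) (allFin b) (allFin b))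
      (cong₂ _*_ (length-allFin b) (trans (length-allFin b) (sym (ℕ.*-identityʳ b))))))

  length-namesM : length namesM ≡ a
  length-namesM = trans (List.length-map M (allFin a)) (length-allFin a)

  length-namesG : length namesG ≡ b
  length-namesG = trans (List.length-map G (allFin b)) (length-allFin b)

  -- An arm has a + 1 paired and a b free forms, a² + 1 altogether, so there are (a² + 1)² states
  -- with the valley and a² without it. The orbit sizes add up to the same polynomial.
  length-cycles : length (concatMap cyc names) ≡ length states
  length-cycles = begin
    length (concatMap cyc names)
      ≡⟨ split namesS (namesM ++ namesL ++ namesG ++ []) ⟩
    length (concatMap cyc namesS) + length (concatMap cyc (namesM ++ namesL ++ namesG ++ []))
      ≡⟨ cong (length (concatMap cyc namesS) +_) (trans (split namesM (namesL ++ namesG ++ []))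
         (cong (length (concatMap cyc namesM) +_) (trans (split namesL (namesG ++ []))
         (cong (λ js → length (concatMap cyc namesL) + length (concatMap cyc js)) (List.++-identityʳ namesG))))) ⟩
    length (concatMap cyc namesS) + (length (concatMap cyc namesM) + (length (concatMap cyc namesL) + length (concatMap cyc namesG)))
      ≡⟨ cong₂ _+_ (trans (length-block 𝕊 namesS kindS) (cong (_* a) length-namesS))
         (cong₂ _+_ (trans (length-block 𝕄 namesM kindM) (cong (_* suc a) length-namesM))
         (cong₂ _+_ (length-block 𝕃 namesL kindL) (trans (length-block 𝔾 namesG kindG) (cong (_* orbitSize 𝔾) length-namesG)))) ⟩
    b ^ 3 * a + (a * suc a + (1 * orbitSize 𝕃 + b * orbitSize 𝔾))
      ≡⟨ count c ⟩
    (suc a + a * b) * (suc a + a * b) + a * a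
      ≡⟨ length-states ⟨
    length states ∎
    where
    open ≡-Reasoning
    split : ∀ xs ys → length (concatMap cyc (xs ++ ys)) ≡ length (concatMap cyc xs) + length (concatMap cyc ys)
    split xs ys = trans (cong length (List.concatMap-++ cyc xs ys)) (List.length-++ (concatMap cyc xs))
    count : ∀ c → let b = suc c ; a = suc b in
      b * (b * (b * 1)) * a + (a * suc a + (1 * (suc (b * suc a) + suc a) + b * ((c + 2 * a) * suc a + 2))) ≡ (suc a + a * b) * (suc a + a * b) + a * a
    count = solve-∀

  -- Every entry of the repetition-free list `states` occurs in a cycle and the lengths agree, so
  -- nothing is left over: the cycles are disjoint, have no repetition and consist of valid states.
  cycles-↭-states : states ↭ concatMap cyc names
  cycles-↭-states = unique⊆⇒↭ (concatMap cyc names) states-unique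
    (λ q∈ → let j , q∈j = cover (states-valid q∈) in List.∈-concat⁺′ q∈j (List.∈-map⁺ cyc (all-names j)))
    (ℕ.≤-reflexive length-cycles)

  cycles-unique : Unique (concatMap cyc names)
  cycles-unique = Unique-resp-↭ cycles-↭-states states-unique

  cycles-valid : ∀ {j q} → q List.∈ cyc j → Valid q
  cycles-valid {j} q∈ = states-valid (Perm.∈-resp-↭ (↭-sym cycles-↭-states) (List.∈-concat⁺′ q∈ (List.∈-map⁺ cyc (all-names j))))

  names-unique : Unique names
  names-unique = unique-concatMap⁻ cyc (λ j → first j , first∈ j) cycles-unique

-- Totals over the cycles

sum-map-applyUpTo : {A : Set} (st : A → ℕ) (g : ℕ → A) (n : ℕ) → sum (map st (applyUpTo g n)) ≡ ∑ n (st ∘ g)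
sum-map-applyUpTo st g n = cong sum (List.map-applyUpTo g st n)

sum-map-++ : {A : Set} (st : A → ℕ) (xs ys : List A) → sum (map st (xs ++ ys)) ≡ sum (map st xs) + sum (map st ys)
sum-map-++ st xs ys = trans (cong sum (List.map-++ st xs ys)) (Sum.sum-++ (map st xs) (map st ys))

-- A statistic that adds up local contributions: f and g those of the outer and
-- inner chains, h that of a pair, T and Z those of the valley in full and empty states.

record Stat : Set where
  field
    f g h : ℕ → ℕ
    T Z   : ℕ

  weightArm : Arm → ℕ
  weightArm (free o i) = f o + g i
  weightArm (pair l)   = h l

  weight : State → ℕ
  weight (full s t)   = T + weightArm s + weightArm t
  weight (empty o o′) = Z + f o + f o′

  weight-mirror : ∀ q → weight (mirror q) ≡ weight q
  weight-mirror (full s t)   = exchange T (weightArm t) (weightArm s)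
    where
    exchange : ∀ x y z → x + y + z ≡ x + z + y
    exchange = solve-∀
  weight-mirror (empty o o′) = exchange Z (f o′) (f o)
    where
    exchange : ∀ x y z → x + y + z ≡ x + z + y
    exchange = solve-∀

module Totals (c : ℕ) (st : Stat) where

  open Coverage c
  open Stat st

  -- `round` is what the valley and the two equal inner counters contribute in one round: the phase
  -- without valley, then a heights.
  F G′ H round : ℕ
  F     = ∑ a f
  G′    = ∑ a g
  H     = ∑ (suc a) h
  round = Z + (a * T + 2 * G′)

  kindTotal : Kind → ℕ
  kindTotal 𝕊 = a * T + 2 * F + 2 * G′
  kindTotal 𝕄 = suc a * T + 2 * H
  kindTotal 𝕃 = b * round + Z + 2 * (a * F) + (suc a * T + 2 * H)
  kindTotal 𝔾 = 2 * (a * suc a * T + a * H + suc a * F + suc a * G′) + (c * round + 2 * Z) + 2 * (b * F)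

  ∑-3 : ∀ n x y z → ∑ n (λ t → x t + y t + z t) ≡ ∑ n x + ∑ n y + ∑ n z
  ∑-3 n x y z = trans (∑-distrib n (λ t → x t + y t) z) (cong (_+ ∑ n z) (∑-distrib n x y))

  turns : ∀ (f : ℕ → ℕ) k d → ∑ (k * a) (λ t → f ((t + d) % a)) ≡ k * ∑ a f
  turns f = ∑-turns b f

  turns₀ : ∀ (f : ℕ → ℕ) k → ∑ (k * a) (λ t → f (t % a)) ≡ k * ∑ a f
  turns₀ f k = trans (∑-cong (k * a) (λ t → cong (λ x → f (x % a)) (sym (ℕ.+-identityʳ t)))) (turns f k 0)

  turns⁺ : ∀ (f : ℕ → ℕ) k d → ∑ (k * suc a) (λ t → f ((t + d) % suc a)) ≡ k * ∑ (suc a) f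
  turns⁺ f = ∑-turns a f

  turns⁺₀ : ∀ (f : ℕ → ℕ) k → ∑ (k * suc a) (λ t → f (t % suc a)) ≡ k * ∑ (suc a) f
  turns⁺₀ f k = trans (∑-cong (k * suc a) (λ t → cong (λ x → f (x % suc a)) (sym (ℕ.+-identityʳ t)))) (turns⁺ f k 0)

  turn₁ : ∀ (f : ℕ → ℕ) d → ∑ a (λ t → f ((t + d) % a)) ≡ ∑ a f
  turn₁ f d = trans (cong (λ n → ∑ n (λ t → f ((t + d) % a))) (sym (ℕ.*-identityˡ a))) (trans (turns f 1 d) (ℕ.*-identityˡ (∑ a f)))

  turn₁₀ : ∀ (f : ℕ → ℕ) → ∑ a (λ t → f (t % a)) ≡ ∑ a f
  turn₁₀ f = ∑-cong-< a (λ t t<a → cong f (m<n⇒m%n≡m t<a))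

  turn₁⁺ : ∀ (f : ℕ → ℕ) d → ∑ (suc a) (λ t → f ((t + d) % suc a)) ≡ ∑ (suc a) f
  turn₁⁺ f d = trans (cong (λ n → ∑ n (λ t → f ((t + d) % suc a))) (sym (ℕ.*-identityˡ (suc a)))) (trans (turns⁺ f 1 d) (ℕ.*-identityˡ (∑ (suc a) f)))

  turn₁₀⁺ : ∀ (f : ℕ → ℕ) → ∑ (suc a) (λ t → f (t % suc a)) ≡ ∑ (suc a) f
  turn₁₀⁺ f = ∑-cong-< (suc a) (λ t t<a → cong f (m<n⇒m%n≡m t<a))

  total-spin : ∀ x y z → sum (map weight (applyUpTo (spin x y z) a)) ≡ kindTotal 𝕊
  total-spin x y z = begin
    sum (map weight (applyUpTo (spin x y z) a))
      ≡⟨ sum-map-applyUpTo weight (spin x y z) a ⟩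
    ∑ a (λ t → T + (f ((t + suc x) % a) + g (t % a)) + (f ((t + (suc y + suc z)) % a) + g ((t + suc y) % a)))
      ≡⟨ ∑-3 a (λ _ → T) (λ t → f ((t + suc x) % a) + g (t % a)) (λ t → f ((t + (suc y + suc z)) % a) + g ((t + suc y) % a)) ⟩
    ∑ a (λ _ → T) + ∑ a (λ t → f ((t + suc x) % a) + g (t % a)) + ∑ a (λ t → f ((t + (suc y + suc z)) % a) + g ((t + suc y) % a))
      ≡⟨ cong₂ _+_ (cong₂ _+_ (∑-const a T)
           (trans (∑-distrib a (λ t → f ((t + suc x) % a)) (λ t → g (t % a))) (cong₂ _+_ (turn₁ f (suc x)) (turn₁₀ g))))
           (trans (∑-distrib a (λ t → f ((t + (suc y + suc z)) % a)) (λ t → g ((t + suc y) % a))) (cong₂ _+_ (turn₁ f (suc y + suc z)) (turn₁ g (suc y)))) ⟩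
    a * T + (F + G′) + (F + G′)
      ≡⟨ rearrange (a * T) F G′ ⟩
    a * T + 2 * F + 2 * G′ ∎
    where
    open ≡-Reasoning
    rearrange : ∀ x y z → x + (y + z) + (y + z) ≡ x + 2 * y + 2 * z
    rearrange = solve-∀

  total-pairs : ∀ d → sum (map weight (applyUpTo (pairs d) (suc a))) ≡ kindTotal 𝕄
  total-pairs d = begin
    sum (map weight (applyUpTo (pairs d) (suc a)))
      ≡⟨ sum-map-applyUpTo weight (pairs d) (suc a) ⟩
    ∑ (suc a) (λ t → T + h (t % suc a) + h ((t + d) % suc a))
      ≡⟨ ∑-3 (suc a) (λ _ → T) (λ t → h (t % suc a)) (λ t → h ((t + d) % suc a)) ⟩
    ∑ (suc a) (λ _ → T) + ∑ (suc a) (λ t → h (t % suc a)) + ∑ (suc a) (λ t → h ((t + d) % suc a))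
      ≡⟨ cong₂ _+_ (cong₂ _+_ (∑-const (suc a) T) (turn₁₀⁺ h)) (turn₁⁺ h d) ⟩
    suc a * T + H + H
      ≡⟨ rearrange (suc a * T) H ⟩
    suc a * T + 2 * H ∎
    where
    open ≡-Reasoning
    rearrange : ∀ x y → x + y + y ≡ x + 2 * y
    rearrange = solve-∀

  phase : ℕ → ℕ
  phase zero    = Z
  phase (suc i) = T + 2 * g i

  ∑-phase : ∑ (suc a) phase ≡ round
  ∑-phase = cong (Z +_) (trans (∑-distrib a (λ _ → T) (λ i → 2 * g i)) (cong₂ _+_ (∑-const a T) (∑-double a g)))

  weight-midAt : ∀ m o o′ → weight (midAt m o o′) ≡ phase m + f o + f o′
  weight-midAt zero    o o′ = refl
  weight-midAt (suc i) o o′ = rearrange T (f o) (f o′) (g i)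
    where
    rearrange : ∀ t x y z → t + (x + z) + (y + z) ≡ t + 2 * z + x + y
    rearrange = solve-∀

  -- The outer sums stay unevaluated: in one half of a cycle `G e` the number of these states is not
  -- a multiple of a, and only both halves together complete the turns.
  total-mid : ∀ d u → sum (map weight (applyUpTo (mid d) (suc (u * suc a)))) ≡
              u * round + Z + ∑ (suc (u * suc a)) (λ t → f (t % a)) + ∑ (suc (u * suc a)) (λ t → f ((t + d) % a))
  total-mid d u = begin
    sum (map weight (applyUpTo (mid d) N))
      ≡⟨ sum-map-applyUpTo weight (mid d) N ⟩
    ∑ N (weight ∘ mid d)
      ≡⟨ ∑-cong N (λ t → weight-midAt (t % suc a) (t % a) ((t + d) % a)) ⟩
    ∑ N (λ t → phase (t % suc a) + f (t % a) + f ((t + d) % a))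
      ≡⟨ ∑-3 N (λ t → phase (t % suc a)) (λ t → f (t % a)) (λ t → f ((t + d) % a)) ⟩
    ∑ N (λ t → phase (t % suc a)) + ∑ N (λ t → f (t % a)) + ∑ N (λ t → f ((t + d) % a))
      ≡⟨ cong (λ x → x + ∑ N (λ t → f (t % a)) + ∑ N (λ t → f ((t + d) % a))) phases ⟩
    u * round + Z + ∑ N (λ t → f (t % a)) + ∑ N (λ t → f ((t + d) % a)) ∎
    where
    open ≡-Reasoning
    N = suc (u * suc a)
    phases : ∑ N (λ t → phase (t % suc a)) ≡ u * round + Z
    phases = trans (∑-last (u * suc a) (λ t → phase (t % suc a))) (cong₂ _+_
      (trans (turns⁺₀ phase u) (cong (u *_) ∑-phase))
      (cong phase ([m+kn]%n≡m%n 0 u (suc a))))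

  total-L : sum (map weight (cyc L)) ≡ kindTotal 𝕃
  total-L = trans (sum-map-++ weight (applyUpTo (mid 0) (suc (b * suc a))) (applyUpTo (pairs 0) (suc a)))
    (cong₂ _+_ (begin
      sum (map weight (applyUpTo (mid 0) (suc (b * suc a))))
        ≡⟨ total-mid 0 b ⟩
      b * round + Z + ∑ (suc (b * suc a)) (λ t → f (t % a)) + ∑ (suc (b * suc a)) (λ t → f ((t + 0) % a))
        -- For b rounds the number of states is 1 + (a - 1)(a + 1) = a², a whole number of turns.
        ≡⟨ cong₂ (λ x y → b * round + Z + x + y)
             (trans (cong (λ n → ∑ n (λ t → f (t % a))) (square c)) (turns₀ f a))
             (trans (cong (λ n → ∑ n (λ t → f ((t + 0) % a))) (square c)) (turns f a 0)) ⟩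
      b * round + Z + a * F + a * F
        ≡⟨ rearrange (b * round + Z) (a * F) ⟩
      b * round + Z + 2 * (a * F) ∎)
    (total-pairs 0))
    where
    open ≡-Reasoning
    square : ∀ c → suc (suc c * suc (suc (suc c))) ≡ suc (suc c) * suc (suc c)
    square = solve-∀
    rearrange : ∀ x y → x + y + y ≡ x + 2 * y
    rearrange = solve-∀

  total-pairˡ : ∀ d → sum (map weight (applyUpTo (pairˡ d) (a * suc a))) ≡ a * suc a * T + a * H + suc a * F + suc a * G′
  total-pairˡ d = begin
    sum (map weight (applyUpTo (pairˡ d) N))
      ≡⟨ sum-map-applyUpTo weight (pairˡ d) N ⟩
    ∑ N (λ t → T + h (t % suc a) + (f ((t + d) % a) + g (t % a)))
      ≡⟨ ∑-3 N (λ _ → T) (λ t → h (t % suc a)) (λ t → f ((t + d) % a) + g (t % a)) ⟩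
    ∑ N (λ _ → T) + ∑ N (λ t → h (t % suc a)) + ∑ N (λ t → f ((t + d) % a) + g (t % a))
      ≡⟨ cong₂ _+_ (cong₂ _+_ (∑-const N T) (turns⁺₀ h a)) (trans (∑-distrib N (λ t → f ((t + d) % a)) (λ t → g (t % a)))
           (cong₂ _+_ (trans (cong (λ n → ∑ n (λ t → f ((t + d) % a))) (ℕ.*-comm a (suc a))) (turns f (suc a) d))
                      (trans (cong (λ n → ∑ n (λ t → g (t % a))) (ℕ.*-comm a (suc a))) (turns₀ g (suc a))))) ⟩
    a * suc a * T + a * H + (suc a * F + suc a * G′)
      ≡⟨ ℕ.+-assoc (a * suc a * T + a * H) _ _ ⟨
    a * suc a * T + a * H + suc a * F + suc a * G′ ∎
    where
    open ≡-Reasoning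
    N = a * suc a

  -- An outer chain runs freely through the u rounds of one half and the e rounds of
  -- the other one, with the second run continuing the first modulo a.

  outer-runs : ∀ e u → e + u ≡ c → ∑ (suc (u * suc a)) (λ t → f (t % a)) + ∑ (suc (e * suc a)) (λ t → f ((t + suc u) % a)) ≡ b * F
  outer-runs e u e+u = begin
    ∑ N (λ t → f (t % a)) + ∑ N′ (λ t → f ((t + suc u) % a))
      ≡⟨ cong (∑ N (λ t → f (t % a)) +_) (∑-cong N′ (λ t → cong f (sym (continue t)))) ⟩
    ∑ N (λ t → f (t % a)) + ∑ N′ (λ t → f ((N + t) % a))
      ≡⟨ ∑-+ N N′ (λ t → f (t % a)) ⟨
    ∑ (N + N′) (λ t → f (t % a))
      -- (a - 2)(a + 1) + 2 = (a - 1) a, so the two runs together make b turns.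
      ≡⟨ cong (λ n → ∑ n (λ t → f (t % a))) (trans (rearrange e u a) (trans (cong (λ x → x * suc a + 2) e+u) (lengths c))) ⟩
    ∑ (b * a) (λ t → f (t % a))
      ≡⟨ turns₀ f b ⟩
    b * F ∎
    where
    open ≡-Reasoning
    N  = suc (u * suc a)
    N′ = suc (e * suc a)
    continue : ∀ t → (N + t) % a ≡ (t + suc u) % a
    continue t = trans (cong (_% a) (shuffle u a t)) ([m+kn]%n≡m%n (t + suc u) u a)
      where
      shuffle : ∀ u a t → suc (u * suc a) + t ≡ t + suc u + u * a
      shuffle = solve-∀
    rearrange : ∀ e u a → suc (u * suc a) + suc (e * suc a) ≡ (e + u) * suc a + 2
    rearrange = solve-∀
    lengths : ∀ c → c * suc (suc (suc c)) + 2 ≡ suc c * suc (suc c)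
    lengths = solve-∀

  total-halfG : ∀ e u → sum (map weight (halfG e u)) ≡ a * suc a * T + a * H + suc a * F + suc a * G′ +
    (u * round + Z + ∑ (suc (u * suc a)) (λ t → f (t % a)) + ∑ (suc (u * suc a)) (λ t → f ((t + suc e) % a)))
  total-halfG e u = trans (sum-map-++ weight (applyUpTo (pairˡ (suc e)) (a * suc a)) (applyUpTo (mid (suc e)) (suc (u * suc a))))
    (cong₂ _+_ (total-pairˡ (suc e)) (total-mid (suc e) u))

  sum-mirror : ∀ qs → sum (map weight (map mirror qs)) ≡ sum (map weight qs)
  sum-mirror qs = cong sum (trans (sym (List.map-∘ qs)) (List.map-cong weight-mirror qs))

  total-G : ∀ e u → e + u ≡ c → sum (map weight (halfG e u ++ map mirror (halfG u e))) ≡ kindTotal 𝔾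
  total-G e u e+u = begin
    sum (map weight (halfG e u ++ map mirror (halfG u e)))
      ≡⟨ sum-map-++ weight (halfG e u) (map mirror (halfG u e)) ⟩
    sum (map weight (halfG e u)) + sum (map weight (map mirror (halfG u e)))
      ≡⟨ cong₂ _+_ (total-halfG e u) (trans (sum-mirror (halfG u e)) (total-halfG u e)) ⟩
    X + (u * round + Z + A + A′) + (X + (e * round + Z + B + B′))
      -- Mirroring exchanges the outer chains: the left one has the sum `A` in the first half and
      -- `B′` in the second, the right one `A′` and `B`.
      ≡⟨ rearrange X e u round Z A A′ B B′ ⟩
    2 * X + ((e + u) * round + 2 * Z) + ((A + B′) + (B + A′))
      ≡⟨ cong₂ (λ x y → 2 * X + (x * round + 2 * Z) + y) e+u (trans (cong₂ _+_ (outer-runs e u e+u) (outer-runs u e (trans (ℕ.+-comm u e) e+u)))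
           (cong (b * F +_) (sym (ℕ.+-identityʳ (b * F))))) ⟩
    2 * X + (c * round + 2 * Z) + 2 * (b * F) ∎
    where
    open ≡-Reasoning
    X = a * suc a * T + a * H + suc a * F + suc a * G′
    A = ∑ (suc (u * suc a)) (λ t → f (t % a))
    A′ = ∑ (suc (u * suc a)) (λ t → f ((t + suc e) % a))
    B = ∑ (suc (e * suc a)) (λ t → f (t % a))
    B′ = ∑ (suc (e * suc a)) (λ t → f ((t + suc u) % a))
    rearrange : ∀ x e u r z p p′ q q′ → x + (u * r + z + p + p′) + (x + (e * r + z + q + q′)) ≡ 2 * x + ((e + u) * r + 2 * z) + ((p + q′) + (q + p′))
    rearrange = solve-∀

  total-cyc : ∀ j → sum (map weight (cyc j)) ≡ kindTotal (kind j)
  total-cyc (S x y z) = total-spin (toℕ x) (toℕ y) (toℕ z)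
  total-cyc (M d)     = total-pairs (suc (toℕ d))
  total-cyc L         = total-L
  total-cyc (G e)     = total-G (toℕ e) (toℕ (opposite e)) (ℕ.suc-injective (opposite-sum e))

unique-map : {A B : Set} (φ : A → B) {xs : List A} → (∀ {x y} → x List.∈ xs → y List.∈ xs → φ x ≡ φ y → x ≡ y) →
             Unique xs → Unique (map φ xs)
unique-map φ {[]}     inj []        = []
unique-map φ {x ∷ xs} inj (x∉ ∷ u) = All.map⁺ (All.tabulate (λ y∈ eq → All.lookup x∉ y∈ (inj (here refl) (there y∈) eq)))
  ∷ unique-map φ (λ x∈ y∈ → inj (there x∈) (there y∈)) u

2*∑id : ∀ n → 2 * ∑ (suc n) id ≡ n * suc n
2*∑id zero    = refl
2*∑id (suc n) = trans (cong (2 *_) (∑-last (suc n) id)) (trans (ℕ.*-distribˡ-+ 2 (∑ (suc n) id) (suc n))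
  (trans (cong (_+ 2 * suc n) (2*∑id n)) (rearrange n)))
  where
  rearrange : ∀ n → n * suc n + 2 * suc n ≡ suc n * suc (suc n)
  rearrange = solve-∀

m+n≡o⇒m≡o∸n : ∀ {m n o} → m + n ≡ o → m ≡ o ∸ n
m+n≡o⇒m≡o∸n {m} {n} refl = sym (ℕ.m+n∸n≡m m n)

-- The sizes of ideals and antichains as additive statistics

module Sizes (c : ℕ) where

  open Coverage c public
  open Stat

  -- `antichainStat` counts the minimal elements of the complement: one on every incomplete chain
  -- (on inner chains only if the valley is present), the peak of a pair in phase b, and the valley
  -- when it is missing. In `idealStat` the cap `_⊓ b` matters only in phase a of a pair.
  idealStat antichainStat : Stat
  idealStat = record
    { f = _⊓ b
    ; g = _⊓ b
    ; h = λ l → l ⊓ b + bit (does (b <? l)) + l ⊓ b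
    ; T = 1
    ; Z = 0
    }
  antichainStat = record
    { f = λ o → bit (does (o <? b))
    ; g = λ i → bit (does (i <? b))
    ; h = λ l → bit (does (l <? b)) + bit (does (l ≟ b)) + bit (does (l <? b))
    ; T = 0
    ; Z = 1
    }

  size-ideal : ∀ q → size (ideal q) ≡ weight idealStat q
  size-ideal q = trans (∣pos∣ (does ∘ mem? q)) (weigh q)
    where
    weigh-arm : ∀ s → ∣ tabulate {n = b} (λ k → does (toℕ k <? outerHeight s)) ∣ + bit (does (b <? peakHeight s))
                      + ∣ tabulate {n = b} (λ k → does (toℕ k <? innerHeight s)) ∣ ≡ weightArm idealStat s
    weigh-arm (free o i) = cong₂ _+_ (trans (ℕ.+-identityʳ _) (∣tabulate-<∣ b o)) (∣tabulate-<∣ b i)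
    weigh-arm (pair l)   = cong₂ (λ x y → x + bit (does (b <? l)) + y) (∣tabulate-<∣ b l) (∣tabulate-<∣ b l)
    weigh-outer : ∀ o → ∣ tabulate {n = b} (λ k → does (toℕ k <? o)) ∣ + 0 + ∣ tabulate {n = b} (λ k → does (toℕ k <? 0)) ∣ ≡ o ⊓ b
    weigh-outer o = trans (cong₂ _+_ (trans (ℕ.+-identityʳ _) (∣tabulate-<∣ b o)) (∣tabulate-<∣ b 0)) (ℕ.+-identityʳ (o ⊓ b))
    weigh : ∀ q → bit (does (V? q)) + countˢ (does ∘ mem? q) left + countˢ (does ∘ mem? q) right ≡ weight idealStat q
    weigh (full s t)   = cong₂ (λ x y → 1 + x + y) (weigh-arm s) (weigh-arm t)
    weigh (empty o o′) = cong₂ _+_ (weigh-outer o) (weigh-outer o′)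

  -- Validity enters at the peak of a free arm: if both heights were b, the peak would be minimal in
  -- the complement, but the weight of a free arm does not count it.
  size-ρ : ∀ {q} → Valid q → size (ρ (φ q)) ≡ weight antichainStat q
  size-ρ {q} valid = trans (cong ∣_∣ (ρ∘φ q)) (trans (∣pos∣ (does ∘ locMin? q)) (weigh valid))
    where
    peak-free : ∀ {o i} → o ≤ b → i ≤ b → o ≢ i → ¬ (¬ (b < 0) × b ≤ o × b ≤ i)
    peak-free o≤ i≤ o≢i (_ , b≤o , b≤i) = o≢i (trans (ℕ.≤-antisym o≤ b≤o) (ℕ.≤-antisym b≤i i≤))
    peak-pair : ∀ l → (¬ (b < l) × b ≤ l × b ≤ l) ⇔ (l ≡ b)
    peak-pair l = mk⇔ (λ (b≮l , b≤l , _) → ℕ.≤-antisym (ℕ.≮⇒≥ b≮l) b≤l)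
      (λ l≡b → ℕ.<-irrefl (sym l≡b) , ℕ.≤-reflexive (sym l≡b) , ℕ.≤-reflexive (sym l≡b))
    inner-full : ∀ i → ∣ tabulate {n = b} (λ k → does ((toℕ k ≟ i) ×-dec yes tt)) ∣ ≡ bit (does (i <? b))
    inner-full i = trans (∣tabulate∣-cong {n = b} (λ k → does-⇔ (mk⇔ proj₁ (_, tt)) ((toℕ k ≟ i) ×-dec yes tt) (toℕ k ≟ i))) (∣tabulate-≟∣ b i)
    weigh-arm : ∀ {s} → ValidArm s → ∣ tabulate {n = b} (λ k → does (toℕ k ≟ outerHeight s)) ∣
      + bit (does (¬? (b <? peakHeight s) ×-dec (b ≤? outerHeight s) ×-dec (b ≤? innerHeight s)))
      + ∣ tabulate {n = b} (λ k → does ((toℕ k ≟ innerHeight s) ×-dec yes tt)) ∣ ≡ weightArm antichainStat s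
    weigh-arm (free {o} {i} o≤ i≤ o≢i) = cong₂ _+_
      (trans (cong₂ _+_ (∣tabulate-≟∣ b o) (cong bit (dec-false (¬? (b <? 0) ×-dec (b ≤? o) ×-dec (b ≤? i)) (peak-free o≤ i≤ o≢i))))
        (ℕ.+-identityʳ _))
      (inner-full i)
    weigh-arm (pair {l} l≤) = cong₂ _+_
      (cong₂ _+_ (∣tabulate-≟∣ b l) (cong bit (does-⇔ (peak-pair l) (¬? (b <? l) ×-dec (b ≤? l) ×-dec (b ≤? l)) (l ≟ b))))
      (inner-full l)
    weigh-outer : ∀ o → ∣ tabulate {n = b} (λ k → does (toℕ k ≟ o)) ∣
      + bit (does (¬? (b <? 0) ×-dec (b ≤? o) ×-dec (b ≤? 0)))
      + ∣ tabulate {n = b} (λ k → does ((toℕ k ≟ 0) ×-dec no id)) ∣ ≡ bit (does (o <? b))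
    weigh-outer o = trans (cong₂ _+_
      (cong₂ _+_ (∣tabulate-≟∣ b o) (cong bit (dec-false (¬? (b <? 0) ×-dec (b ≤? o) ×-dec (b ≤? 0)) λ { (_ , _ , ()) })))
      (trans (∣tabulate∣-cong {n = b} (λ k → dec-false ((toℕ k ≟ 0) ×-dec no id) proj₂)) (∣tabulate-false∣ b)))
      (trans (ℕ.+-identityʳ _) (ℕ.+-identityʳ _))
    weigh : ∀ {q} → Valid q → bit (does (¬? (V? q))) + countˢ (does ∘ locMin? q) left + countˢ (does ∘ locMin? q) right ≡ weight antichainStat q
    weigh (full s t)           = cong₂ _+_ (weigh-arm s) (weigh-arm t)
    weigh (empty {o} {o′} _ _) = cong₂ (λ x y → 1 + x + y) (weigh-outer o) (weigh-outer o′)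

  module Iᵗ = Totals c idealStat
  module Aᵗ = Totals c antichainStat

  ideal-F : 2 * Iᵗ.F ≡ b * a
  ideal-F = trans (cong (2 *_) (∑-cong-< a (λ k k<a → ℕ.m≤n⇒m⊓n≡m (s≤s⁻¹ k<a)))) (2*∑id b)

  -- Up to phase b a pair has twice as many elements as its phase says; in phase a it is the
  -- complete arm of 2b + 1 elements.
  ideal-H : Iᵗ.H ≡ 2 * Iᵗ.F + (b + 1 + b)
  ideal-H = trans (∑-last a (h idealStat)) (cong₂ _+_
    (trans (∑-cong-< a small) (∑-double a (_⊓ b)))
    (cong₂ (λ x y → x + bit y + x) (ℕ.m≥n⇒m⊓n≡n (ℕ.n≤1+n b)) (dec-true (b <? a) ℕ.≤-refl)))
    where
    small : ∀ l → l < a → h idealStat l ≡ 2 * (l ⊓ b)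
    small l l<a rewrite dec-false (b <? l) (ℕ.≤⇒≯ (s≤s⁻¹ l<a)) = rearrange (l ⊓ b)
      where
      rearrange : ∀ x → x + 0 + x ≡ 2 * x
      rearrange = solve-∀

  antichain-F : Aᵗ.F ≡ b
  antichain-F = trans (∑-last b (f antichainStat)) (trans (cong₂ _+_
    (trans (∑-cong-< b (λ k k<b → cong bit (dec-true (k <? b) k<b))) (trans (∑-const b 1) (ℕ.*-identityʳ b)))
    (cong bit (dec-false (b <? b) (ℕ.<-irrefl refl)))) (ℕ.+-identityʳ b))

  -- A pair contributes 2 in each phase below b, then 1 for the peak, and 0 in phase a, when the arm
  -- is complete.
  antichain-H : Aᵗ.H ≡ 2 * b + 1
  antichain-H = trans (∑-last a (h antichainStat)) (trans (cong₂ _+_ (∑-last b (h antichainStat)) last)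
    (trans (ℕ.+-identityʳ _) (cong₂ _+_ (trans (∑-cong-< b small) (trans (∑-const b 2) (ℕ.*-comm b 2))) middle)))
    where
    small : ∀ l → l < b → h antichainStat l ≡ 2
    small l l<b rewrite dec-true (l <? b) l<b | dec-false (l ≟ b) (ℕ.<⇒≢ l<b) = refl
    middle : h antichainStat b ≡ 1
    middle rewrite dec-false (b <? b) (ℕ.<-irrefl refl) | dec-true (b ≟ b) refl = refl
    last : h antichainStat a ≡ 0
    last rewrite dec-false (a <? b) (ℕ.≤⇒≯ (ℕ.n≤1+n b)) | dec-false (a ≟ b) ℕ.1+n≢n = refl

  antichainValue idealValue : Kind → ℕ
  antichainValue 𝕊 = 4 * a ∸ 4
  antichainValue 𝕄 = 4 * a ∸ 2
  antichainValue 𝕃 = 4 * a ^ 2 ∸ a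
  antichainValue 𝔾 = (12 * a ^ 2 ∸ 11 * a) + 2
  idealValue 𝕊 = 2 * a ^ 2 ∸ a
  idealValue 𝕄 = (2 * a ^ 2 + 3 * a) ∸ 1
  idealValue 𝕃 = (2 * a ^ 3 + 3 * a) ∸ 1
  idealValue 𝔾 = 6 * a ^ 3 ∸ a

  -- Each value is reached through a polynomial identity with the subtrahend on the other side, so
  -- that truncated subtraction stays out of the computation.
  antichain-total : ∀ κ → Aᵗ.kindTotal κ ≡ antichainValue κ
  antichain-total 𝕊 = trans (cong (λ F → a * 0 + 2 * F + 2 * F) antichain-F) (m+n≡o⇒m≡o∸n (identity c))
    where
    identity : ∀ c → let b = suc c ; a = suc b in a * 0 + 2 * b + 2 * b + 4 ≡ 4 * a
    identity = solve-∀
  antichain-total 𝕄 = trans (cong (λ H → suc a * 0 + 2 * H) antichain-H) (m+n≡o⇒m≡o∸n (identity c))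
    where
    identity : ∀ c → let b = suc c ; a = suc b in suc a * 0 + 2 * (2 * b + 1) + 2 ≡ 4 * a
    identity = solve-∀
  antichain-total 𝕃 = trans
    (cong₂ (λ F H → b * (1 + (a * 0 + 2 * F)) + 1 + 2 * (a * F) + (suc a * 0 + 2 * H)) antichain-F antichain-H)
    (m+n≡o⇒m≡o∸n (identity c))
    where
    identity : ∀ c → let b = suc c ; a = suc b in
      b * (1 + (a * 0 + 2 * b)) + 1 + 2 * (a * b) + (suc a * 0 + 2 * (2 * b + 1)) + a ≡ 4 * (a * (a * 1))
    identity = solve-∀
  antichain-total 𝔾 = trans
    (cong₂ (λ F H → 2 * (a * suc a * 0 + a * H + suc a * F + suc a * F) + (c * (1 + (a * 0 + 2 * F)) + 2 * 1) + 2 * (b * F))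
      antichain-F antichain-H)
    (trans (identity c) (cong (_+ 2) (m+n≡o⇒m≡o∸n {12 * (a * b) + a} {11 * a} (difference c))))
    where
    identity : ∀ c → let b = suc c ; a = suc b in
      2 * (a * suc a * 0 + a * (2 * b + 1) + suc a * b + suc a * b) + (c * (1 + (a * 0 + 2 * b)) + 2 * 1) + 2 * (b * b)
      ≡ 12 * (a * b) + a + 2
    identity = solve-∀
    difference : ∀ c → let b = suc c ; a = suc b in 12 * (a * b) + a + 11 * a ≡ 12 * (a * (a * 1))
    difference = solve-∀

  -- The sum of the heights is available as 2 F = b a. For `𝕃` and `𝔾`, `double` therefore first
  -- brings every F into the form 2 F.
  ideal-total : ∀ κ → Iᵗ.kindTotal κ ≡ idealValue κ
  ideal-total 𝕊 = trans (cong (λ X → a * 1 + X + X) ideal-F) (m+n≡o⇒m≡o∸n (identity c))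
    where
    identity : ∀ c → let b = suc c ; a = suc b in a * 1 + b * a + b * a + a ≡ 2 * (a * (a * 1))
    identity = solve-∀
  ideal-total 𝕄 = trans (cong (λ H → suc a * 1 + 2 * H) ideal-H)
    (trans (cong (λ X → suc a * 1 + 2 * (X + (b + 1 + b))) ideal-F) (m+n≡o⇒m≡o∸n (identity c)))
    where
    identity : ∀ c → let b = suc c ; a = suc b in suc a * 1 + 2 * (b * a + (b + 1 + b)) + 1 ≡ 2 * (a * (a * 1)) + 3 * a
    identity = solve-∀
  ideal-total 𝕃 = trans (cong (λ H → b * (0 + (a * 1 + 2 * Iᵗ.F)) + 0 + 2 * (a * Iᵗ.F) + (suc a * 1 + 2 * H)) ideal-H)
    (trans (double c Iᵗ.F) (trans (cong (λ X → b * (a + X) + a * X + (suc a + 2 * (X + (b + 1 + b)))) ideal-F) (m+n≡o⇒m≡o∸n (identity c))))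
    where
    double : ∀ c F → let b = suc c ; a = suc b in
      b * (0 + (a * 1 + 2 * F)) + 0 + 2 * (a * F) + (suc a * 1 + 2 * (2 * F + (b + 1 + b)))
      ≡ b * (a + 2 * F) + a * (2 * F) + (suc a + 2 * (2 * F + (b + 1 + b)))
    double = solve-∀
    identity : ∀ c → let b = suc c ; a = suc b in
      b * (a + b * a) + a * (b * a) + (suc a + 2 * (b * a + (b + 1 + b))) + 1 ≡ 2 * (a * (a * (a * 1))) + 3 * a
    identity = solve-∀
  ideal-total 𝔾 = trans
    (cong (λ H → 2 * (a * suc a * 1 + a * H + suc a * Iᵗ.F + suc a * Iᵗ.F) + (c * (0 + (a * 1 + 2 * Iᵗ.F)) + 2 * 0) + 2 * (b * Iᵗ.F)) ideal-H)
    (trans (double c Iᵗ.F) (trans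
      (cong (λ X → 2 * (a * suc a + a * (X + (b + 1 + b)) + suc a * X) + c * (a + X) + b * X) ideal-F)
      (m+n≡o⇒m≡o∸n (identity c))))
    where
    double : ∀ c F → let b = suc c ; a = suc b in
      2 * (a * suc a * 1 + a * (2 * F + (b + 1 + b)) + suc a * F + suc a * F) + (c * (0 + (a * 1 + 2 * F)) + 2 * 0) + 2 * (b * F)
      ≡ 2 * (a * suc a + a * (2 * F + (b + 1 + b)) + suc a * (2 * F)) + c * (a + 2 * F) + b * (2 * F)
    double = solve-∀
    identity : ∀ c → let b = suc c ; a = suc b in
      2 * (a * suc a + a * (b * a + (b + 1 + b)) + suc a * (b * a)) + c * (a + b * a) + b * (b * a) + a ≡ 6 * (a * (a * (a * 1)))
    identity = solve-∀

  sizeValue : Kind → ℕ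
  sizeValue 𝕊 = a
  sizeValue 𝕄 = a + 1
  sizeValue 𝕃 = a ^ 2 + a + 1
  sizeValue 𝔾 = 3 * a ^ 2 + a

  orbitSize-value : ∀ κ → orbitSize κ ≡ sizeValue κ
  orbitSize-value 𝕊 = refl
  orbitSize-value 𝕄 = ℕ.+-comm 1 a
  orbitSize-value 𝕃 = identity c
    where
    identity : ∀ c → let b = suc c ; a = suc b in suc (b * suc a) + suc a ≡ a * (a * 1) + a + 1
    identity = solve-∀
  orbitSize-value 𝔾 = identity c
    where
    identity : ∀ c → let b = suc c ; a = suc b in (c + 2 * a) * suc a + 2 ≡ 3 * (a * (a * 1)) + a
    identity = solve-∀

  -- The four sizes increase strictly: a < a + 1 < a² + a + 1 < 3a² + a. Hence the size of an orbit
  -- determines its kind, which yields both homometries.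
  orbitSize-injective : ∀ κ κ′ → orbitSize κ ≡ orbitSize κ′ → κ ≡ κ′
  orbitSize-injective = go
    where
    S<M : a < suc a
    S<M = ℕ.n<1+n a
    M<L : suc a < suc (b * suc a) + suc a
    M<L = ℕ.m<n+m (suc a) {suc (b * suc a)} z<s
    L<G : suc (b * suc a) + suc a < (c + 2 * a) * suc a + 2
    L<G = subst (suc (b * suc a) + suc a <_) (gap c) (ℕ.m<m+n (suc (b * suc a) + suc a) {suc ((c + a) * suc a)} z<s)
      where
      gap : ∀ c → let b = suc c ; a = suc b in suc (b * suc a) + suc a + suc ((c + a) * suc a) ≡ (c + 2 * a) * suc a + 2
      gap = solve-∀
    S<L = ℕ.<-trans S<M M<L
    M<G = ℕ.<-trans M<L L<G
    S<G = ℕ.<-trans S<M M<G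
    go : ∀ κ κ′ → orbitSize κ ≡ orbitSize κ′ → κ ≡ κ′
    go 𝕊 𝕊 _ = refl
    go 𝕄 𝕄 _ = refl
    go 𝕃 𝕃 _ = refl
    go 𝔾 𝔾 _ = refl
    go 𝕊 𝕄 eq = ⊥-elim (ℕ.<⇒≢ S<M eq)
    go 𝕊 𝕃 eq = ⊥-elim (ℕ.<⇒≢ S<L eq)
    go 𝕊 𝔾 eq = ⊥-elim (ℕ.<⇒≢ S<G eq)
    go 𝕄 𝕃 eq = ⊥-elim (ℕ.<⇒≢ M<L eq)
    go 𝕄 𝔾 eq = ⊥-elim (ℕ.<⇒≢ M<G eq)
    go 𝕃 𝔾 eq = ⊥-elim (ℕ.<⇒≢ L<G eq)
    go 𝕄 𝕊 eq = ⊥-elim (ℕ.<⇒≢ S<M (sym eq))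
    go 𝕃 𝕊 eq = ⊥-elim (ℕ.<⇒≢ S<L (sym eq))
    go 𝔾 𝕊 eq = ⊥-elim (ℕ.<⇒≢ S<G (sym eq))
    go 𝕃 𝕄 eq = ⊥-elim (ℕ.<⇒≢ M<L (sym eq))
    go 𝔾 𝕄 eq = ⊥-elim (ℕ.<⇒≢ M<G (sym eq))
    go 𝔾 𝕃 eq = ⊥-elim (ℕ.<⇒≢ L<G (sym eq))

-- From cycles of states to orbits of rowmotion

module _ {n : ℕ} {_≼_ : Rel (Fin n) 0ℓ} (isDPO : IsDecPartialOrder _≡_ _≼_) where

  open Rowmotion isDPO

  generate⁻¹-commutes : ∀ J → generate⁻¹ (ρ̂ J) ≡ ρ (generate⁻¹ J)
  generate⁻¹-commutes J = trans (generate⁻¹∘generate (minimals (∁ (value J)) , [ minimals-isAntichain (∁ (value J)) ]))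
    (antichain-≡ (cong (minimals ∘ ∁ ∘ value) (sym (generate∘generate⁻¹ J))))
    where
    antichain-≡ : {A B : Antichain} → value A ≡ value B → A ≡ B
    antichain-≡ {_ , _} {_ , _} refl = refl

  -- The way back from ideals to antichains keeps the length of an orbit, and `χ̂` of the result is
  -- the original total. Homometry for `ρ̂` thus becomes a statement about the orbits of `ρ`.
  antichainOrbit : Orbit ρ̂ → Orbit ρ
  antichainOrbit = mapOrbit generate⁻¹ generate generate∘generate⁻¹ generate⁻¹∘generate generate⁻¹-commutes

  χ̂-antichainOrbit : ∀ O → χ̂ (antichainOrbit O) ≡ total size O
  χ̂-antichainOrbit O = cong (sum ∘ map size) (trans (sym (List.map-∘ (elements O)))
    (trans (List.map-cong generate∘generate⁻¹ (elements O)) (List.map-id (elements O))))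

  homometric-ρ̂ : (∀ O₁ O₂ → # O₁ ≡ # O₂ → χ̂ O₁ ≡ χ̂ O₂) → Homometric ρ̂ size
  homometric-ρ̂ homometric O₁ O₂ eq = trans (sym (χ̂-antichainOrbit O₁))
    (trans (homometric (antichainOrbit O₁) (antichainOrbit O₂)
      (trans (List.length-map generate⁻¹ (elements O₁)) (trans eq (sym (List.length-map generate⁻¹ (elements O₂))))))
    (χ̂-antichainOrbit O₂))

module Orbits (c : ℕ) where

  open Sizes c public

  cycᴬ : Name → List Antichain
  cycᴬ j = map φ (cyc j)

  cycᴬ-path : ∀ j → Path (Graph ρ) (φ (first j)) (cycᴬ j) (φ (first j))
  cycᴬ-path j = mapᴾ φ ρ-step (path j)

  name : Antichain → Name
  name A = let _ , valid , _ = φ-surjective A in proj₁ (cover valid)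

  cover-name : ∀ A → A List.∈ cycᴬ (name A)
  cover-name A = let _ , valid , φq≡A = φ-surjective A in
    subst (List._∈ cycᴬ (name A)) φq≡A (List.∈-map⁺ φ (proj₂ (cover valid)))

  -- Injectivity of `φ` is available on valid states, and all entries of the cycles are valid
  -- because the cycles rearrange `states`.
  distinct : Unique (concatMap cycᴬ names)
  distinct = subst Unique (List.map-concatMap φ cyc names) (unique-map φ
    (λ q∈ r∈ → φ-injective (states-valid (Perm.∈-resp-↭ (↭-sym cycles-↭-states) q∈))
                           (states-valid (Perm.∈-resp-↭ (↭-sym cycles-↭-states) r∈)))
    cycles-unique)

  open Cycles (φ ∘ first) cycᴬ names (λ j → List.∈-map⁺ φ (first∈ j)) cycᴬ-path
              name (all-names ∘ name) cover-name all-names distinct public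

  χ-cycle : ∀ j → sum (map size (cycᴬ j)) ≡ antichainValue (kind j)
  χ-cycle j = begin
    -- Passing to the images under `ρ` replaces the maximal elements of each ideal by the minimal
    -- elements of its complement, whose number is a sum of local contributions.
    sum (map size (cycᴬ j))                                   ≡⟨ cycle-total-next size (cycᴬ-path j) ⟩
    sum (map (size ∘ ρ) (map φ (cyc j)))                      ≡⟨ cong sum (List.map-∘ (cyc j)) ⟨
    sum (map (size ∘ ρ ∘ φ) (cyc j))                          ≡⟨ cong sum (List.map-cong-local (All.tabulate (λ q∈ → size-ρ (cycles-valid {j} q∈)))) ⟩
    sum (map (Stat.weight antichainStat) (cyc j))             ≡⟨ Aᵗ.total-cyc j ⟩
    Aᵗ.kindTotal (kind j)                                        ≡⟨ antichain-total (kind j) ⟩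
    antichainValue (kind j)                                   ∎
    where open ≡-Reasoning

  χ̂-cycle : ∀ j → sum (map size (map generate (cycᴬ j))) ≡ idealValue (kind j)
  χ̂-cycle j = begin
    sum (map size (map generate (cycᴬ j)))        ≡⟨ cong (sum ∘ map size) (List.map-∘ (cyc j)) ⟨
    sum (map size (map (generate ∘ φ) (cyc j)))   ≡⟨ cong (sum ∘ map size) (List.map-cong (generate∘generate⁻¹ ∘ ideal) (cyc j)) ⟩
    sum (map size (map ideal (cyc j)))            ≡⟨ cong sum (List.map-∘ (cyc j)) ⟨
    sum (map (size ∘ ideal) (cyc j))              ≡⟨ cong sum (List.map-cong size-ideal (cyc j)) ⟩
    sum (map (Stat.weight idealStat) (cyc j))     ≡⟨ Iᵗ.total-cyc j ⟩
    Iᵗ.kindTotal (kind j)                            ≡⟨ ideal-total (kind j) ⟩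
    idealValue (kind j)                           ∎
    where open ≡-Reasoning

  infix 4 _HasKind_

  record _HasKind_ (O : Orbit ρ) (κ : Kind) : Set where
    field
      #-≡ : # O ≡ sizeValue κ
      χ-≡ : χ O ≡ antichainValue κ
      χ̂-≡ : χ̂ O ≡ idealValue κ

  open _HasKind_ public

  cycle-kind : ∀ O j → Setoid._≈_ (OrbitSetoid ρ) O (cycle j) → O HasKind kind j
  cycle-kind O j eq = record
    { #-≡ = trans (Perm.↭-length O↭) (trans (List.length-map φ (cyc j)) (trans (length-cyc j) (orbitSize-value (kind j))))
    ; χ-≡ = trans (sum-map-↭ size O↭) (χ-cycle j)
    ; χ̂-≡ = trans (sum-map-↭ size (Perm.map⁺ generate O↭)) (χ̂-cycle j)
    }
    where
    O↭ : elements O ↭ cycᴬ j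
    O↭ = ≈ₒ⇒↭ O (cycle j) (λ {x} → eq {x})

  orbit-kind : ∀ O → ∃ λ κ → O HasKind κ
  orbit-kind O = kind (name (Orbit.base O)) , cycle-kind O (name (Orbit.base O)) (λ {x} → cycle-index O {x})

  block-kind : ∀ {κ} js → (∀ {j} → j List.∈ js → kind j ≡ κ) → ∀ O → O ∈ₒ map cycle js → O HasKind κ
  block-kind js js-kind O O∈ = let j , j∈ , eq = find (Any.map⁻ O∈) in
    subst (O HasKind_) (js-kind j∈) (cycle-kind O j (λ {x} → eq {x}))

  kind-unique : ∀ {O₁ O₂ κ₁ κ₂} → O₁ HasKind κ₁ → O₂ HasKind κ₂ → # O₁ ≡ # O₂ → κ₁ ≡ κ₂
  kind-unique {κ₁ = κ₁} {κ₂} k₁ k₂ eq = orbitSize-injective κ₁ κ₂ (trans (orbitSize-value κ₁)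
    (trans (sym (#-≡ k₁)) (trans eq (trans (#-≡ k₂) (sym (orbitSize-value κ₂))))))

  homometric-χ : Homometric ρ size
  homometric-χ O₁ O₂ eq = let κ₁ , k₁ = orbit-kind O₁ ; κ₂ , k₂ = orbit-kind O₂ in
    trans (χ-≡ k₁) (trans (cong antichainValue (kind-unique k₁ k₂ eq)) (sym (χ-≡ k₂)))

  homometric-χ̂ : ∀ O₁ O₂ → # O₁ ≡ # O₂ → χ̂ O₁ ≡ χ̂ O₂
  homometric-χ̂ O₁ O₂ eq = let κ₁ , k₁ = orbit-kind O₁ ; κ₂ , k₂ = orbit-kind O₂ in
    trans (χ̂-≡ k₁) (trans (cong idealValue (kind-unique k₁ k₂ eq)) (sym (χ̂-≡ k₂)))

  partitions : PartitionsOrbits ρ (map cycle namesS ∷ map cycle namesM ∷ map cycle namesL ∷ map cycle namesG ∷ [])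
  partitions = subst (UniqueSetoid.Unique (OrbitSetoid ρ)) (sym blocks)
      (UniqueSetoid.map⁺ (setoid Name) (OrbitSetoid ρ) (λ {i} {j} eq → cycle-injective {i} {j} (λ {x} → eq {x})) names-unique)
    , λ O → subst (O ∈ₒ_) (sym blocks) (Any.map⁺ (Any.map (λ { refl {x} → cycle-index O {x} }) (all-names (name (Orbit.base O)))))
    where
    blocks : concat (map cycle namesS ∷ map cycle namesM ∷ map cycle namesL ∷ map cycle namesG ∷ []) ≡ map cycle names
    blocks = List.concat-map (namesS ∷ namesM ∷ namesL ∷ namesG ∷ [])

  length-block-map : ∀ js {n} → length js ≡ n → length (map cycle js) ≡ n
  length-block-map js eq = trans (List.length-map cycle js) eq

theorem4p5 : (a : ℕ) → 2 ≤ a → let open Fence a in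
    ∃[ 𝒮 ] ∃[ ℳ ] ∃[ ℒ ] ∃[ 𝒢 ]
    PartitionsOrbits ρ (𝒮 ∷ ℳ ∷ ℒ ∷ 𝒢 ∷ [])
    × (length 𝒮 ≡ (a ∸ 1) ^ 3 × length ℳ ≡ a × length ℒ ≡ 1 × length 𝒢 ≡ a ∸ 1)
    × (∀ (O : Orbit ρ) →
    (O ∈ₒ 𝒮 → # O ≡ a)
    × (O ∈ₒ ℳ → # O ≡ a + 1)
    × (O ∈ₒ ℒ → # O ≡ a ^ 2 + a + 1)
    × (O ∈ₒ 𝒢 → # O ≡ 3 * a ^ 2 + a))
    × Homometric ρ size
    × Homometric ρ̂ size
    × (∀ (O : Orbit ρ) →
    (O ∈ₒ 𝒮 → χ O ≡ 4 * a ∸ 4)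
    × (O ∈ₒ ℳ → χ O ≡ 4 * a ∸ 2)
    × (O ∈ₒ ℒ → χ O ≡ 4 * a ^ 2 ∸ a)
    × (O ∈ₒ 𝒢 → χ O ≡ (12 * a ^ 2 ∸ 11 * a) + 2))
    × (∀ (O : Orbit ρ) →
    (O ∈ₒ 𝒮 → χ̂ O ≡ 2 * a ^ 2 ∸ a)
    × (O ∈ₒ ℳ → χ̂ O ≡ (2 * a ^ 2 + 3 * a) ∸ 1)
    × (O ∈ₒ ℒ → χ̂ O ≡ (2 * a ^ 3 + 3 * a) ∸ 1)
    × (O ∈ₒ 𝒢 → χ̂ O ≡ 6 * a ^ 3 ∸ a))
theorem4p5 (suc zero) (s≤s ())
theorem4p5 (suc (suc c)) _ =
  map cycle namesS , map cycle namesM , map cycle namesL , map cycle namesG , partitions ,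
  (length-block-map namesS length-namesS , length-block-map namesM length-namesM , refl , length-block-map namesG length-namesG) ,
  (λ O → #-≡ ∘ S′ O , #-≡ ∘ M′ O , #-≡ ∘ L′ O , #-≡ ∘ G′ O) ,
  homometric-χ , homometric-ρ̂ ≼-isDecPartialOrder homometric-χ̂ ,
  (λ O → χ-≡ ∘ S′ O , χ-≡ ∘ M′ O , χ-≡ ∘ L′ O , χ-≡ ∘ G′ O) ,
  (λ O → χ̂-≡ ∘ S′ O , χ̂-≡ ∘ M′ O , χ̂-≡ ∘ L′ O , χ̂-≡ ∘ G′ O)
  where
  open Orbits c
  S′ = block-kind {𝕊} namesS kindS
  M′ = block-kind {𝕄} namesM kindM
  L′ = block-kind {𝕃} namesL kindL
  G′ = block-kind {𝔾} namesG kindG
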